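{- Let $N\ge 3$ and $k\ge 3$ be integers, let $\Gamma=\gamma_k\times\gamma_N$ be the non-skew toroidal grid constructed from $N$-cycles (the Cartesian product of a cycle on $k$ vertices and a cycle on $N$ vertices), and let $G=\Gamma\setminus v$ be the graph obtained from $\Gamma$ by deleting one vertex $v$ together with its incident edges. Suppose $|V(G)|\ge 3N-1$. Then $c_2^{(2)}(G)=0$.
   Context: $\gamma_i$ denotes the cycle on $i$ vertices. The non-skew toroidal grid indexed by $(k,0)$ and $(0,N)$, with $k,N\ge 3$, is the integer lattice (edges joining points at distance $1$) modulo identification of points whose difference is $(k,0)$ or $(0,N)$; it is the Cartesian product $\gamma_k\times\gamma_N$. It is 4-regular and all its vertices are equivalent under automorphisms. Deleting a vertex from a connected 4-regular graph is called decompletion. For a connected graph $G$, assign a variable $\alpha_e$ to each edge $e$. The Kirchhoff polynomial is $\Psi_G=\sum_T\prod_{e\notin T}\alpha_e$, the sum running over all spanning trees $T$ of $G$. For a prime $p$, $[\Psi_G]_p$ is the number of zeros of $\Psi_G$ in $\mathbb{F}_p^{|E(G)|}$. If $G$ has at least 3 vertices, then $[\Psi_G]_p$ is divisible by $p^2$, and the $c_2$ invariant of $G$ at $p$ is $c_2^{(p)}(G)=\frac{[\Psi_G]_p}{p^2}\bmod p$. -}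

module Defs where

open import Data.Fin.Base using (Fin; zero; suc; toℕ; fromℕ<)
open import Data.Fin.Properties using (injective⇒≤; toℕ-fromℕ<) renaming (any? to anyFin?; _≟_ to _≟ᶠ_)
open import Data.Fin.Subset using (Subset; inside; outside) renaming (_∈_ to _∈ˢ_)
open import Data.Fin.Subset.Properties using () renaming (_∈?_ to _∈ˢ?_)
open import Data.List.Base using (List; []; _∷_; _++_; map; filter; length; lookup; allFin; cartesianProduct; cartesianProductWith)
open import Data.List.Membership.Propositional using (_∈_; find; lose)
open import Data.List.Membership.Propositional.Properties using (∈-allFin; ∈-map⁻; ∈-cartesianProduct⁺; ∈-cartesianProduct⁻; ∈-filter⁺; ∈-filter⁻; ∈-++⁻; ∈-lookup)
open import Data.List.Relation.Unary.All using (all?) renaming (lookup to lookupAll; tabulate to tabulateAll)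
import Data.List.Relation.Unary.AllPairs as AllPairs
open import Data.List.Relation.Unary.Any using (here; there; any?)
open import Data.List.Relation.Unary.Unique.Propositional using (Unique)
open import Data.List.Relation.Unary.Unique.Propositional.Properties using (allFin⁺; cartesianProduct⁺; filter⁺)
import Data.List.Relation.Unary.Unique.DecPropositional as DecUnique
open import Data.Nat.Base using (ℕ; zero; suc; _^_; _<_; s≤s; NonZero)
open import Data.Nat.ListAction using (sum; product)
open import Data.Nat.Properties using (m^n≢0; _<?_)
open import Data.Nat.Divisibility using (_∣?_)
open import Data.Nat.DivMod using (_/_; _%_; _mod_)
open import Data.Product.Base using (Σ; ∃; _×_; _,_; proj₁; proj₂)
open import Data.Product.Properties using () renaming (≡-dec to ×-≡-dec)
open import Data.Sum.Base using (_⊎_; inj₁; inj₂)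
open import Data.Vec.Base using (Vec; []; _∷_) renaming (lookup to lookupᵛ)
open import Function.Base using (_∘_)
open import Relation.Binary.Definitions using (DecidableEquality)
open import Relation.Binary.PropositionalEquality using (_≡_; _≢_; refl; sym; cong; subst)
open import Relation.Nullary using (¬_; Dec; contradiction)
open import Relation.Nullary.Decidable using (map′; ¬?; _×-dec_; _⊎-dec_)

-- A finite graph.  Parallel edges and loops are allowed; each edge is listed
-- once, as a pair of ends whose order carries no meaning.  Only the elements
-- of 'vertices' are vertices of the graph: 'Vertex' is merely their type, so
-- that deleting a vertex does not change it.
record Graph : Set₁ where
  infix 4 _≟_
  field
    Vertex   : Set
    _≟_      : DecidableEquality Vertex
    vertices : List Vertex
    unique   : Unique vertices
    edges    : List (Vertex × Vertex)
    incident : ∀ {u v} → (u , v) ∈ edges → u ∈ vertices × v ∈ vertices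

  ∣V∣ : ℕ
  ∣V∣ = length vertices

  ∣E∣ : ℕ
  ∣E∣ = length edges

  -- Edges are identified by their position, so parallel edges stay distinct.
  Edge : Set
  Edge = Fin ∣E∣

  ends : Edge → Vertex × Vertex
  ends = lookup edges

sucMod : ∀ {n} → Fin n → Fin n
sucMod {suc n} i = suc (toℕ i) mod suc n

-- The cycle on n vertices (for n = 1, 2 it is a loop and a double edge).
γ : ℕ → Graph
γ n = record
  { Vertex   = Fin n
  ; _≟_      = _≟ᶠ_
  ; vertices = allFin n
  ; unique   = allFin⁺ n
  ; edges    = map (λ i → i , sucMod i) (allFin n)
  ; incident = λ _ → ∈-allFin _ , ∈-allFin _
  }

infixl 7 _□_

-- The Cartesian product: (g , h) and (g′ , h′) are adjacent when g = g′ and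
-- hh′ is an edge, or gg′ is an edge and h = h′.
_□_ : Graph → Graph → Graph
G □ H = record
  { Vertex   = G.Vertex × H.Vertex
  ; _≟_      = ×-≡-dec G._≟_ H._≟_
  ; vertices = cartesianProduct G.vertices H.vertices
  ; unique   = cartesianProduct⁺ G.unique H.unique
  ; edges    = map inH gh ++ map inG hg
  ; incident = inc
  }
  where
  module G = Graph G
  module H = Graph H
  gh = cartesianProduct G.vertices H.edges
  hg = cartesianProduct G.edges H.vertices
  inH : G.Vertex × (H.Vertex × H.Vertex) → (G.Vertex × H.Vertex) × (G.Vertex × H.Vertex)
  inH (g , (h , h′)) = (g , h) , (g , h′)
  inG : (G.Vertex × G.Vertex) × H.Vertex → (G.Vertex × H.Vertex) × (G.Vertex × H.Vertex)
  inG ((g , g′) , h) = (g , h) , (g′ , h)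
  inc : ∀ {u v} → (u , v) ∈ map inH gh ++ map inG hg →
        u ∈ cartesianProduct G.vertices H.vertices ×
        v ∈ cartesianProduct G.vertices H.vertices
  inc e∈ with ∈-++⁻ (map inH gh) e∈
  ... | inj₁ p with ∈-map⁻ inH p
  ...   | _ , q , refl with ∈-cartesianProduct⁻ G.vertices H.edges q
  ...     | g∈ , e∈H = ∈-cartesianProduct⁺ g∈ (proj₁ (H.incident e∈H))
                     , ∈-cartesianProduct⁺ g∈ (proj₂ (H.incident e∈H))
  inc e∈ | inj₂ p with ∈-map⁻ inG p
  ...   | _ , q , refl with ∈-cartesianProduct⁻ G.edges H.vertices q
  ...     | e∈G , h∈ = ∈-cartesianProduct⁺ (proj₁ (G.incident e∈G)) h∈
                     , ∈-cartesianProduct⁺ (proj₂ (G.incident e∈G)) h∈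

infixl 6 _∖_

_∖_ : (G : Graph) → Graph.Vertex G → Graph
G ∖ v = record
  { Vertex   = Vertex
  ; _≟_      = _≟_
  ; vertices = filter ≢v? vertices
  ; unique   = filter⁺ ≢v? unique
  ; edges    = filter avoids? edges
  ; incident = λ e∈ → let e∈G , a , b = ∈-filter⁻ avoids? e∈
                          u∈ , w∈     = incident e∈G
                      in ∈-filter⁺ ≢v? u∈ a , ∈-filter⁺ ≢v? w∈ b
  }
  where
  open Graph G
  ≢v? : ∀ u → Dec (u ≢ v)
  ≢v? u = ¬? (u ≟ v)
  avoids? : ∀ e → Dec (proj₁ e ≢ v × proj₂ e ≢ v)
  avoids? (a , b) = ≢v? a ×-dec ≢v? b

module _ (G : Graph) where
  open Graph G

  Joins : Edge → Vertex → Vertex → Set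
  Joins e u w = ends e ≡ (u , w) ⊎ ends e ≡ (w , u)

  -- Walks all of whose edges satisfy P.
  data Walk (P : Edge → Set) : Vertex → Vertex → Set where
    stop : ∀ {u} → Walk P u u
    step : ∀ {u w v} (e : Edge) → P e → Joins e u w → Walk P w v → Walk P u v

module _ {G : Graph} where
  open Graph G

  walkEdges : ∀ {P u v} → Walk G P u v → List Edge
  walkEdges stop           = []
  walkEdges (step e _ _ w) = e ∷ walkEdges w

  -- The vertices visited, apart from the last one.
  walkSources : ∀ {P u v} → Walk G P u v → List Vertex
  walkSources stop                   = []
  walkSources (step {u = u} _ _ _ w) = u ∷ walkSources w

  -- Distinct edges exclude going back and forth along one edge; cycles of
  -- length 1 (loops) and 2 (parallel edges) do count.
  IsCycle : ∀ {P u} → Walk G P u u → Set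
  IsCycle w = 0 < length (walkEdges w) × Unique (walkEdges w) × Unique (walkSources w)

module _ (G : Graph) where
  open Graph G

  Connected : (Edge → Set) → Set
  Connected P = ∀ {u v} → u ∈ vertices → v ∈ vertices → Walk G P u v

  Acyclic : (Edge → Set) → Set
  Acyclic P = ∀ {u} (w : Walk G P u u) → ¬ IsCycle w

  IsSpanningTree : Subset ∣E∣ → Set
  IsSpanningTree T = Connected (_∈ˢ T) × Acyclic (_∈ˢ T)

private
  lookup-injective : ∀ {A : Set} {xs : List A} → Unique xs →
                     ∀ {i j} → lookup xs i ≡ lookup xs j → i ≡ j
  lookup-injective {xs = _ ∷ _} _                   {zero}  {zero}  _  = refl
  lookup-injective {xs = _ ∷ _} (x∉ AllPairs.∷ _)   {zero}  {suc j} eq = contradiction eq (lookupAll x∉ (∈-lookup j))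
  lookup-injective {xs = _ ∷ _} (x∉ AllPairs.∷ _)   {suc i} {zero}  eq = contradiction (sym eq) (lookupAll x∉ (∈-lookup i))
  lookup-injective {xs = _ ∷ _} (_  AllPairs.∷ xs!) {suc i} {suc j} eq = cong suc (lookup-injective xs! eq)

module _ {G : Graph} where
  open Graph G

  private
    mapWalk : ∀ {P Q : Edge → Set} → (∀ {e} → P e → Q e) →
              ∀ {u v} → Walk G P u v → Walk G Q u v
    mapWalk f stop           = stop
    mapWalk f (step e p j w) = step e (f p) j (mapWalk f w)

    _++ʷ_ : ∀ {P u v w} → Walk G P u v → Walk G P v w → Walk G P u w
    stop         ++ʷ w′ = w′
    step e p j w ++ʷ w′ = step e p j (w ++ʷ w′)

    -- A walk using e and es either avoids e, or may be taken to use it once.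
    Split : Edge → List Edge → Vertex → Vertex → Set
    Split e es u v =
      Walk G (_∈ es) u v ⊎
      (Walk G (_∈ es) u (proj₁ (ends e)) × Walk G (_∈ es) (proj₂ (ends e)) v) ⊎
      (Walk G (_∈ es) u (proj₂ (ends e)) × Walk G (_∈ es) (proj₁ (ends e)) v)

    join : ∀ {e es u v} → Split e es u v → Walk G (_∈ e ∷ es) u v
    join (inj₁ w)               = mapWalk there w
    join (inj₂ (inj₁ (w , w′))) = mapWalk there w ++ʷ step _ (here refl) (inj₁ refl) (mapWalk there w′)
    join (inj₂ (inj₂ (w , w′))) = mapWalk there w ++ʷ step _ (here refl) (inj₂ refl) (mapWalk there w′)

    split : ∀ {e es u v} → Walk G (_∈ e ∷ es) u v → Split e es u v
    split stop = inj₁ stop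
    split (step f (there p) j w) with split w
    ... | inj₁ a               = inj₁ (step f p j a)
    ... | inj₂ (inj₁ (a , b))  = inj₂ (inj₁ (step f p j a , b))
    ... | inj₂ (inj₂ (a , b))  = inj₂ (inj₂ (step f p j a , b))
    split (step f (here refl) (inj₁ j) w) with ends f | j | split w
    ... | _ | refl | inj₁ a              = inj₂ (inj₁ (stop , a))
    ... | _ | refl | inj₂ (inj₁ (_ , b)) = inj₂ (inj₁ (stop , b))
    ... | _ | refl | inj₂ (inj₂ (_ , b)) = inj₁ b
    split (step f (here refl) (inj₂ j) w) with ends f | j | split w
    ... | _ | refl | inj₁ a              = inj₂ (inj₂ (stop , a))
    ... | _ | refl | inj₂ (inj₁ (_ , b)) = inj₁ b
    ... | _ | refl | inj₂ (inj₂ (_ , b)) = inj₂ (inj₂ (stop , b))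

    walkWithin? : ∀ es u v → Dec (Walk G (_∈ es) u v)
    walkWithin? [] u v = map′ (λ { refl → stop }) (λ { stop → refl }) (u ≟ v)
    walkWithin? (e ∷ es) u v = map′ join split
      (walkWithin? es u v ⊎-dec
       (walkWithin? es u _ ×-dec walkWithin? es _ v) ⊎-dec
       (walkWithin? es u _ ×-dec walkWithin? es _ v))

  module _ {P : Edge → Set} (P? : ∀ e → Dec (P e)) where

    walk? : ∀ u v → Dec (Walk G P u v)
    walk? u v = map′ (mapWalk (proj₂ ∘ ∈-filter⁻ P? {xs = allFin _}))
                     (mapWalk (∈-filter⁺ P? (∈-allFin _)))
                     (walkWithin? (filter P? (allFin ∣E∣)) u v)

    connected? : Dec (Connected G P)
    connected? = map′ (λ a u∈ v∈ → lookupAll (lookupAll a u∈) v∈)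
                      (λ c → tabulateAll (λ u∈ → tabulateAll (λ v∈ → c u∈ v∈)))
                      (all? (λ u → all? (walk? u) vertices) vertices)

    private
      WalkWith : ℕ → (List Edge → List Vertex → Set) → Vertex → Vertex → Set
      WalkWith n Q u v = Σ (Walk G P u v) λ w →
        length (walkEdges w) ≡ n × Q (walkEdges w) (walkSources w)

      walkWith? : ∀ n {Q : List Edge → List Vertex → Set} →
                  (∀ es us → Dec (Q es us)) → ∀ u v → Dec (WalkWith n Q u v)
      walkWith? zero Q? u v = map′
        (λ { (refl , q) → stop , refl , q })
        (λ { (stop , _ , q) → refl , q })
        (u ≟ v ×-dec Q? [] [])
      walkWith? (suc n) {Q} Q? u v = map′ to from
        (anyFin? λ e → P? e ×-dec
          ((proj₁ (ends e) ≟ u ×-dec walkWith? n (λ es us → Q? (e ∷ es) (u ∷ us)) (proj₂ (ends e)) v) ⊎-dec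
           (proj₂ (ends e) ≟ u ×-dec walkWith? n (λ es us → Q? (e ∷ es) (u ∷ us)) (proj₁ (ends e)) v)))
        where
        First : Edge → Set
        First e = P e ×
          ((proj₁ (ends e) ≡ u × WalkWith n (λ es us → Q (e ∷ es) (u ∷ us)) (proj₂ (ends e)) v) ⊎
           (proj₂ (ends e) ≡ u × WalkWith n (λ es us → Q (e ∷ es) (u ∷ us)) (proj₁ (ends e)) v))
        to : ∃ First → WalkWith (suc n) Q u v
        to (e , p , inj₁ (refl , w , l , q)) = step e p (inj₁ refl) w , cong suc l , q
        to (e , p , inj₂ (refl , w , l , q)) = step e p (inj₂ refl) w , cong suc l , q
        from : WalkWith (suc n) Q u v → ∃ First
        from (step e p (inj₁ j) w , refl , q) = e , p , inj₁ (cong proj₁ j ,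
          subst (λ x → WalkWith n (λ es us → Q (e ∷ es) (u ∷ us)) (proj₂ x) v) (sym j) (w , refl , q))
        from (step e p (inj₂ j) w , refl , q) = e , p , inj₂ (cong proj₂ j ,
          subst (λ x → WalkWith n (λ es us → Q (e ∷ es) (u ∷ us)) (proj₁ x) v) (sym j) (w , refl , q))

      Cyclic : List Edge → List Vertex → Set
      Cyclic es us = 0 < length es × Unique es × Unique us

      cyclic? : ∀ es us → Dec (Cyclic es us)
      cyclic? es us = 0 <? length es ×-dec
        (DecUnique.unique? _≟ᶠ_ es ×-dec DecUnique.unique? _≟_ us)

      CycleAt : Vertex → Set
      CycleAt u = ∃ λ (i : Fin (suc ∣E∣)) → WalkWith (toℕ i) Cyclic u u

      source∈ : ∀ {u} (w : Walk G P u u) → IsCycle w → u ∈ vertices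
      source∈ (step e _ (inj₁ j) _) _ = proj₁ (incident (subst (_∈ edges) j (∈-lookup e)))
      source∈ (step e _ (inj₂ j) _) _ = proj₂ (incident (subst (_∈ edges) j (∈-lookup e)))
      source∈ stop (() , _)

      cycleAt : ∀ {u} (w : Walk G P u u) → IsCycle w → CycleAt u
      cycleAt w c@(_ , es! , _) = fromℕ< l< , w , sym (toℕ-fromℕ< l<) , c
        where
        l< : length (walkEdges w) < suc ∣E∣
        l< = s≤s (injective⇒≤ (lookup-injective es!))

    acyclic? : Dec (Acyclic G P)
    acyclic? = map′
      (λ no-cycle w c → no-cycle (lose (source∈ w c) (cycleAt w c)))
      (λ acyclic any → let _ , _ , _ , w , _ , c = find {P = CycleAt} any in acyclic w c)
      (¬? (any? (λ u → anyFin? λ i → walkWith? (toℕ i) cyclic? u u) vertices))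

isSpanningTree? : ∀ G T → Dec (IsSpanningTree G T)
isSpanningTree? G T = connected? (_∈ˢ? T) ×-dec acyclic? {G} (_∈ˢ? T)

allVecs : {A : Set} → List A → ∀ n → List (Vec A n)
allVecs xs zero    = [] ∷ []
allVecs xs (suc n) = cartesianProductWith _∷_ xs (allVecs xs n)

module _ (G : Graph) where
  open Graph G

  spanningTrees : List (Subset ∣E∣)
  spanningTrees = filter (isSpanningTree? G) (allVecs (outside ∷ inside ∷ []) ∣E∣)

  Ψ : (Edge → ℕ) → ℕ
  Ψ α = sum (map (λ T → product (map α (filter (λ e → ¬? (e ∈ˢ? T)) (allFin ∣E∣)))) spanningTrees)

  -- The number of zeros of Ψ over the field with p elements (p prime), whose
  -- elements are given by their representatives 0, …, p - 1.  As Ψ has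
  -- natural-number coefficients, its value at a point is the residue of its
  -- value at the representatives.
  zeros : ℕ → ℕ
  zeros p = length (filter (λ α → p ∣? Ψ (toℕ ∘ lookupᵛ α)) (allVecs (allFin p) ∣E∣))

-- The residue is represented by an element of {0, …, p - 1}.  For p prime and
-- G with at least 3 vertices, the division by p ^ 2 is exact.
c₂ : (p : ℕ) .{{_ : NonZero p}} → Graph → ℕ
c₂ p G = (zeros G p / p ^ 2) {{m^n≢0 p 2}} % p

module Submission where

-- Over F₂, Ψ(α) is odd exactly when the linear system ∂y = 0, δx = αy in
-- potentials x (vanishing at a base vertex w) and currents y has only the zero
-- solution: the number of its solutions has the parity of the number of
-- spanning trees whose complement lies in the support of α.  This follows from
-- a Chevalley-Warning argument: the sum over F₂^M of a product of at most M
-- affine functions does not depend on their constant terms.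
--
-- Take for w a neighbour of the deleted vertex.  It has degree three in G; let
-- e₁, e₂, e₃ be its edges and a, b, c its neighbours.  For given weights on the
-- other edges, the possible potentials at a, b, c and currents through e₁, e₂,
-- e₃ form a Lagrangian subspace (if solutions are determined by these values),
-- and going through the Lagrangian planes of F₂⁴ shows that Ψ vanishes at 0, 4
-- or 8 of the 8 choices of weights on e₁, e₂, e₃.  So zeros G 2 = 4 q, and one
-- needs that the number of weightings for which it vanishes at 4 choices is
-- even.
--
-- The reflection ρ of the torus that fixes the deleted vertex and w pairs off
-- the weightings that are not ρ-invariant.  The ρ-invariant ones contribute
-- the parity of the number of triples (α , x , y) with α invariant, ∂y = 0 and
-- δx = αy, where x vanishes at a, b and w, and y vanishes on e₁, e₂, e₃.  For
-- fixed y these conditions are linear in (x , α), and there are fewer of them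
-- than unknowns because ρ fixes at least three edges (this uses k ≥ 3).  Hence
-- the number of solutions is even.

open import Defs
open import Data.Nat using (ℕ; _*_; _∸_; _≥_)
open import Relation.Binary.PropositionalEquality using (_≡_)
open import Data.Bool.Base using (Bool; T; _∧_; _∨_; false; if_then_else_; not; true) renaming (_xor_ to infixr 5 _⊕_)
open import Data.Bool.Properties using (xor-assoc; xor-comm; xor-identityʳ; xor-same; ∧-assoc; ∧-comm; ∧-distribʳ-xor; ∧-distribˡ-xor; ∧-zeroʳ; ∨-zeroʳ)
open import Data.Fin.Base using (Fin; _↑ʳ_; _↑ˡ_; suc; toℕ; zero)
open import Data.Fin.Properties using (injective⇒≤; toℕ-fromℕ<; toℕ-injective; toℕ<n) renaming (_≟_ to _≟ᶠ_)
open import Data.Fin.Subset using (Subset; inside; outside) renaming (_∈_ to _∈ˢ_)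
open import Data.Fin.Subset.Properties using () renaming (_∈?_ to _∈ˢ?_)
open import Data.List.Base using (List; []; _∷_; allFin; cartesianProduct; filter; length; map) renaming (_++_ to _++ˡ_; lookup to lookupˡ; tabulate to tabulateˡ)
open import Data.List.Membership.Propositional using (_∈_; lose)
open import Data.List.Membership.Propositional.Properties using (∈-++⁺ʳ; ∈-++⁺ˡ; ∈-++⁻; ∈-allFin; ∈-cartesianProduct⁺; ∈-filter⁺; ∈-filter⁻; ∈-lookup; ∈-map⁺; ∈-map⁻)
open import Data.List.Properties using (filter-notAll; length-++; length-map; length-tabulate; map-++; map-tabulate; map-∘)
open import Data.List.Relation.Binary.Disjoint.Propositional using (Disjoint)
open import Data.List.Relation.Unary.All using ([]; _∷_) renaming (lookup to lookupAll; tabulate to tabulateAll)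
open import Data.List.Relation.Unary.AllPairs using ([]; _∷_)
open import Data.List.Relation.Unary.Any using (here; index; there)
open import Data.List.Relation.Unary.Any.Properties using (lookup-index)
open import Data.List.Relation.Unary.Unique.Propositional using (Unique)
open import Data.Nat.Base using (_+_; _<_; _≡ᵇ_; _≤_; suc; s≤s; zero; z≤n)
open import Data.Nat.DivMod using (%-distribˡ-+; [m+n]%n≡m%n; _%_; _/_; _mod_; m%n%n≡m%n; m%n<n; m*n%n≡0; m*n/n≡m; m<n⇒m%n≡m)
open import Data.Nat.Divisibility using (_∣?_; _∣_; divides)
open import Data.Nat.ListAction using (product; sum)
open import Data.Nat.Properties using (*-cancelˡ-<; *-comm; *-distribˡ-+; +-assoc; +-cancelʳ-≤; +-comm; +-identityʳ; +-mono-≤; +-monoʳ-<; +-monoˡ-≤; +-suc; <-asym; <-cmp; <-irrefl; <⇒≤; _<?_; m<m+n; module ≤-Reasoning; m∸n+n≡m; ≡ᵇ⇒≡; ≤-reflexive; ≤-trans)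
open import Data.Nat.Solver using (module +-*-Solver)
open import Data.Product.Base using (_,_; _×_; proj₁; proj₂; ∃)
open import Data.Sum.Base using ([_,_]′; _⊎_; inj₁; inj₂)
open import Data.Unit.Base using (tt)
open import Data.Vec.Base using (Vec; []; _++_; _[_]≔_; _∷_; head; lookup; replicate; tabulate; tail; zipWith)
open import Data.Vec.Properties using ([]=⇒lookup; lookup-++ʳ; lookup-++ˡ; lookup-map; lookup-replicate; lookup-zipWith; lookup⇒[]=; lookup∘tabulate; lookup∘update; lookup∘update′; tabulate-cong; tabulate∘lookup)
open import Function.Base using (_∘_)
open import Relation.Binary.Definitions using (tri<; tri>; tri≈)
open import Relation.Binary.PropositionalEquality using (_≢_; cong; cong₂; module ≡-Reasoning; refl; subst; sym; trans)
open import Relation.Nullary using (Dec; contradiction; does; no; yes; ¬_)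
open import Relation.Nullary.Decidable using (_×-dec_; dec-false; dec-true; ¬?)
import Data.List.Membership.DecPropositional as DecMembership
import Data.List.Relation.Unary.Unique.Propositional.Properties as Unique
import Data.Vec.Base as Vec

-- Whether Ψ vanishes at exactly four of the eight choices is not a linear condition on the
-- Lagrangian plane. For planes invariant under the exchange of b and c, however, it is the sum of
-- two values of the indicator, at (0,0,0,0) and at (1,1,0,0). This turns the invariant weightings
-- into a count of solutions of one system, and it is the reason for taking a reflection whose axis
-- contains v, w and a, so that e₁ is fixed and e₂, e₃ are exchanged.
--
-- The number three comes from a count of equations. G has n vertices and m = 2n - 2 edges. If f
-- edges are fixed by ρ, invariance of α costs (2n - 2 - f)/2 equations; there are m - 1 further
-- ones, for the edges other than e₃, and three for the potentials at w, a, b. These are fewer than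
-- the n + m unknowns exactly when f > 2. Such edges are found as far as possible from v: the
-- reflection of an N-cycle about q fixes a vertex opposite to q if N is even and an edge opposite
-- to q if N is odd, and in either case each of the k copies of that cycle contributes one fixed
-- edge of the torus.

⊕-interchange : ∀ a b c d → (a ⊕ b) ⊕ (c ⊕ d) ≡ (a ⊕ c) ⊕ (b ⊕ d)
⊕-interchange a b c d = begin
  (a ⊕ b) ⊕ (c ⊕ d) ≡⟨ xor-assoc a b (c ⊕ d) ⟩
  a ⊕ (b ⊕ (c ⊕ d)) ≡⟨ cong (a ⊕_) (sym (xor-assoc b c d)) ⟩
  a ⊕ ((b ⊕ c) ⊕ d) ≡⟨ cong (λ e → a ⊕ (e ⊕ d)) (xor-comm b c) ⟩
  a ⊕ ((c ⊕ b) ⊕ d) ≡⟨ cong (a ⊕_) (xor-assoc c b d) ⟩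
  a ⊕ (c ⊕ (b ⊕ d)) ≡⟨ sym (xor-assoc a c (b ⊕ d)) ⟩
  (a ⊕ c) ⊕ (b ⊕ d) ∎
  where open ≡-Reasoning

bool-ext : ∀ {a b} → (a ≡ true → b ≡ true) → (b ≡ true → a ≡ true) → a ≡ b
bool-ext {false} {false} _ _ = refl
bool-ext {false} {true}  _ g = g refl
bool-ext {true}  {b}     f _ = sym (f refl)

∧-true⁻ : ∀ {a b} → a ∧ b ≡ true → a ≡ true × b ≡ true
∧-true⁻ {true} {true} _ = refl , refl

∧-true⁺ : ∀ {a b} → a ≡ true → b ≡ true → a ∧ b ≡ true
∧-true⁺ refl refl = refl

not-true⁻ : ∀ {a} → not a ≡ true → a ≡ false
not-true⁻ {false} _ = refl

not-true⁺ : ∀ {a} → a ≡ false → not a ≡ true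
not-true⁺ refl = refl

⊕-false⁻ : ∀ {a b} → a ⊕ b ≡ false → a ≡ b
⊕-false⁻ {false} {false} _ = refl
⊕-false⁻ {true}  {true}  _ = refl

⊕-false⁺ : ∀ {a b} → a ≡ b → a ⊕ b ≡ false
⊕-false⁺ {a} refl = xor-same a

⊕-cancel : ∀ a b → a ⊕ (a ⊕ b) ≡ b
⊕-cancel a b = trans (sym (xor-assoc a a b)) (cong (_⊕ b) (xor-same a))

true≢false : true ≢ false
true≢false ()

-- Equality, products and sums over finite index sets

module _ {n : ℕ} where

  infix 4 _==_

  _==_ : Fin n → Fin n → Bool
  i == j = does (i ≟ᶠ j)

  ==-refl : ∀ i → (i == i) ≡ true
  ==-refl i with i ≟ᶠ i
  ... | yes _  = refl
  ... | no i≢i = contradiction refl i≢i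

  ==-sound : ∀ {i j} → (i == j) ≡ true → i ≡ j
  ==-sound {i} {j} eq with i ≟ᶠ j
  ... | yes i≡j = i≡j

  ==-false : ∀ {i j} → i ≢ j → (i == j) ≡ false
  ==-false {i} {j} i≢j with i ≟ᶠ j
  ... | yes i≡j = contradiction i≡j i≢j
  ... | no _    = refl

Π : ∀ n → (Fin n → Bool) → Bool
Π zero    φ = true
Π (suc n) φ = φ zero ∧ Π n (φ ∘ suc)

Π⁻ : ∀ {n} φ → Π n φ ≡ true → ∀ i → φ i ≡ true
Π⁻ {suc n} φ p zero    = proj₁ (∧-true⁻ p)
Π⁻ {suc n} φ p (suc i) = Π⁻ (φ ∘ suc) (proj₂ (∧-true⁻ p)) i

Π⁺ : ∀ {n} φ → (∀ i → φ i ≡ true) → Π n φ ≡ true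
Π⁺ {zero}  φ p = refl
Π⁺ {suc n} φ p = ∧-true⁺ (p zero) (Π⁺ (φ ∘ suc) (p ∘ suc))

Π-cong : ∀ n {φ ψ} → (∀ i → φ i ≡ ψ i) → Π n φ ≡ Π n ψ
Π-cong zero    eq = refl
Π-cong (suc n) eq = cong₂ _∧_ (eq zero) (Π-cong n (eq ∘ suc))

Σ : ∀ n → (Fin n → Bool) → Bool
Σ zero    φ = false
Σ (suc n) φ = φ zero ⊕ Σ n (φ ∘ suc)

Σ-cong : ∀ n {φ ψ} → (∀ i → φ i ≡ ψ i) → Σ n φ ≡ Σ n ψ
Σ-cong zero    eq = refl
Σ-cong (suc n) eq = cong₂ _⊕_ (eq zero) (Σ-cong n (eq ∘ suc))

Σ-false : ∀ n {φ} → (∀ i → φ i ≡ false) → Σ n φ ≡ false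
Σ-false zero    eq = refl
Σ-false (suc n) eq = cong₂ _⊕_ (eq zero) (Σ-false n (eq ∘ suc))

Σ-⊕ : ∀ n φ ψ → Σ n (λ i → φ i ⊕ ψ i) ≡ Σ n φ ⊕ Σ n ψ
Σ-⊕ zero    φ ψ = refl
Σ-⊕ (suc n) φ ψ = trans (cong ((φ zero ⊕ ψ zero) ⊕_) (Σ-⊕ n _ _)) (⊕-interchange (φ zero) (ψ zero) (Σ n (φ ∘ suc)) (Σ n (ψ ∘ suc)))

Σ-∧ : ∀ n c φ → Σ n (λ i → c ∧ φ i) ≡ c ∧ Σ n φ
Σ-∧ n true  φ = refl
Σ-∧ n false φ = Σ-false n (λ _ → refl)

Σ-swap : ∀ n m (φ : Fin n → Fin m → Bool) → Σ n (λ i → Σ m (φ i)) ≡ Σ m (λ j → Σ n (λ i → φ i j))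
Σ-swap zero    m φ = sym (Σ-false m (λ _ → refl))
Σ-swap (suc n) m φ = trans (cong (Σ m (φ zero) ⊕_) (Σ-swap n m (φ ∘ suc))) (sym (Σ-⊕ m _ _))

Σ-extract : ∀ {n} j (φ : Fin n → Bool) → Σ n φ ≡ φ j ⊕ Σ n (λ i → not (i == j) ∧ φ i)
Σ-extract {suc n} zero    φ = refl
Σ-extract {suc n} (suc j) φ = begin
  φ zero ⊕ Σ n (φ ∘ suc)     ≡⟨ cong (φ zero ⊕_) (Σ-extract j (φ ∘ suc)) ⟩
  φ zero ⊕ (φ (suc j) ⊕ r)   ≡⟨ sym (xor-assoc (φ zero) (φ (suc j)) r) ⟩
  (φ zero ⊕ φ (suc j)) ⊕ r   ≡⟨ cong (_⊕ r) (xor-comm (φ zero) (φ (suc j))) ⟩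
  (φ (suc j) ⊕ φ zero) ⊕ r   ≡⟨ xor-assoc (φ (suc j)) (φ zero) r ⟩
  φ (suc j) ⊕ (φ zero ⊕ r)   ∎
  where
  open ≡-Reasoning
  r : Bool
  r = Σ n (λ i → not (i == j) ∧ φ (suc i))

Σ-δ : ∀ {n} j (φ : Fin n → Bool) → Σ n (λ i → (i == j) ∧ φ i) ≡ φ j
Σ-δ {n} j φ = begin
  Σ n (λ i → (i == j) ∧ φ i) ≡⟨ Σ-extract j (λ i → (i == j) ∧ φ i) ⟩
  (j == j) ∧ φ j ⊕ Σ n (λ i → not (i == j) ∧ ((i == j) ∧ φ i))
    ≡⟨ cong₂ _⊕_ (cong (λ b → b ∧ φ j) (==-refl j)) (Σ-false n (λ i → lem (i == j) (φ i))) ⟩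
  φ j ⊕ false ≡⟨ xor-identityʳ (φ j) ⟩
  φ j ∎
  where
  open ≡-Reasoning
  lem : ∀ a b → not a ∧ (a ∧ b) ≡ false
  lem true  b = refl
  lem false b = refl

-- Sums over F₂ⁿ

S : ∀ n → (Vec Bool n → Bool) → Bool
S zero    F = F []
S (suc n) F = S n (F ∘ (false ∷_)) ⊕ S n (F ∘ (true ∷_))

S-cong : ∀ n {F G : Vec Bool n → Bool} → (∀ z → F z ≡ G z) → S n F ≡ S n G
S-cong zero    eq = eq []
S-cong (suc n) eq = cong₂ _⊕_ (S-cong n (λ z → eq (false ∷ z))) (S-cong n (λ z → eq (true ∷ z)))

S-false : ∀ n {F : Vec Bool n → Bool} → (∀ z → F z ≡ false) → S n F ≡ false
S-false zero    eq = eq []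
S-false (suc n) eq = cong₂ _⊕_ (S-false n (λ z → eq (false ∷ z))) (S-false n (λ z → eq (true ∷ z)))

S-⊕ : ∀ n (F G : Vec Bool n → Bool) → S n (λ z → F z ⊕ G z) ≡ S n F ⊕ S n G
S-⊕ zero    F G = refl
S-⊕ (suc n) F G = trans (cong₂ _⊕_ (S-⊕ n _ _) (S-⊕ n _ _)) (⊕-interchange (S n (F ∘ (false ∷_))) (S n (G ∘ (false ∷_))) (S n (F ∘ (true ∷_))) (S n (G ∘ (true ∷_))))

S-∧ : ∀ n c (F : Vec Bool n → Bool) → S n (λ z → c ∧ F z) ≡ c ∧ S n F
S-∧ n true  F = refl
S-∧ n false F = S-false n (λ _ → refl)

S-swap : ∀ n m (F : Vec Bool n → Vec Bool m → Bool) → S n (λ x → S m (F x)) ≡ S m (λ y → S n (λ x → F x y))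
S-swap zero    m F = refl
S-swap (suc n) m F = trans (cong₂ _⊕_ (S-swap n m _) (S-swap n m _)) (sym (S-⊕ m _ _))

S-++ : ∀ n m (F : Vec Bool (n + m) → Bool) → S (n + m) F ≡ S n (λ x → S m (λ y → F (x ++ y)))
S-++ zero    m F = refl
S-++ (suc n) m F = cong₂ _⊕_ (S-++ n m _) (S-++ n m _)

S-witness : ∀ n {F : Vec Bool n → Bool} → S n F ≡ true → ∃ λ z → F z ≡ true
S-witness zero    p = [] , p
S-witness (suc n) {F} p with S n (F ∘ (false ∷_)) in eq
... | true  = let z , q = S-witness n eq in false ∷ z , q
... | false = let z , q = S-witness n p  in true ∷ z , q

S-Π : ∀ n (g : Fin n → Bool → Bool) → S n (λ v → Π n (λ i → g i (lookup v i))) ≡ Π n (λ i → g i false ⊕ g i true)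
S-Π zero    g = refl
S-Π (suc n) g = begin
  S n (λ v → g zero false ∧ R v) ⊕ S n (λ v → g zero true ∧ R v)
    ≡⟨ cong₂ _⊕_ (S-∧ n (g zero false) R) (S-∧ n (g zero true) R) ⟩
  g zero false ∧ S n R ⊕ g zero true ∧ S n R
    ≡⟨ sym (∧-distribʳ-xor (S n R) (g zero false) (g zero true)) ⟩
  (g zero false ⊕ g zero true) ∧ S n R
    ≡⟨ cong ((g zero false ⊕ g zero true) ∧_) (S-Π n (g ∘ suc)) ⟩
  (g zero false ⊕ g zero true) ∧ Π n (λ i → g (suc i) false ⊕ g (suc i) true) ∎
  where
  open ≡-Reasoning
  R : Vec Bool n → Bool
  R v = Π n (λ i → g (suc i) (lookup v i))

infix 4 _==ᵛ_

_==ᵛ_ : ∀ {n} → Vec Bool n → Vec Bool n → Bool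
[]      ==ᵛ []      = true
(a ∷ x) ==ᵛ (b ∷ y) = not (a ⊕ b) ∧ (x ==ᵛ y)

==ᵛ-refl : ∀ {n} (x : Vec Bool n) → (x ==ᵛ x) ≡ true
==ᵛ-refl []      = refl
==ᵛ-refl (a ∷ x) = ∧-true⁺ (not-true⁺ (xor-same a)) (==ᵛ-refl x)

==ᵛ-sound : ∀ {n} {x y : Vec Bool n} → (x ==ᵛ y) ≡ true → x ≡ y
==ᵛ-sound {x = []}    {[]}    _ = refl
==ᵛ-sound {x = a ∷ x} {b ∷ y} p =
  cong₂ _∷_ (⊕-false⁻ (not-true⁻ (proj₁ (∧-true⁻ p)))) (==ᵛ-sound (proj₂ (∧-true⁻ {not (a ⊕ b)} p)))

S-δ : ∀ n c (F : Vec Bool n → Bool) → S n (λ w → (w ==ᵛ c) ∧ F w) ≡ F c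
S-δ zero    []          F = refl
S-δ (suc n) (false ∷ c) F = trans (cong₂ _⊕_ (S-δ n c (F ∘ (false ∷_))) (S-false n (λ _ → refl))) (xor-identityʳ _)
S-δ (suc n) (true ∷ c)  F = cong₂ _⊕_ (S-false n (λ _ → refl)) (S-δ n c (F ∘ (true ∷_)))

-- Inserting a delta function writes `F (φ z)` as a sum over w; after exchanging the sums, w = φ z
-- may be read as z = φ w.
S-involution : ∀ {n} (φ : Vec Bool n → Vec Bool n) → (∀ z → φ (φ z) ≡ z) →
               ∀ F → S n (F ∘ φ) ≡ S n F
S-involution {n} φ φφ F = begin
  S n (F ∘ φ)                                  ≡⟨ S-cong n (λ z → sym (S-δ n (φ z) F)) ⟩
  S n (λ z → S n (λ w → (w ==ᵛ φ z) ∧ F w))    ≡⟨ S-swap n n _ ⟩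
  S n (λ w → S n (λ z → (w ==ᵛ φ z) ∧ F w))    ≡⟨ S-cong n (λ w → S-cong n (λ z → cong (_∧ F w) (flip w z))) ⟩
  S n (λ w → S n (λ z → (z ==ᵛ φ w) ∧ F w))    ≡⟨ S-cong n (λ w → S-δ n (φ w) (λ _ → F w)) ⟩
  S n F                                        ∎
  where
  open ≡-Reasoning
  half : ∀ w z → (w ==ᵛ φ z) ≡ true → (z ==ᵛ φ w) ≡ true
  half w z p rewrite ==ᵛ-sound {x = w} p | φφ z = ==ᵛ-refl z
  flip : ∀ w z → (w ==ᵛ φ z) ≡ (z ==ᵛ φ w)
  flip w z = bool-ext (half w z) (half z w)

infix 4 _<ᵛ_

_<ᵛ_ : ∀ {n} → Vec Bool n → Vec Bool n → Bool
[]          <ᵛ []          = false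
(false ∷ x) <ᵛ (true ∷ y)  = true
(true ∷ x)  <ᵛ (false ∷ y) = false
(false ∷ x) <ᵛ (false ∷ y) = x <ᵛ y
(true ∷ x)  <ᵛ (true ∷ y)  = x <ᵛ y

<ᵛ-trichotomy : ∀ {n} (x y : Vec Bool n) → (x <ᵛ y) ⊕ ((y <ᵛ x) ⊕ (x ==ᵛ y)) ≡ true
<ᵛ-trichotomy []          []          = refl
<ᵛ-trichotomy (false ∷ x) (true ∷ y)  = refl
<ᵛ-trichotomy (true ∷ x)  (false ∷ y) = refl
<ᵛ-trichotomy (false ∷ x) (false ∷ y) = <ᵛ-trichotomy x y
<ᵛ-trichotomy (true ∷ x)  (true ∷ y)  = <ᵛ-trichotomy x y

-- The lexicographic order picks one point from each orbit of size two. The sums over φ z < z and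
-- over z < φ z are exchanged by φ, hence cancel modulo 2.
S-fixed : ∀ {n} (φ : Vec Bool n → Vec Bool n) → (∀ z → φ (φ z) ≡ z) →
          ∀ F → (∀ z → F (φ z) ≡ F z) → S n F ≡ S n (λ z → (φ z ==ᵛ z) ∧ F z)
S-fixed {n} φ φφ F Fφ = begin
  S n F ≡⟨ S-cong n (λ z → cong (_∧ F z) (sym (<ᵛ-trichotomy (φ z) z))) ⟩
  S n (λ z → ((φ z <ᵛ z) ⊕ ((z <ᵛ φ z) ⊕ (φ z ==ᵛ z))) ∧ F z)
    ≡⟨ S-cong n (λ z → trans (∧-distribʳ-xor (F z) (φ z <ᵛ z) _)
                             (cong ((φ z <ᵛ z) ∧ F z ⊕_) (∧-distribʳ-xor (F z) (z <ᵛ φ z) _))) ⟩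
  S n (λ z → L z ⊕ (G z ⊕ E z)) ≡⟨ S-⊕ n L _ ⟩
  S n L ⊕ S n (λ z → G z ⊕ E z) ≡⟨ cong (S n L ⊕_) (S-⊕ n G E) ⟩
  S n L ⊕ (S n G ⊕ S n E) ≡⟨ cong (λ s → S n L ⊕ (s ⊕ S n E)) (sym G≡L) ⟩
  S n L ⊕ (S n L ⊕ S n E) ≡⟨ ⊕-cancel (S n L) (S n E) ⟩
  S n E ∎
  where
  open ≡-Reasoning
  L G E : Vec Bool n → Bool
  L z = (φ z <ᵛ z) ∧ F z
  G z = (z <ᵛ φ z) ∧ F z
  E z = (φ z ==ᵛ z) ∧ F z
  G≡L : S n L ≡ S n G
  G≡L = trans (sym (S-involution φ φφ L)) (S-cong n (λ z → cong₂ _∧_ (cong (_<ᵛ φ z) (φφ z)) (Fφ z)))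

infixr 5 _⊕ᵛ_

_⊕ᵛ_ : ∀ {n} → Vec Bool n → Vec Bool n → Vec Bool n
_⊕ᵛ_ = zipWith _⊕_

⊕ᵛ-cancel : ∀ {n} (x y : Vec Bool n) → x ⊕ᵛ (x ⊕ᵛ y) ≡ y
⊕ᵛ-cancel []      []      = refl
⊕ᵛ-cancel (a ∷ x) (b ∷ y) = cong₂ _∷_ (⊕-cancel a b) (⊕ᵛ-cancel x y)

⊕ᵛ-fixed : ∀ {n} {t z : Vec Bool n} → t ⊕ᵛ z ≡ z → t ≡ replicate n false
⊕ᵛ-fixed {t = []}    {[]}    _ = refl
⊕ᵛ-fixed {t = a ∷ t} {b ∷ z} p = cong₂ _∷_ (lem a b (cong head p)) (⊕ᵛ-fixed (cong tail p))
  where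
  lem : ∀ a b → a ⊕ b ≡ b → a ≡ false
  lem false b p = refl
  lem true false ()
  lem true true  ()

S-translate : ∀ {n} (t : Vec Bool n) F → S n (λ z → F (t ⊕ᵛ z)) ≡ S n F
S-translate t = S-involution (t ⊕ᵛ_) (⊕ᵛ-cancel t)

-- Translation by a nonzero vector has no fixed points, so `S-fixed` leaves nothing.
S-periodic : ∀ {n} (t : Vec Bool n) F → t ≢ replicate n false → (∀ z → F (t ⊕ᵛ z) ≡ F z) → S n F ≡ false
S-periodic {n} t F t≢0 per = trans (S-fixed (t ⊕ᵛ_) (⊕ᵛ-cancel t) F per) (S-false n zer)
  where
  zer : ∀ z → ((t ⊕ᵛ z) ==ᵛ z) ∧ F z ≡ false
  zer z with (t ⊕ᵛ z) ==ᵛ z in eq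
  ... | true  = contradiction (⊕ᵛ-fixed (==ᵛ-sound eq)) t≢0
  ... | false = refl

all-vectors : ∀ n → (Vec Bool n → Bool) → Bool
all-vectors zero    F = F []
all-vectors (suc n) F = all-vectors n (F ∘ (false ∷_)) ∧ all-vectors n (F ∘ (true ∷_))

all-vectors-sound : ∀ {n F} → all-vectors n F ≡ true → ∀ v → F v ≡ true
all-vectors-sound {zero}  p []          = p
all-vectors-sound {suc n} p (false ∷ v) = all-vectors-sound (proj₁ (∧-true⁻ p)) v
all-vectors-sound {suc n} p (true ∷ v)  = all-vectors-sound (proj₂ (∧-true⁻ p)) v

-- Identities between explicit Boolean polynomials are checked at all 2ⁿ points by evaluation, so
-- that the third argument can be `refl`.
tautology : ∀ n (F G : Vec Bool n → Bool) → all-vectors n (λ v → not (F v ⊕ G v)) ≡ true → ∀ v → F v ≡ G v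
tautology n F G p v = ⊕-false⁻ (not-true⁻ (all-vectors-sound p v))

0ᵛ : ∀ {n} → Vec Bool n
0ᵛ = replicate _ false

⊕ᵛ-identityˡ : ∀ {n} (z : Vec Bool n) → 0ᵛ ⊕ᵛ z ≡ z
⊕ᵛ-identityˡ []      = refl
⊕ᵛ-identityˡ (a ∷ z) = cong (a ∷_) (⊕ᵛ-identityˡ z)

-- Linear forms over F₂

record Form (M : ℕ) : Set where
  field
    at       : Vec Bool M → Bool
    additive : ∀ x y → at (x ⊕ᵛ y) ≡ at x ⊕ at y

open Form public

coordinate : ∀ {M} → Fin M → Form M
coordinate i = record { at = λ z → lookup z i ; additive = lookup-zipWith _⊕_ i }

infixr 5 _⊞_

_⊞_ : ∀ {M} → Form M → Form M → Form M
f ⊞ g = record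
  { at       = λ z → at f z ⊕ at g z
  ; additive = λ x y → trans (cong₂ _⊕_ (additive f x y) (additive g x y)) (⊕-interchange (at f x) (at f y) (at g x) (at g y))
  }

infixr 6 _⊡_

_⊡_ : ∀ {M} → Bool → Form M → Form M
c ⊡ f = record
  { at       = λ z → c ∧ at f z
  ; additive = λ x y → trans (cong (c ∧_) (additive f x y)) (∧-distribˡ-xor c (at f x) (at f y))
  }

ΣForm : ∀ {M} n → (Fin n → Form M) → Form M
ΣForm n f = record
  { at       = λ z → Σ n (λ i → at (f i) z)
  ; additive = λ x y → trans (Σ-cong n (λ i → additive (f i) x y)) (Σ-⊕ n _ _)
  }

at-0 : ∀ {M} (f : Form M) → at f 0ᵛ ≡ false
at-0 f = begin
  at f 0ᵛ                  ≡⟨ sym (⊕-cancel (at f 0ᵛ) (at f 0ᵛ)) ⟩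
  at f 0ᵛ ⊕ (at f 0ᵛ ⊕ at f 0ᵛ) ≡⟨ cong (at f 0ᵛ ⊕_) (sym (additive f 0ᵛ 0ᵛ)) ⟩
  at f 0ᵛ ⊕ at f (0ᵛ ⊕ᵛ 0ᵛ) ≡⟨ cong (λ z → at f 0ᵛ ⊕ at f z) (⊕ᵛ-identityˡ 0ᵛ) ⟩
  at f 0ᵛ ⊕ at f 0ᵛ        ≡⟨ xor-same (at f 0ᵛ) ⟩
  false                    ∎
  where open ≡-Reasoning

afterFalse : ∀ {M} → Form (suc M) → Form M
afterFalse f = record { at = λ z → at f (false ∷ z) ; additive = λ x y → additive f (false ∷ x) (false ∷ y) }

-- On the hyperplanes z₀ = 0 and z₀ = 1 a form restricts to the same form up to a constant; this is
-- what allows induction on the dimension.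
at-true : ∀ {M} (f : Form (suc M)) z → at f (true ∷ z) ≡ at f (false ∷ z) ⊕ at f (true ∷ 0ᵛ)
at-true f z = begin
  at f (true ∷ z)                        ≡⟨ cong (λ t → at f (true ∷ t)) (sym (⊕ᵛ-identityˡ z)) ⟩
  at f (true ∷ 0ᵛ ⊕ᵛ z)                  ≡⟨ additive f (true ∷ 0ᵛ) (false ∷ z) ⟩
  at f (true ∷ 0ᵛ) ⊕ at f (false ∷ z)    ≡⟨ xor-comm (at f (true ∷ 0ᵛ)) _ ⟩
  at f (false ∷ z) ⊕ at f (true ∷ 0ᵛ)    ∎
  where open ≡-Reasoning

-- (f , c) is the affine function f + c, hence the indicator of f = c + 1.
Affine : ℕ → Set
Affine M = Form M × Bool

prod : ∀ {M} → List (Affine M) → Vec Bool M → Bool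
prod []            z = true
prod ((f , c) ∷ l) z = (at f z ⊕ c) ∧ prod l z

prod-++ : ∀ {M} (l l′ : List (Affine M)) z → prod (l ++ˡ l′) z ≡ prod l z ∧ prod l′ z
prod-++ []            l′ z = refl
prod-++ ((f , c) ∷ l) l′ z = trans (cong ((at f z ⊕ c) ∧_) (prod-++ l l′ z)) (sym (∧-assoc (at f z ⊕ c) _ _))

prod-tabulate : ∀ {M} n (f : Fin n → Affine M) z → prod (tabulateˡ f) z ≡ Π n (λ i → at (proj₁ (f i)) z ⊕ proj₂ (f i))
prod-tabulate zero    f z = refl
prod-tabulate (suc n) f z = cong ((at (proj₁ (f zero)) z ⊕ proj₂ (f zero)) ∧_) (prod-tabulate n (f ∘ suc) z)

left right : ∀ {M} → List (Form M × Bool × Bool) → List (Affine M)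
left  = map (λ (f , c , c′) → f , c)
right = map (λ (f , c , c′) → f , c′)

FewFactors : ℕ → Set
FewFactors M = ∀ (l : List (Affine M)) → length l < M → S M (prod l) ≡ false

-- The constants are changed one factor at a time. When c is replaced by c′ in one factor, the
-- difference of the two products has the constant c + c′ in place of that factor, hence fewer than
-- M factors left, and `few` applies.
telescope : ∀ {M} → FewFactors M → (p : List (Affine M)) (l : List (Form M × Bool × Bool)) →
            length p + length l ≤ M →
            S M (λ z → prod p z ∧ (prod (left l) z ⊕ prod (right l) z)) ≡ false
telescope {M} few p []                  _  = S-false M (λ z → ∧-zeroʳ (prod p z))
telescope {M} few p ((f , c , c′) ∷ l) le = begin
  S M (λ z → prod p z ∧ ((at f z ⊕ c) ∧ prod (left l) z ⊕ (at f z ⊕ c′) ∧ prod (right l) z))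
    ≡⟨ S-cong M (λ z → identity (prod p z ∷ at f z ∷ c ∷ c′ ∷ prod (left l) z ∷ prod (right l) z ∷ [])) ⟩
  S M (λ z → T₁ z ⊕ (c ⊕ c′) ∧ T₂ z)
    ≡⟨ S-⊕ M T₁ _ ⟩
  S M T₁ ⊕ S M (λ z → (c ⊕ c′) ∧ T₂ z)
    ≡⟨ cong₂ _⊕_ (telescope few ((f , c) ∷ p) l (≤-trans (≤-reflexive (sym (+-suc (length p) (length l)))) le))
                 (S-∧ M (c ⊕ c′) T₂) ⟩
  (c ⊕ c′) ∧ S M T₂
    ≡⟨ cong ((c ⊕ c′) ∧_) (trans (S-cong M (λ z → sym (prod-++ p (right l) z))) (few (p ++ˡ right l) short)) ⟩
  (c ⊕ c′) ∧ false ≡⟨ ∧-zeroʳ (c ⊕ c′) ⟩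
  false ∎
  where
  open ≡-Reasoning
  T₁ T₂ : Vec Bool M → Bool
  T₁ z = ((at f z ⊕ c) ∧ prod p z) ∧ (prod (left l) z ⊕ prod (right l) z)
  T₂ z = prod p z ∧ prod (right l) z
  identity = tautology 6
    (λ { (p ∷ f ∷ c ∷ d ∷ a ∷ b ∷ []) → p ∧ ((f ⊕ c) ∧ a ⊕ (f ⊕ d) ∧ b) })
    (λ { (p ∷ f ∷ c ∷ d ∷ a ∷ b ∷ []) → ((f ⊕ c) ∧ p) ∧ (a ⊕ b) ⊕ (c ⊕ d) ∧ (p ∧ b) })
    refl
  short : length (p ++ˡ right l) < M
  short rewrite length-++ p {right l} | length-map (λ (f , c , c′) → f , c′) l | sym (+-suc (length p) (length l)) = le

-- The linear case of the Chevalley-Warning argument. Splitting off the first coordinate gives two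
-- products of the same at most M forms in M variables, with different constants; their sum is a
-- telescope, to which the induction hypothesis applies.
few-factors : ∀ M → FewFactors M
few-factors (suc M) l (s≤s le) = begin
  S M (prod l ∘ (false ∷_)) ⊕ S M (prod l ∘ (true ∷_)) ≡⟨ sym (S-⊕ M _ _) ⟩
  S M (λ z → prod l (false ∷ z) ⊕ prod l (true ∷ z))
    ≡⟨ S-cong M (λ z → cong₂ _⊕_ (on-false l z) (on-true l z)) ⟩
  S M (λ z → true ∧ (prod (left (halves l)) z ⊕ prod (right (halves l)) z))
    ≡⟨ telescope (few-factors M) [] (halves l) (≤-trans (≤-reflexive (length-map _ l)) le) ⟩
  false ∎
  where
  open ≡-Reasoning
  halves : List (Affine (suc M)) → List (Form M × Bool × Bool)
  halves = map (λ (f , c) → afterFalse f , c , at f (true ∷ 0ᵛ) ⊕ c)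
  on-false : ∀ l z → prod l (false ∷ z) ≡ prod (left (halves l)) z
  on-false []            z = refl
  on-false ((f , c) ∷ l) z = cong (_ ∧_) (on-false l z)
  on-true : ∀ l z → prod l (true ∷ z) ≡ prod (right (halves l)) z
  on-true []            z = refl
  on-true ((f , c) ∷ l) z = cong₂ _∧_
    (trans (cong (_⊕ c) (at-true f z)) (xor-assoc (at f (false ∷ z)) _ c))
    (on-true l z)

-- For exactly M forms the common value is their determinant over F₂: a nonsingular system has one
-- solution for all constants, and a singular one has an even number.
constants-irrelevant : ∀ {M} (l : List (Form M × Bool × Bool)) → length l ≤ M →
                       S M (prod (left l)) ≡ S M (prod (right l))
constants-irrelevant {M} l le = ⊕-false⁻ (trans (sym (S-⊕ M _ _)) (telescope (few-factors M) [] l le))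

-- The solutions of a homogeneous system are a vector space, of odd size only
-- when it is zero.
S-homogeneous : ∀ {M} (F : Vec Bool M → Bool) → F 0ᵛ ≡ true →
                (∀ {t} → F t ≡ true → ∀ z → F (t ⊕ᵛ z) ≡ F z) →
                S M F ≡ true → ∀ {z} → F z ≡ true → z ≡ 0ᵛ
S-homogeneous {M} F F0 closed odd {z} Fz with z ==ᵛ 0ᵛ in eq
... | true  = ==ᵛ-sound eq
... | false with () ← trans (sym odd) (S-periodic z F (λ { refl → true≢false (trans (sym (==ᵛ-refl z)) eq) }) (closed Fz))

⊕-true⁻ : ∀ {a} → a ⊕ true ≡ true → a ≡ false
⊕-true⁻ {false} _ = refl

⊕-true⁺ : ∀ {a} → a ≡ false → a ⊕ true ≡ true
⊕-true⁺ refl = refl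

Π-∧ : ∀ n φ ψ → Π n φ ∧ Π n ψ ≡ Π n (λ i → φ i ∧ ψ i)
Π-∧ n φ ψ = bool-ext
  (λ p → let φ✓ , ψ✓ = ∧-true⁻ p in Π⁺ _ (λ i → ∧-true⁺ (Π⁻ φ φ✓ i) (Π⁻ ψ ψ✓ i)))
  (λ p → ∧-true⁺ (Π⁺ φ (λ i → proj₁ (∧-true⁻ (Π⁻ _ p i)))) (Π⁺ ψ (λ i → proj₂ (∧-true⁻ {φ i} (Π⁻ _ p i)))))

-- Potentials and currents

-- The first n coordinates of z : Vec Bool (n + m) are potentials at the vertices,
-- the last m are currents through the edges.
module Network {n m : ℕ} (s t : Fin m → Fin n) (w : Fin n) where

  -- Modulo 2 the incidence needs no orientation, and that of a loop is zero.
  inc : Fin m → Fin n → Bool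
  inc e u = (u == s e) ⊕ (u == t e)

  X : Fin n → Form (n + m)
  X u = coordinate (u ↑ˡ m)

  Y : Fin m → Form (n + m)
  Y e = coordinate (n ↑ʳ e)

  δ : Fin m → Form (n + m)
  δ e = X (s e) ⊞ X (t e)

  ∂ : Fin n → Form (n + m)
  ∂ u = ΣForm m (λ e → inc e u ⊡ Y e)

  -- The base vertex w needs no condition on the currents, as the boundaries add
  -- up to zero; this makes room for the normalisation of the potential.
  vertexForm : Fin n → Form (n + m)
  vertexForm u = if u == w then X u else ∂ u

  -- Ohm's law with `α e` as a resistance. Resistances rather than conductances give the sum over
  -- complements of trees.
  edgeForm : (Fin m → Bool) → Fin m → Form (n + m)
  edgeForm α e = δ e ⊞ α e ⊡ Y e

  V : Vec Bool (n + m) → Bool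
  V z = Π n (λ u → at (vertexForm u) z ⊕ true)

  System : (Fin m → Form (n + m)) → (Fin m → Bool) → Bool
  System g c = S (n + m) (λ z → V z ∧ Π m (λ e → at (g e) z ⊕ c e))

  Q : (Fin m → Bool) → Bool
  Q α = System (edgeForm α) (λ _ → true)

  -- The n vertex forms and m edge forms are as many as the coordinates, the largest number that
  -- `constants-irrelevant` allows.
  System-constants : ∀ g c c′ → System g c ≡ System g c′
  System-constants g c c′ = begin
    System g c              ≡⟨ S-cong (n + m) (λ z → sym (on-left z)) ⟩
    S (n + m) (prod (left l))  ≡⟨ constants-irrelevant l (≤-reflexive len) ⟩
    S (n + m) (prod (right l)) ≡⟨ S-cong (n + m) on-right ⟩
    System g c′             ∎
    where
    open ≡-Reasoning
    lv : Fin n → Form (n + m) × Bool × Bool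
    lv u = vertexForm u , true , true
    le : Fin m → Form (n + m) × Bool × Bool
    le e = g e , c e , c′ e
    l = tabulateˡ lv ++ˡ tabulateˡ le
    len : length l ≡ n + m
    len = trans (length-++ (tabulateˡ lv)) (cong₂ _+_ (length-tabulate lv) (length-tabulate le))
    on-left : ∀ z → prod (left l) z ≡ V z ∧ Π m (λ e → at (g e) z ⊕ c e)
    on-left z = trans (cong (λ k → prod k z) (trans (map-++ _ (tabulateˡ lv) _) (cong₂ _++ˡ_ (map-tabulate lv _) (map-tabulate le _))))
                (trans (prod-++ (tabulateˡ {n = n} _) _ z) (cong₂ _∧_ (prod-tabulate n _ z) (prod-tabulate m _ z)))
    on-right : ∀ z → prod (right l) z ≡ V z ∧ Π m (λ e → at (g e) z ⊕ c′ e)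
    on-right z = trans (cong (λ k → prod k z) (trans (map-++ _ (tabulateˡ lv) _) (cong₂ _++ˡ_ (map-tabulate lv _) (map-tabulate le _))))
                (trans (prod-++ (tabulateˡ {n = n} _) _ z) (cong₂ _∧_ (prod-tabulate n _ z) (prod-tabulate m _ z)))

  -- Its zeroes are the potentials that are constant along T and the currents
  -- supported on T, hence trivial precisely for a spanning tree.
  treeForm : (Fin m → Bool) → Fin m → Form (n + m)
  treeForm T e = if T e then δ e else Y e

  treeParity : (Fin m → Bool) → Bool
  treeParity T = System (treeForm T) (λ _ → true)

  -- The freedom in the constants is used to put `T e` in place of `true` at the edge e. Its factor
  -- is then δ + 1 if e lies in T and αy otherwise, so the sum over T splits into a product over the
  -- edges of αy + δ + 1, and these are the factors of `Q α`.
  sum-over-trees : ∀ α → S m (λ T → Π m (λ e → lookup T e ∨ α e) ∧ treeParity (lookup T)) ≡ Q α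
  sum-over-trees α = begin
    S m (λ T → A T ∧ treeParity (lookup T))
      ≡⟨ S-cong m (λ T → cong (A T ∧_) (System-constants (treeForm (lookup T)) _ (lookup T))) ⟩
    S m (λ T → A T ∧ S (n + m) (λ z → V z ∧ B T z))
      ≡⟨ S-cong m (λ T → sym (S-∧ (n + m) (A T) _)) ⟩
    S m (λ T → S (n + m) (λ z → A T ∧ (V z ∧ B T z)))
      ≡⟨ S-swap m (n + m) _ ⟩
    S (n + m) (λ z → S m (λ T → A T ∧ (V z ∧ B T z)))
      ≡⟨ S-cong (n + m) (λ z → trans (S-cong m (λ T → regroup (A T) (V z) (B T z))) (S-∧ m (V z) _)) ⟩
    S (n + m) (λ z → V z ∧ S m (λ T → A T ∧ B T z))
      ≡⟨ S-cong (n + m) (λ z → cong (V z ∧_) (trans (S-cong m (λ T → Π-∧ m _ _)) (S-Π m (g z)))) ⟩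
    S (n + m) (λ z → V z ∧ Π m (λ e → g z e false ⊕ g z e true))
      ≡⟨ S-cong (n + m) (λ z → cong (V z ∧_) (Π-cong m (λ e → local (α e) (at (Y e) z) (at (δ e) z)))) ⟩
    Q α ∎
    where
    open ≡-Reasoning
    A : Vec Bool m → Bool
    A T = Π m (λ e → lookup T e ∨ α e)
    B : Vec Bool m → Vec Bool (n + m) → Bool
    B T z = Π m (λ e → at (treeForm (lookup T) e) z ⊕ lookup T e)
    g : Vec Bool (n + m) → Fin m → Bool → Bool
    g z e b = (b ∨ α e) ∧ (at (if b then δ e else Y e) z ⊕ b)
    regroup : ∀ a b c → a ∧ (b ∧ c) ≡ b ∧ (a ∧ c)
    regroup true  b c = refl
    regroup false b c = sym (∧-zeroʳ b)
    local : ∀ a y d → a ∧ (y ⊕ false) ⊕ (d ⊕ true) ≡ (d ⊕ a ∧ y) ⊕ true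
    local a y d = tautology 3 (λ { (a ∷ y ∷ d ∷ []) → a ∧ (y ⊕ false) ⊕ (d ⊕ true) })
                              (λ { (a ∷ y ∷ d ∷ []) → (d ⊕ a ∧ y) ⊕ true }) refl (a ∷ y ∷ d ∷ [])

  -- Summation by parts: ∂ is the transpose of δ. It is used with ξ constant, with ξ a potential,
  -- and with ξ the indicator of one side of a cut.
  pairing : ∀ (ξ : Fin n → Bool) z → Σ n (λ u → ξ u ∧ at (∂ u) z) ≡ Σ m (λ e → at (Y e) z ∧ (ξ (s e) ⊕ ξ (t e)))
  pairing ξ z = begin
    Σ n (λ u → ξ u ∧ Σ m (λ e → inc e u ∧ y e)) ≡⟨ Σ-cong n (λ u → sym (Σ-∧ m (ξ u) _)) ⟩
    Σ n (λ u → Σ m (λ e → ξ u ∧ (inc e u ∧ y e))) ≡⟨ Σ-swap n m _ ⟩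
    Σ m (λ e → Σ n (λ u → ξ u ∧ (inc e u ∧ y e))) ≡⟨ Σ-cong m edge ⟩
    Σ m (λ e → y e ∧ (ξ (s e) ⊕ ξ (t e))) ∎
    where
    open ≡-Reasoning
    y : Fin m → Bool
    y e = at (Y e) z
    expand : ∀ x p q y → x ∧ ((p ⊕ q) ∧ y) ≡ y ∧ (p ∧ x ⊕ q ∧ x)
    expand x p q y = tautology 4 (λ { (x ∷ p ∷ q ∷ y ∷ []) → x ∧ ((p ⊕ q) ∧ y) })
                                 (λ { (x ∷ p ∷ q ∷ y ∷ []) → y ∧ (p ∧ x ⊕ q ∧ x) }) refl (x ∷ p ∷ q ∷ y ∷ [])
    edge : ∀ e → Σ n (λ u → ξ u ∧ (inc e u ∧ y e)) ≡ y e ∧ (ξ (s e) ⊕ ξ (t e))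
    edge e = begin
      Σ n (λ u → ξ u ∧ (inc e u ∧ y e)) ≡⟨ Σ-cong n (λ u → expand (ξ u) (u == s e) (u == t e) (y e)) ⟩
      Σ n (λ u → y e ∧ ((u == s e) ∧ ξ u ⊕ (u == t e) ∧ ξ u)) ≡⟨ Σ-∧ n (y e) _ ⟩
      y e ∧ Σ n (λ u → (u == s e) ∧ ξ u ⊕ (u == t e) ∧ ξ u)
        ≡⟨ cong (y e ∧_) (trans (Σ-⊕ n _ _) (cong₂ _⊕_ (Σ-δ (s e) ξ) (Σ-δ (t e) ξ))) ⟩
      y e ∧ (ξ (s e) ⊕ ξ (t e)) ∎

  V-vertexForm : ∀ {z} → V z ≡ true → ∀ u → at (vertexForm u) z ≡ false
  V-vertexForm v u = ⊕-true⁻ (Π⁻ _ v u)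

  V-X : ∀ {z} → V z ≡ true → at (X w) z ≡ false
  V-X {z} v = trans (cong (λ b → at (if b then X w else ∂ w) z) (sym (==-refl w))) (V-vertexForm v w)

  V-∂ : ∀ {z} → V z ≡ true → ∀ u → at (∂ u) z ≡ false
  V-∂ {z} v u with u ≟ᶠ w
  ... | no u≢w   = trans (cong (λ b → at (if b then X u else ∂ u) z) (sym (==-false u≢w))) (V-vertexForm v u)
  ... | yes refl = begin
    at (∂ w) z ≡⟨ sym (xor-identityʳ _) ⟩
    at (∂ w) z ⊕ false ≡⟨ cong (at (∂ w) z ⊕_) (sym (Σ-false n rest)) ⟩
    at (∂ w) z ⊕ Σ n (λ u → not (u == w) ∧ at (∂ u) z) ≡⟨ sym (Σ-extract w (λ u → at (∂ u) z)) ⟩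
    Σ n (λ u → at (∂ u) z) ≡⟨ pairing (λ _ → true) z ⟩
    Σ m (λ e → at (Y e) z ∧ false) ≡⟨ Σ-false m (λ e → ∧-zeroʳ _) ⟩
    false ∎
    where
    open ≡-Reasoning
    rest : ∀ u → not (u == w) ∧ at (∂ u) z ≡ false
    rest u with u == w in eq
    ... | true  = refl
    ... | false = trans (cong (λ b → at (if b then X u else ∂ u) z) (sym eq)) (V-vertexForm v u)

  V⁺ : ∀ {z} → at (X w) z ≡ false → (∀ u → at (∂ u) z ≡ false) → V z ≡ true
  V⁺ {z} x d = Π⁺ _ vertex
    where
    vertex : ∀ u → at (vertexForm u) z ⊕ true ≡ true
    vertex u with u == w in eq
    ... | true  = ⊕-true⁺ (subst (λ u → at (X u) z ≡ false) (sym (==-sound eq)) x)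
    ... | false = ⊕-true⁺ (d u)

  V-translate : ∀ {t} → V t ≡ true → ∀ z → V (t ⊕ᵛ z) ≡ V z
  V-translate {t} v z = Π-cong n (λ u → cong (λ b → b ⊕ true) (
    trans (additive (vertexForm u) t z) (cong (λ b → b ⊕ at (vertexForm u) z) (V-vertexForm v u))))

all-vectors-complete : ∀ {n F} → (∀ v → F v ≡ true) → all-vectors n F ≡ true
all-vectors-complete {zero}  p = p []
all-vectors-complete {suc n} p =
  ∧-true⁺ (all-vectors-complete (λ v → p (false ∷ v))) (all-vectors-complete (λ v → p (true ∷ v)))

-- Responses at a vertex of degree three

-- A Boolean function of k bits stored as the binary tree of its values, so that a statement about
-- all such functions becomes a finite computation.
Table : ℕ → Set
Table zero    = Bool
Table (suc k) = Table k × Table k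

read : ∀ {k} → Table k → Vec Bool k → Bool
read {zero}  b       []          = b
read {suc k} (l , r) (false ∷ v) = read l v
read {suc k} (l , r) (true ∷ v)  = read r v

write : ∀ {k} → (Vec Bool k → Bool) → Table k
write {zero}  F = F []
write {suc k} F = write (F ∘ (false ∷_)) , write (F ∘ (true ∷_))

all-tables : ∀ k → (Table k → Bool) → Bool
all-tables zero    P = P false ∧ P true
all-tables (suc k) P = all-tables k (λ l → all-tables k (λ r → P (l , r)))

all-tables-sound : ∀ k {P} → all-tables k P ≡ true → ∀ t → P t ≡ true
all-tables-sound zero    p false = proj₁ (∧-true⁻ p)
all-tables-sound zero    p true  = proj₂ (∧-true⁻ p)
all-tables-sound (suc k) p (l , r) = all-tables-sound k (all-tables-sound k p l) r

_⇒_ : Bool → Bool → Bool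
false ⇒ b = true
true  ⇒ b = b

implies : ∀ {a b} → (a ≡ true → b ≡ true) → a ⇒ b ≡ true
implies {false} f = refl
implies {true}  f = f refl

_≡ᵇ?_ : Bool → Bool → Bool
a ≡ᵇ? b = not (a ⊕ b)

-- The standard symplectic form, in which the potential at a is dual to the current through e₁ and
-- that at b to the current through e₂. The term of c is absent because its potential is normalised
-- to 0.
ω : Vec Bool 4 → Vec Bool 4 → Bool
ω (u ∷ v ∷ j ∷ l ∷ []) (u′ ∷ v′ ∷ j′ ∷ l′ ∷ []) = (u ∧ j′ ⊕ v ∧ l′) ⊕ (u′ ∧ j ⊕ v′ ∧ l)

Σ² : (Bool → Bool → Bool) → Bool
Σ² f = (f false false ⊕ f false true) ⊕ (f true false ⊕ f true true)

-- N (u ∷ v ∷ j ∷ l ∷ []) stands for the parity of the number of solutions with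
-- potentials u, v, 0 at a, b, c and currents j, l, j + l through e₁, e₂, e₃.
module Response (N : Vec Bool 4 → Bool) where

  n : Bool → Bool → Bool → Bool → Bool
  n u v j l = N (u ∷ v ∷ j ∷ l ∷ [])

  all-currents : Bool → Bool → Bool
  all-currents j l = Σ² (λ u v → n u v j l)

  -- Each prescribes one of the three currents and equal potentials at the far ends of two star
  -- edges, everything else being summed over. For `along-c` the current is j + l, through e₃, and
  -- the equal potentials are those at a and b.
  along-a along-b along-c : Bool → Bool
  along-a r = Σ² (λ v l → n false v r l)
  along-b r = Σ² (λ u j → n u false j r)
  along-c r = Σ² (λ u j → n u u j (j ⊕ r))

  -- Ψ at the weights ε: the potentials at a, b, c are ε₁ j, ε₂ l and ε₃ (j + l),
  -- and the last is subtracted from all of them.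
  value : Bool → Bool → Bool → Bool
  value ε₁ ε₂ ε₃ = Σ² (λ j l → n (ε₁ ∧ j ⊕ ε₃ ∧ (j ⊕ l)) (ε₂ ∧ l ⊕ ε₃ ∧ (j ⊕ l)) j l)

  zeroes : ℕ
  zeroes = pair (value false false) + pair (value false true) + (pair (value true false) + pair (value true true))
    where
    pair : (Bool → Bool) → ℕ
    pair f = (if f false then 0 else 1) + (if f true then 0 else 1)

  balanced : Bool
  balanced = zeroes ≡ᵇ 4

  -- Up to a constant the potentials (1,1,0) at a, b, c are (0,0,1). So this counts the solutions
  -- without currents at the star and with potential 0 at a and b, that at c being arbitrary.
  fixedParity : Bool
  fixedParity = n false false false false ⊕ n true true false false

  -- The exchange of b and c: the potentials (u,0,v) are renormalised to vanish at c by subtracting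
  -- v, and the current through e₃ is j + l.
  swapped : Vec Bool 4 → Bool
  swapped (u ∷ v ∷ j ∷ l ∷ []) = n (u ⊕ v) v j (j ⊕ l)

  symmetric : Bool
  symmetric = all-vectors 4 (λ x → swapped x ≡ᵇ? N x)

  -- These exclude the isotropic subspaces of dimension less than two, for which some of the sums on
  -- the left would be 0 while the corresponding ones on the right are 1, or conversely.
  relations : Bool
  relations = ((all-currents true true ≡ᵇ? all-currents false false) ∧ ((all-currents true false ≡ᵇ? all-currents false false) ∧ (all-currents false true ≡ᵇ? all-currents false false)))
    ∧ ((along-a true ≡ᵇ? along-a false) ∧ ((along-b true ≡ᵇ? along-b false) ∧ (along-c true ≡ᵇ? along-c false)))

  subspace : Bool
  subspace = all-vectors 4 (λ x → N x ⇒ all-vectors 4 (λ y → N (x ⊕ᵛ y) ≡ᵇ? N y))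

  isotropicᵇ : Bool
  isotropicᵇ = all-vectors 4 (λ x → N x ⇒ all-vectors 4 (λ y → N y ⇒ not (ω x y)))

open Response using (relations; subspace; isotropicᵇ; zeroes; balanced; symmetric; fixedParity; swapped)

check : Table 4 → Bool
check t = (relations N ∧ (isotropicᵇ N ∧ subspace N)) ⇒
  (((zeroes N ≡ᵇ 0) ∨ ((zeroes N ≡ᵇ 4) ∨ (zeroes N ≡ᵇ 8))) ∧
   ((balanced (swapped N) ≡ᵇ? balanced N) ∧ (symmetric N ⇒ (balanced N ≡ᵇ? fixedParity N))))
  where
  N : Vec Bool 4 → Bool
  N = read t

-- Of the 2¹⁶ tables, only the zero table and the indicators of the fifteen
-- Lagrangian planes of F₂⁴ satisfy the hypotheses.
all-checked : all-tables 4 check ≡ true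
all-checked = refl

lagrangian-response : ∀ N → relations N ≡ true → isotropicᵇ N ≡ true → subspace N ≡ true →
  (zeroes N ≡ᵇ 0) ∨ ((zeroes N ≡ᵇ 4) ∨ (zeroes N ≡ᵇ 8)) ≡ true ×
  balanced (swapped N) ≡ balanced N ×
  (symmetric N ≡ true → balanced N ≡ fixedParity N)
lagrangian-response N r i s = counts , ≡ᵇ?⁻ (proj₁ (∧-true⁻ rest)) , λ p → ≡ᵇ?⁻ (⇒⁻ (proj₂ (∧-true⁻ {balanced (swapped N) ≡ᵇ? balanced N} rest)) p)
  where
  ⇒⁻ : ∀ {a b} → a ⇒ b ≡ true → a ≡ true → b ≡ true
  ⇒⁻ p refl = p
  ≡ᵇ?⁻ : ∀ {a b} → a ≡ᵇ? b ≡ true → a ≡ b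
  ≡ᵇ?⁻ p = ⊕-false⁻ (not-true⁻ p)
  -- The hypotheses evaluate N only at the sixteen explicit vectors, where `read (write N)` computes
  -- to N; so r, i and s serve for the table as they are.
  conclusion = ⇒⁻ (all-tables-sound 4 {check} all-checked (write N)) (∧-true⁺ r (∧-true⁺ i s))
  counts = proj₁ (∧-true⁻ conclusion)
  rest = proj₂ (∧-true⁻ {(zeroes N ≡ᵇ 0) ∨ ((zeroes N ≡ᵇ 4) ∨ (zeroes N ≡ᵇ 8))} conclusion)

-- Counting modulo 8

odd : ℕ → Bool
odd zero    = false
odd (suc n) = not (odd n)

odd-+ : ∀ m n → odd (m + n) ≡ odd m ⊕ odd n
odd-+ zero    n = refl
odd-+ (suc m) n = trans (cong not (odd-+ m n)) (lem (odd m) (odd n))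
  where
  lem : ∀ a b → not (a ⊕ b) ≡ not a ⊕ b
  lem false b     = refl
  lem true  false = refl
  lem true  true  = refl

even⇒half : ∀ n → odd n ≡ false → ∃ λ q → n ≡ q + q
even⇒half zero          _ = 0 , refl
even⇒half (suc (suc n)) p with odd n in eq
... | false = let q , n≡ = even⇒half n eq in suc q , trans (cong (λ k → suc (suc k)) n≡) (cong suc (sym (+-suc q q)))

Sℕ : ∀ n → (Vec Bool n → ℕ) → ℕ
Sℕ zero    F = F []
Sℕ (suc n) F = Sℕ n (F ∘ (false ∷_)) + Sℕ n (F ∘ (true ∷_))

Sℕ-cong : ∀ n {F G : Vec Bool n → ℕ} → (∀ z → F z ≡ G z) → Sℕ n F ≡ Sℕ n G
Sℕ-cong zero    eq = eq []
Sℕ-cong (suc n) eq = cong₂ _+_ (Sℕ-cong n (λ z → eq (false ∷ z))) (Sℕ-cong n (λ z → eq (true ∷ z)))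

Sℕ-+ : ∀ n (F G : Vec Bool n → ℕ) → Sℕ n (λ z → F z + G z) ≡ Sℕ n F + Sℕ n G
Sℕ-+ zero    F G = refl
Sℕ-+ (suc n) F G = trans (cong₂ _+_ (Sℕ-+ n (F ∘ (false ∷_)) (G ∘ (false ∷_))) (Sℕ-+ n (F ∘ (true ∷_)) (G ∘ (true ∷_))))
  (solve 4 (λ a b c d → (a :+ b) :+ (c :+ d) := (a :+ c) :+ (b :+ d)) refl (Sℕ n (F ∘ (false ∷_))) _ _ _)
  where open +-*-Solver

Sℕ-zero : ∀ n → Sℕ n (λ _ → 0) ≡ 0
Sℕ-zero zero    = refl
Sℕ-zero (suc n) = cong₂ _+_ (Sℕ-zero n) (Sℕ-zero n)

Sℕ-* : ∀ n k (F : Vec Bool n → ℕ) → Sℕ n (λ z → k * F z) ≡ k * Sℕ n F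
Sℕ-* zero    k F = refl
Sℕ-* (suc n) k F = trans (cong₂ _+_ (Sℕ-* n k (F ∘ (false ∷_))) (Sℕ-* n k (F ∘ (true ∷_)))) (sym (*-distribˡ-+ k (Sℕ n (F ∘ (false ∷_))) _))

odd-Sℕ : ∀ n (F : Vec Bool n → ℕ) → odd (Sℕ n F) ≡ S n (odd ∘ F)
odd-Sℕ zero    F = refl
odd-Sℕ (suc n) F = trans (odd-+ (Sℕ n (F ∘ (false ∷_))) _) (cong₂ _⊕_ (odd-Sℕ n (F ∘ (false ∷_))) (odd-Sℕ n (F ∘ (true ∷_))))

-- The sum over the i-th coordinate is stored at the point where that coordinate is `false`, and 0
-- at the other. The domain is unchanged, so the operation can be repeated for e₁, e₂, e₃ wherever
-- these edges stand in the list.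
overCoordinate : ∀ {n} → Fin n → (Vec Bool n → ℕ) → Vec Bool n → ℕ
overCoordinate i F z = if lookup z i then 0 else F (z [ i ]≔ false) + F (z [ i ]≔ true)

Sℕ-overCoordinate : ∀ {n} (i : Fin n) F → Sℕ n F ≡ Sℕ n (overCoordinate i F)
Sℕ-overCoordinate {suc n} zero F = sym (trans (cong₂ _+_ (Sℕ-+ n (F ∘ (false ∷_)) (F ∘ (true ∷_))) (Sℕ-zero n)) (+-identityʳ _))
Sℕ-overCoordinate {suc n} (suc i) F = cong₂ _+_ (Sℕ-overCoordinate i (F ∘ (false ∷_))) (Sℕ-overCoordinate i (F ∘ (true ∷_)))

Σ-involution : ∀ {n} (ρ : Fin n → Fin n) → (∀ i → ρ (ρ i) ≡ i) → ∀ φ → Σ n (φ ∘ ρ) ≡ Σ n φ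
Σ-involution {n} ρ ρρ φ = begin
  Σ n (φ ∘ ρ)                                 ≡⟨ Σ-cong n (λ i → sym (Σ-δ (ρ i) φ)) ⟩
  Σ n (λ i → Σ n (λ j → (j == ρ i) ∧ φ j))    ≡⟨ Σ-swap n n _ ⟩
  Σ n (λ j → Σ n (λ i → (j == ρ i) ∧ φ j))    ≡⟨ Σ-cong n (λ j → Σ-cong n (λ i → cong (λ k → k ∧ φ j) (flip j i))) ⟩
  Σ n (λ j → Σ n (λ i → (i == ρ j) ∧ φ j))    ≡⟨ Σ-cong n (λ j → Σ-δ (ρ j) (λ _ → φ j)) ⟩
  Σ n φ                                       ∎
  where
  open ≡-Reasoning
  half : ∀ j i → (j == ρ i) ≡ true → (i == ρ j) ≡ true
  half j i p rewrite ==-sound {i = j} p | ρρ i = ==-refl i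
  flip : ∀ j i → (j == ρ i) ≡ (i == ρ j)
  flip j i = bool-ext (half j i) (half i j)

lookup-ext : ∀ {n} {x y : Vec Bool n} → (∀ i → lookup x i ≡ lookup y i) → x ≡ y
lookup-ext {x = x} {y} eq = trans (sym (tabulate∘lookup x)) (trans (tabulate-cong eq) (tabulate∘lookup y))

lookup-ext-++ : ∀ n {m} (z z′ : Vec Bool (n + m)) → (∀ u → lookup z (u ↑ˡ m) ≡ lookup z′ (u ↑ˡ m)) →
                (∀ e → lookup z (n ↑ʳ e) ≡ lookup z′ (n ↑ʳ e)) → z ≡ z′
lookup-ext-++ zero    z       z′        _ q = lookup-ext q
lookup-ext-++ (suc n) (a ∷ z) (a′ ∷ z′) p q = cong₂ _∷_ (p zero) (lookup-ext-++ n z z′ (p ∘ suc) q)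

prod-map⁻ : ∀ {A : Set} {M} (f : A → Affine M) xs {z} → prod (map f xs) z ≡ true →
            ∀ {x} → x ∈ xs → at (proj₁ (f x)) z ⊕ proj₂ (f x) ≡ true
prod-map⁻ f (x ∷ xs) p (here refl) = proj₁ (∧-true⁻ p)
prod-map⁻ f (x ∷ xs) {z} p (there x∈) = prod-map⁻ f xs (proj₂ (∧-true⁻ {at (proj₁ (f x)) z ⊕ proj₂ (f x)} p)) x∈

prod-map⁺ : ∀ {A : Set} {M} (f : A → Affine M) xs {z} → (∀ {x} → x ∈ xs → at (proj₁ (f x)) z ⊕ proj₂ (f x) ≡ true) →
            prod (map f xs) z ≡ true
prod-map⁺ f []       p = refl
prod-map⁺ f (x ∷ xs) p = ∧-true⁺ (p (here refl)) (prod-map⁺ f xs (p ∘ there))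

zeroes-cong : ∀ {M N} → (∀ x → M x ≡ N x) → zeroes M ≡ zeroes N
zeroes-cong {M} {N} eq = cong₂ _+_ (cong₂ _+_ (pairs false false) (pairs false true)) (cong₂ _+_ (pairs true false) (pairs true true))
  where
  value-cong : ∀ ε₁ ε₂ ε₃ → Response.value M ε₁ ε₂ ε₃ ≡ Response.value N ε₁ ε₂ ε₃
  value-cong ε₁ ε₂ ε₃ = cong₂ _⊕_ (cong₂ _⊕_ (eq _) (eq _)) (cong₂ _⊕_ (eq _) (eq _))
  pairs : ∀ ε₁ ε₂ → _
  pairs ε₁ ε₂ = cong₂ (λ p q → (if p then 0 else 1) + (if q then 0 else 1)) (value-cong ε₁ ε₂ false) (value-cong ε₁ ε₂ true)

-- Division by 4 on the values 0, 4, 8, written by cases so that it is visibly odd only at 4.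
quarter : ℕ → ℕ
quarter z = if z ≡ᵇ 4 then 1 else if z ≡ᵇ 8 then 2 else 0

quarter-correct : ∀ z → (z ≡ᵇ 0) ∨ ((z ≡ᵇ 4) ∨ (z ≡ᵇ 8)) ≡ true → z ≡ 4 * quarter z
quarter-correct z p with z ≡ᵇ 0 in q₀ | z ≡ᵇ 4 in q₄ | z ≡ᵇ 8 in q₈
... | true  | true  | _     = ≡ᵇ⇒≡ z 4 (subst T (sym q₄) tt)
... | true  | false | true  = ≡ᵇ⇒≡ z 8 (subst T (sym q₈) tt)
... | true  | false | false = ≡ᵇ⇒≡ z 0 (subst T (sym q₀) tt)
... | false | true  | _     = ≡ᵇ⇒≡ z 4 (subst T (sym q₄) tt)
... | false | false | true  = ≡ᵇ⇒≡ z 8 (subst T (sym q₈) tt)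

odd-quarter : ∀ z → odd (quarter z) ≡ (z ≡ᵇ 4)
odd-quarter z with z ≡ᵇ 4 | z ≡ᵇ 8
... | true  | _     = refl
... | false | true  = refl
... | false | false = refl

-- Networks with a reflection that fixes the base vertex

record Reflection {n m : ℕ} (s t : Fin m → Fin n) (w : Fin n) : Set where
  field
    a b c    : Fin n
    e₁ e₂ e₃ : Fin m
    e₂≢e₁    : e₂ ≢ e₁
    e₃≢e₁    : e₃ ≢ e₁
    e₃≢e₂    : e₃ ≢ e₂
    ends₁    : (s e₁ ≡ w × t e₁ ≡ a) ⊎ (s e₁ ≡ a × t e₁ ≡ w)
    ends₂    : (s e₂ ≡ w × t e₂ ≡ b) ⊎ (s e₂ ≡ b × t e₂ ≡ w)
    ends₃    : (s e₃ ≡ w × t e₃ ≡ c) ⊎ (s e₃ ≡ c × t e₃ ≡ w)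
    at-w     : ∀ e → (w == s e) ⊕ (w == t e) ≡ (e == e₁) ∨ ((e == e₂) ∨ (e == e₃))
    ρᵛ       : Fin n → Fin n
    ρᵉ       : Fin m → Fin m
    ρᵛ-involutive : ∀ u → ρᵛ (ρᵛ u) ≡ u
    ρᵉ-involutive : ∀ e → ρᵉ (ρᵉ e) ≡ e
    ends-ρ   : ∀ e → (s (ρᵉ e) ≡ ρᵛ (s e) × t (ρᵉ e) ≡ ρᵛ (t e)) ⊎ (s (ρᵉ e) ≡ ρᵛ (t e) × t (ρᵉ e) ≡ ρᵛ (s e))
    ρw       : ρᵛ w ≡ w
    ρa       : ρᵛ a ≡ a
    ρb       : ρᵛ b ≡ c
    ρe₁      : ρᵉ e₁ ≡ e₁
    ρe₂      : ρᵉ e₂ ≡ e₃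
    -- The list has one edge from each orbit {e , ρ e} of size two.
    few-pairs : length (filter (λ e → toℕ e <? toℕ (ρᵉ e)) (allFin m)) + 2 < n

module Reflected {n m : ℕ} {s t : Fin m → Fin n} {w : Fin n} (reflection : Reflection s t w) where

  open Network s t w
  open Reflection reflection

  star : Fin m → Bool
  star e = (e == e₁) ∨ ((e == e₂) ∨ (e == e₃))

  star-e₁ : star e₁ ≡ true
  star-e₁ = cong (λ p → p ∨ ((e₁ == e₂) ∨ (e₁ == e₃))) (==-refl e₁)

  star-e₂ : star e₂ ≡ true
  star-e₂ = trans (cong (λ p → (e₂ == e₁) ∨ (p ∨ (e₂ == e₃))) (==-refl e₂)) (∨-zeroʳ (e₂ == e₁))

  star-e₃ : star e₃ ≡ true
  star-e₃ = trans (cong (λ p → (e₃ == e₁) ∨ ((e₃ == e₂) ∨ p)) (==-refl e₃))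
                  (trans (cong ((e₃ == e₁) ∨_) (∨-zeroʳ (e₃ == e₂))) (∨-zeroʳ (e₃ == e₁)))

  star⁻ : ∀ e → star e ≡ true → e ≡ e₁ ⊎ e ≡ e₂ ⊎ e ≡ e₃
  star⁻ e p with e == e₁ in q₁ | e == e₂ in q₂ | e == e₃ in q₃
  ... | true  | _     | _    = inj₁ (==-sound q₁)
  ... | false | true  | _    = inj₂ (inj₁ (==-sound q₂))
  ... | false | false | true = inj₂ (inj₂ (==-sound q₃))

  Π-star : ∀ φ → Π m φ ≡ Π m (λ e → star e ∨ φ e) ∧ (φ e₁ ∧ (φ e₂ ∧ φ e₃))
  Π-star φ = bool-ext
    (λ p → ∧-true⁺ (Π⁺ _ (λ e → trans (cong (star e ∨_) (Π⁻ φ p e)) (∨-zeroʳ (star e))))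
                   (∧-true⁺ (Π⁻ φ p e₁) (∧-true⁺ (Π⁻ φ p e₂) (Π⁻ φ p e₃))))
    (λ p → let r , q = ∧-true⁻ p ; p₁ , q′ = ∧-true⁻ q ; p₂ , p₃ = ∧-true⁻ q′ in
           Π⁺ φ (every (Π⁻ _ r) p₁ p₂ p₃))
    where
    every : (∀ e → star e ∨ φ e ≡ true) → φ e₁ ≡ true → φ e₂ ≡ true → φ e₃ ≡ true → ∀ e → φ e ≡ true
    every r p₁ p₂ p₃ e with star e in eq | r e
    ... | false | p = p
    ... | true  | _ with star⁻ e eq
    ...   | inj₁ refl        = p₁
    ...   | inj₂ (inj₁ refl) = p₂
    ...   | inj₂ (inj₂ refl) = p₃

  Σ-star : ∀ φ → Σ m φ ≡ φ e₁ ⊕ (φ e₂ ⊕ (φ e₃ ⊕ Σ m (λ e → not (star e) ∧ φ e)))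
  Σ-star φ = begin
    Σ m φ                                  ≡⟨ Σ-extract e₁ φ ⟩
    φ e₁ ⊕ Σ m φ₁                          ≡⟨ cong (φ e₁ ⊕_) (Σ-extract e₂ φ₁) ⟩
    φ e₁ ⊕ (φ₁ e₂ ⊕ Σ m φ₂)                ≡⟨ cong (λ k → φ e₁ ⊕ (φ₁ e₂ ⊕ k)) (Σ-extract e₃ φ₂) ⟩
    φ e₁ ⊕ (φ₁ e₂ ⊕ (φ₂ e₃ ⊕ Σ m φ₃))
      ≡⟨ cong (φ e₁ ⊕_) (cong₂ _⊕_ (cong (λ k → not k ∧ φ e₂) (==-false e₂≢e₁))
           (cong₂ _⊕_ (cong₂ (λ k l → not k ∧ (not l ∧ φ e₃)) (==-false e₃≢e₂) (==-false e₃≢e₁))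
             (Σ-cong m (λ e → collect (e == e₁) (e == e₂) (e == e₃) (φ e))))) ⟩
    φ e₁ ⊕ (φ e₂ ⊕ (φ e₃ ⊕ Σ m (λ e → not (star e) ∧ φ e))) ∎
    where
    open ≡-Reasoning
    φ₁ φ₂ φ₃ : Fin m → Bool
    φ₁ e = not (e == e₁) ∧ φ e
    φ₂ e = not (e == e₂) ∧ φ₁ e
    φ₃ e = not (e == e₃) ∧ φ₂ e
    collect : ∀ p q r x → not r ∧ (not q ∧ (not p ∧ x)) ≡ not (p ∨ (q ∨ r)) ∧ x
    collect p q r x = tautology 4 (λ { (p ∷ q ∷ r ∷ x ∷ []) → not r ∧ (not q ∧ (not p ∧ x)) })
                                  (λ { (p ∷ q ∷ r ∷ x ∷ []) → not (p ∨ (q ∨ r)) ∧ x }) refl (p ∷ q ∷ r ∷ x ∷ [])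

  -- The solutions before the weights of e₁, e₂, e₃ are specified.
  W : (Fin m → Bool) → Vec Bool (n + m) → Bool
  W α z = V z ∧ Π m (λ e → star e ∨ (at (edgeForm α e) z ⊕ true))

  W-edge : ∀ {α z} → W α z ≡ true → ∀ e → star e ≡ false → at (δ e) z ≡ α e ∧ at (Y e) z
  W-edge {α} {z} p e e∉ =
    ⊕-false⁻ (⊕-true⁻ (trans (cong (λ k → k ∨ (at (edgeForm α e) z ⊕ true)) (sym e∉)) (Π⁻ _ (proj₂ (∧-true⁻ p)) e)))

  W-translate : ∀ {α t} → W α t ≡ true → ∀ z → W α (t ⊕ᵛ z) ≡ W α z
  W-translate {α} {t} p z = cong₂ _∧_ (V-translate (proj₁ (∧-true⁻ p)) z) (Π-cong m edge)
    where
    edge : ∀ e → star e ∨ (at (edgeForm α e) (t ⊕ᵛ z) ⊕ true) ≡ star e ∨ (at (edgeForm α e) z ⊕ true)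
    edge e with star e in eq
    ... | true  = refl
    ... | false = cong (λ k → k ⊕ true) (trans (additive (edgeForm α e) t z)
                    (cong (λ k → k ⊕ at (edgeForm α e) z) (⊕-false⁺ (W-edge p e eq))))

  δ-star : ∀ {z} → V z ≡ true → ∀ {e u} → (s e ≡ w × t e ≡ u) ⊎ (s e ≡ u × t e ≡ w) → at (δ e) z ≡ at (X u) z
  δ-star {z} v {e} {u} (inj₁ (refl , refl)) = cong (λ k → k ⊕ at (X u) z) (V-X v)
  δ-star {z} v {e} {u} (inj₂ (refl , refl)) = trans (cong (at (X u) z ⊕_) (V-X v)) (xor-identityʳ _)

  current-at-w : ∀ {z} → V z ≡ true → at (Y e₃) z ≡ at (Y e₁) z ⊕ at (Y e₂) z
  current-at-w {z} v = ⊕-false⁻ (begin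
    y e₃ ⊕ (y e₁ ⊕ y e₂) ≡⟨ xor-comm (y e₃) _ ⟩
    (y e₁ ⊕ y e₂) ⊕ y e₃ ≡⟨ xor-assoc (y e₁) (y e₂) (y e₃) ⟩
    y e₁ ⊕ (y e₂ ⊕ y e₃) ≡⟨ cong (λ k → y e₁ ⊕ (y e₂ ⊕ k)) (sym (xor-identityʳ (y e₃))) ⟩
    y e₁ ⊕ (y e₂ ⊕ (y e₃ ⊕ false))
      ≡⟨ cong₂ _⊕_ (on star-e₁) (cong₂ _⊕_ (on star-e₂) (cong₂ _⊕_ (on star-e₃) (sym (Σ-false m off)))) ⟩
    φ e₁ ⊕ (φ e₂ ⊕ (φ e₃ ⊕ Σ m (λ e → not (star e) ∧ φ e))) ≡⟨ sym (Σ-star φ) ⟩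
    Σ m φ ≡⟨ V-∂ v w ⟩
    false ∎)
    where
    open ≡-Reasoning
    y φ : Fin m → Bool
    y e = at (Y e) z
    φ e = inc e w ∧ y e
    on : ∀ {e} → star e ≡ true → y e ≡ φ e
    on {e} p = cong (λ k → k ∧ y e) (sym (trans (at-w e) p))
    off : ∀ e → not (star e) ∧ φ e ≡ false
    off e with star e in eq
    ... | true  = refl
    ... | false = cong (λ k → k ∧ y e) (trans (at-w e) eq)

  -- Reciprocity. Pair the potential of z with the current of z′: the sum of y′ δx over all edges
  -- vanishes because y′ has no boundary. Off the star Ohm's law turns its terms into α y y′, which
  -- is symmetric in z and z′, so the contributions of the star agree as well.
  isotropic : ∀ {α z z′} → W α z ≡ true → W α z′ ≡ true →
    at (X a) z ∧ at (Y e₁) z′ ⊕ (at (X b) z ∧ at (Y e₂) z′ ⊕ at (X c) z ∧ at (Y e₃) z′) ≡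
    at (X a) z′ ∧ at (Y e₁) z ⊕ (at (X b) z′ ∧ at (Y e₂) z ⊕ at (X c) z′ ∧ at (Y e₃) z)
  isotropic {α} {z} {z′} p p′ =
    trans (half p p′) (trans (Σ-cong m rest-sym) (sym (half p′ p)))
    where
    open ≡-Reasoning
    rest : ∀ z z′ → Fin m → Bool
    rest z z′ e = not (star e) ∧ (at (Y e) z′ ∧ (α e ∧ at (Y e) z))
    rest-sym : ∀ e → rest z z′ e ≡ rest z′ z e
    rest-sym e = tautology 4 (λ { (k ∷ y ∷ a ∷ y′ ∷ []) → not k ∧ (y ∧ (a ∧ y′)) })
                              (λ { (k ∷ y ∷ a ∷ y′ ∷ []) → not k ∧ (y′ ∧ (a ∧ y)) })
                              refl (star e ∷ at (Y e) z′ ∷ α e ∷ at (Y e) z ∷ [])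
    half : ∀ {z z′} → W α z ≡ true → W α z′ ≡ true →
      at (X a) z ∧ at (Y e₁) z′ ⊕ (at (X b) z ∧ at (Y e₂) z′ ⊕ at (X c) z ∧ at (Y e₃) z′) ≡ Σ m (rest z z′)
    half {z} {z′} p p′ = ⊕-false⁻ (begin
      (A ⊕ (B ⊕ C)) ⊕ Σ m (rest z z′)
        ≡⟨ trans (xor-assoc A (B ⊕ C) _) (cong (A ⊕_) (xor-assoc B C _)) ⟩
      A ⊕ (B ⊕ (C ⊕ Σ m (rest z z′)))
        ≡⟨ cong₂ _⊕_ (term ends₁) (cong₂ _⊕_ (term ends₂) (cong₂ _⊕_ (term ends₃) (Σ-cong m inner))) ⟩
      φ e₁ ⊕ (φ e₂ ⊕ (φ e₃ ⊕ Σ m (λ e → not (star e) ∧ φ e)))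
        ≡⟨ sym (Σ-star φ) ⟩
      Σ m φ ≡⟨ sym (pairing (λ u → at (X u) z) z′) ⟩
      Σ n (λ u → at (X u) z ∧ at (∂ u) z′)
        ≡⟨ Σ-false n (λ u → trans (cong (at (X u) z ∧_) (V-∂ (proj₁ (∧-true⁻ p′)) u)) (∧-zeroʳ _)) ⟩
      false ∎)
      where
      A B C : Bool
      A = at (X a) z ∧ at (Y e₁) z′
      B = at (X b) z ∧ at (Y e₂) z′
      C = at (X c) z ∧ at (Y e₃) z′
      φ : Fin m → Bool
      φ e = at (Y e) z′ ∧ at (δ e) z
      term : ∀ {e u} → (s e ≡ w × t e ≡ u) ⊎ (s e ≡ u × t e ≡ w) → at (X u) z ∧ at (Y e) z′ ≡ φ e
      term {e} {u} j = trans (∧-comm (at (X u) z) _) (cong (at (Y e) z′ ∧_) (sym (δ-star (proj₁ (∧-true⁻ p)) j)))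
      inner : ∀ e → rest z z′ e ≡ not (star e) ∧ φ e
      inner e with star e in eq
      ... | true  = refl
      ... | false = cong (at (Y e) z′ ∧_) (sym (W-edge p e eq))

  -- Subtracting a constant from the potentials away from w.
  unit : Vec Bool (n + m)
  unit = tabulate (λ u → not (u == w)) ++ 0ᵛ

  X-unit : ∀ u → at (X u) unit ≡ not (u == w)
  X-unit u = trans (lookup-++ˡ (tabulate _) 0ᵛ u) (lookup∘tabulate _ u)

  Y-unit : ∀ e → at (Y e) unit ≡ false
  Y-unit e = trans (lookup-++ʳ (tabulate {n = n} _) 0ᵛ e) (lookup-replicate e false)

  V-unit : V unit ≡ true
  V-unit = V⁺ (trans (X-unit w) (cong not (==-refl w)))
              (λ u → Σ-false m (λ e → trans (cong (inc e u ∧_) (Y-unit e)) (∧-zeroʳ _)))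

  δ-unit : ∀ e → at (δ e) unit ≡ star e
  δ-unit e = begin
    at (X (s e)) unit ⊕ at (X (t e)) unit ≡⟨ cong₂ _⊕_ (X-unit (s e)) (X-unit (t e)) ⟩
    not (s e == w) ⊕ not (t e == w)       ≡⟨ nots (s e == w) (t e == w) ⟩
    (s e == w) ⊕ (t e == w)               ≡⟨ cong₂ _⊕_ (flip (s e)) (flip (t e)) ⟩
    (w == s e) ⊕ (w == t e)               ≡⟨ at-w e ⟩
    star e                                ∎
    where
    open ≡-Reasoning
    nots : ∀ p q → not p ⊕ not q ≡ p ⊕ q
    nots p q = tautology 2 (λ { (p ∷ q ∷ []) → not p ⊕ not q }) (λ { (p ∷ q ∷ []) → p ⊕ q }) refl (p ∷ q ∷ [])
    flip : ∀ u → (u == w) ≡ (w == u)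
    flip u = bool-ext (λ p → subst (λ k → (w == k) ≡ true) (sym (==-sound {i = u} p)) (==-refl w))
                      (λ p → subst (λ k → (k == w) ≡ true) (==-sound {i = w} p) (==-refl w))

  -- A constant added away from w changes potential differences only across the star, where `W`
  -- imposes no equation.
  W-unit : ∀ α → W α unit ≡ true
  W-unit α = ∧-true⁺ V-unit (Π⁺ _ edge)
    where
    edge : ∀ e → star e ∨ (at (edgeForm α e) unit ⊕ true) ≡ true
    edge e with star e in eq
    ... | true  = refl
    ... | false = ⊕-true⁺ (⊕-false⁺ (trans (δ-unit e) (trans eq (sym (trans (cong (α e ∧_) (Y-unit e)) (∧-zeroʳ _))))))

  X-unit-star : ∀ {e u} → star e ≡ true → (s e ≡ w × t e ≡ u) ⊎ (s e ≡ u × t e ≡ w) → at (X u) unit ≡ true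
  X-unit-star {e} e∈ j = trans (sym (δ-star V-unit j)) (trans (δ-unit e) e∈)

  -- `W` leaves three places free, one for each edge of the star. Filling them with f, g, h gives a
  -- system with n + m forms again, so the constants do not matter.
  W-constants : ∀ α (f g h : Form (n + m)) p q r p′ q′ r′ →
    S (n + m) (λ z → W α z ∧ ((at f z ⊕ p) ∧ ((at g z ⊕ q) ∧ (at h z ⊕ r)))) ≡
    S (n + m) (λ z → W α z ∧ ((at f z ⊕ p′) ∧ ((at g z ⊕ q′) ∧ (at h z ⊕ r′))))
  W-constants α f g h p q r p′ q′ r′ =
    trans (as-system p q r) (trans (System-constants forms (const p q r) (const p′ q′ r′)) (sym (as-system p′ q′ r′)))
    where
    open ≡-Reasoning
    override : ∀ {A : Set} → A → A → A → (Fin m → A) → Fin m → A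
    override x y z k e = if e == e₁ then x else if e == e₂ then y else if e == e₃ then z else k e
    forms : Fin m → Form (n + m)
    forms = override f g h (edgeForm α)
    const : Bool → Bool → Bool → Fin m → Bool
    const p q r = override p q r (λ _ → true)
    override-e₁ : ∀ {A : Set} (x y z : A) k → override x y z k e₁ ≡ x
    override-e₁ x y z k rewrite ==-refl e₁ = refl
    override-e₂ : ∀ {A : Set} (x y z : A) k → override x y z k e₂ ≡ y
    override-e₂ x y z k rewrite ==-false e₂≢e₁ | ==-refl e₂ = refl
    override-e₃ : ∀ {A : Set} (x y z : A) k → override x y z k e₃ ≡ z
    override-e₃ x y z k rewrite ==-false e₃≢e₁ | ==-false e₃≢e₂ | ==-refl e₃ = refl
    as-system : ∀ p q r → S (n + m) (λ z → W α z ∧ ((at f z ⊕ p) ∧ ((at g z ⊕ q) ∧ (at h z ⊕ r)))) ≡ System forms (const p q r)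
    as-system p q r = S-cong (n + m) pointwise
      where
      pointwise : ∀ z → W α z ∧ ((at f z ⊕ p) ∧ ((at g z ⊕ q) ∧ (at h z ⊕ r))) ≡
                        V z ∧ Π m (λ e → at (forms e) z ⊕ const p q r e)
      pointwise z = trans (∧-assoc (V z) _ _) (cong (V z ∧_) (trans (cong₂ _∧_ (Π-cong m off)
          (cong₂ _∧_ (cong₂ (λ F k → at F z ⊕ k) (sym (override-e₁ f g h (edgeForm α))) (sym (override-e₁ p q r (λ _ → true))))
          (cong₂ _∧_ (cong₂ (λ F k → at F z ⊕ k) (sym (override-e₂ f g h (edgeForm α))) (sym (override-e₂ p q r (λ _ → true))))
                     (cong₂ (λ F k → at F z ⊕ k) (sym (override-e₃ f g h (edgeForm α))) (sym (override-e₃ p q r (λ _ → true)))))))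
        (sym (Π-star (λ e → at (forms e) z ⊕ const p q r e)))))
        where
        off : ∀ e → star e ∨ (at (edgeForm α e) z ⊕ true) ≡ star e ∨ (at (forms e) z ⊕ const p q r e)
        off e with e == e₁ | e == e₂ | e == e₃
        ... | true  | _     | _     = refl
        ... | false | true  | _     = refl
        ... | false | false | true  = refl
        ... | false | false | false = refl

  -- A factor x + u + 1 tests x = u. Keeping the five values as plain Boolean arguments makes the
  -- expression accessible to `tautology`.
  indicator : (u v r j l xa xb xc y₁ y₂ : Bool) → Bool
  indicator u v r j l xa xb xc y₁ y₂ =
    (xa ⊕ not u) ∧ ((xb ⊕ not v) ∧ ((xc ⊕ not r) ∧ ((y₁ ⊕ not j) ∧ (y₂ ⊕ not l))))

  I : (u v r j l : Bool) → Vec Bool (n + m) → Bool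
  I u v r j l z = indicator u v r j l (at (X a) z) (at (X b) z) (at (X c) z) (at (Y e₁) z) (at (Y e₂) z)

  R : (Fin m → Bool) → (u v r j l : Bool) → Bool
  R α u v r j l = S (n + m) (λ z → W α z ∧ I u v r j l z)

  N : (Fin m → Bool) → Vec Bool 4 → Bool
  N α (u ∷ v ∷ j ∷ l ∷ []) = R α u v false j l

  R-shift : ∀ {α t} → W α t ≡ true → ∀ u v r j l →
    R α (at (X a) t ⊕ u) (at (X b) t ⊕ v) (at (X c) t ⊕ r) (at (Y e₁) t ⊕ j) (at (Y e₂) t ⊕ l) ≡ R α u v r j l
  R-shift {α} {t} p u v r j l = trans (sym (S-translate t _)) (S-cong (n + m) (λ z → cong₂ _∧_ (W-translate p z)
    (cong₂ _∧_ (shift (X a) u z) (cong₂ _∧_ (shift (X b) v z) (cong₂ _∧_ (shift (X c) r z)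
      (cong₂ _∧_ (shift (Y e₁) j z) (shift (Y e₂) l z)))))))
    where
    shift : ∀ f u z → at f (t ⊕ᵛ z) ⊕ not (at f t ⊕ u) ≡ at f z ⊕ not u
    shift f u z = trans (cong (λ k → k ⊕ not (at f t ⊕ u)) (additive f t z))
      (tautology 3 (λ { (p ∷ q ∷ u ∷ []) → (p ⊕ q) ⊕ not (p ⊕ u) }) (λ { (p ∷ q ∷ u ∷ []) → q ⊕ not u }) refl (at f t ∷ at f z ∷ u ∷ []))

  -- If r = 1, translate by `unit`, a solution without currents that flips the three potentials
  -- together.
  R-normalise : ∀ α u v r j l → R α u v r j l ≡ N α ((u ⊕ r) ∷ (v ⊕ r) ∷ j ∷ l ∷ [])
  R-normalise α u v false j l = cong₂ (λ u v → R α u v false j l) (sym (xor-identityʳ u)) (sym (xor-identityʳ v))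
  R-normalise α u v true  j l = begin
    R α u v true j l ≡⟨ sym (R-shift (W-unit α) u v true j l) ⟩
    R α (at (X a) unit ⊕ u) (at (X b) unit ⊕ v) (at (X c) unit ⊕ true) (at (Y e₁) unit ⊕ j) (at (Y e₂) unit ⊕ l)
      ≡⟨ cong₂ (λ p q → R α (p ⊕ u) (q ⊕ v) (at (X c) unit ⊕ true) (at (Y e₁) unit ⊕ j) (at (Y e₂) unit ⊕ l)) (X-unit-star star-e₁ ends₁) (X-unit-star star-e₂ ends₂) ⟩
    R α (true ⊕ u) (true ⊕ v) (at (X c) unit ⊕ true) (at (Y e₁) unit ⊕ j) (at (Y e₂) unit ⊕ l)
      ≡⟨ cong₂ (λ p q → R α (true ⊕ u) (true ⊕ v) (p ⊕ true) (q ⊕ j) (at (Y e₂) unit ⊕ l)) (X-unit-star star-e₃ ends₃) (Y-unit e₁) ⟩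
    R α (true ⊕ u) (true ⊕ v) false j (at (Y e₂) unit ⊕ l)
      ≡⟨ cong₂ (λ p q → R α p q false j (at (Y e₂) unit ⊕ l)) (xor-comm true u) (xor-comm true v) ⟩
    R α (u ⊕ true) (v ⊕ true) false j (at (Y e₂) unit ⊕ l)
      ≡⟨ cong (λ p → R α (u ⊕ true) (v ⊕ true) false j (p ⊕ l)) (Y-unit e₂) ⟩
    R α (u ⊕ true) (v ⊕ true) false j l ∎
    where open ≡-Reasoning

  N-witness : ∀ α u v j l → N α (u ∷ v ∷ j ∷ l ∷ []) ≡ true → ∃ λ z → W α z ≡ true ×
    at (X a) z ≡ u × at (X b) z ≡ v × at (X c) z ≡ false × at (Y e₁) z ≡ j × at (Y e₂) z ≡ l
  N-witness α u v j l p =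
    let z , q = S-witness (n + m) p
        W✓ , q₁ = ∧-true⁻ {W α z} q ; a✓ , q₂ = ∧-true⁻ q₁ ; b✓ , q₃ = ∧-true⁻ q₂ ; c✓ , q₄ = ∧-true⁻ q₃ ; 1✓ , 2✓ = ∧-true⁻ q₄
    in z , W✓ , eq a✓ , eq b✓ , eq c✓ , eq 1✓ , eq 2✓
    where
    eq : ∀ {x u} → x ⊕ not u ≡ true → x ≡ u
    eq {false} {false} _ = refl
    eq {true}  {true}  _ = refl

  -- An odd number of solutions with boundary values x yields at least one, and translation by it
  -- carries the solutions with values y to those with values x + y.
  N-translate : ∀ α x → N α x ≡ true → ∀ y → N α (x ⊕ᵛ y) ≡ N α y
  N-translate α (u ∷ v ∷ j ∷ l ∷ []) p (u′ ∷ v′ ∷ j′ ∷ l′ ∷ []) with N-witness α u v j l p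
  ... | z , W✓ , refl , refl , c✓ , refl , refl =
    trans (cong (λ k → R α (at (X a) z ⊕ u′) (at (X b) z ⊕ v′) k (at (Y e₁) z ⊕ j′) (at (Y e₂) z ⊕ l′)) (sym (cong (_⊕ false) c✓))) (R-shift W✓ u′ v′ false j′ l′)

  N-isotropic : ∀ α x y → N α x ≡ true → N α y ≡ true → ω x y ≡ false
  N-isotropic α (u ∷ v ∷ j ∷ l ∷ []) (u′ ∷ v′ ∷ j′ ∷ l′ ∷ []) p p′
    with N-witness α u v j l p | N-witness α u′ v′ j′ l′ p′
  ... | z , W✓ , refl , refl , c✓ , refl , refl | z′ , W✓′ , refl , refl , c✓′ , refl , refl =
    ⊕-false⁺ (trans (drop z z′ c✓) (trans (isotropic {α} W✓ W✓′) (sym (drop z′ z c✓′))))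
    where
    drop : ∀ z z′ → at (X c) z ≡ false →
      at (X a) z ∧ at (Y e₁) z′ ⊕ at (X b) z ∧ at (Y e₂) z′ ≡
      at (X a) z ∧ at (Y e₁) z′ ⊕ (at (X b) z ∧ at (Y e₂) z′ ⊕ at (X c) z ∧ at (Y e₃) z′)
    drop z z′ q = cong (at (X a) z ∧ at (Y e₁) z′ ⊕_)
      (sym (trans (cong (λ k → at (X b) z ∧ at (Y e₂) z′ ⊕ k ∧ at (Y e₃) z′) q) (xor-identityʳ _)))

  gather : ∀ α (F : Bool → Bool → Vec Bool (n + m) → Bool) →
    Σ² (λ p q → S (n + m) (λ z → W α z ∧ F p q z)) ≡ S (n + m) (λ z → W α z ∧ Σ² (λ p q → F p q z))
  gather α F = begin
    (σ false false ⊕ σ false true) ⊕ (σ true false ⊕ σ true true)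
      ≡⟨ cong₂ _⊕_ (sym (S-⊕ (n + m) (G false false) (G false true))) (sym (S-⊕ (n + m) (G true false) (G true true))) ⟩
    S (n + m) (λ z → G false false z ⊕ G false true z) ⊕ S (n + m) (λ z → G true false z ⊕ G true true z)
      ≡⟨ sym (S-⊕ (n + m) _ _) ⟩
    S (n + m) (λ z → (G false false z ⊕ G false true z) ⊕ (G true false z ⊕ G true true z))
      ≡⟨ S-cong (n + m) (λ z → factor (W α z) (F false false z) (F false true z) (F true false z) (F true true z)) ⟩
    S (n + m) (λ z → W α z ∧ Σ² (λ p q → F p q z)) ∎
    where
    open ≡-Reasoning
    G : Bool → Bool → Vec Bool (n + m) → Bool
    G p q z = W α z ∧ F p q z
    σ : Bool → Bool → Bool
    σ p q = S (n + m) (G p q)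
    factor : ∀ w a b c d → (w ∧ a ⊕ w ∧ b) ⊕ (w ∧ c ⊕ w ∧ d) ≡ w ∧ ((a ⊕ b) ⊕ (c ⊕ d))
    factor true  a b c d = refl
    factor false a b c d = refl

  combine : ∀ α (F : Bool → Bool → Vec Bool (n + m) → Bool) (G : Vec Bool (n + m) → Bool) →
    (∀ z → Σ² (λ p q → F p q z) ≡ G z) →
    Σ² (λ p q → S (n + m) (λ z → W α z ∧ F p q z)) ≡ S (n + m) (λ z → W α z ∧ G z)
  combine α F G eq = trans (gather α F) (S-cong (n + m) (λ z → cong (W α z ∧_) (eq z)))

  module _ (α : Fin m → Bool) where

    open Response (N α) using (all-currents; along-a; along-b; along-c)

    -- Summing over two boundary values removes their factors from the indicator. Three affine
    -- conditions remain, just as many as `W-constants` handles; the same holds for the three lemmas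
    -- below.
    all-currents-constant : ∀ j l → all-currents j l ≡ all-currents false false
    all-currents-constant j l = trans (as-sum j l)
      (trans (W-constants α (X c) (Y e₁) (Y e₂) true (not j) (not l) true true true) (sym (as-sum false false)))
      where
      as-sum : ∀ j l → all-currents j l ≡
        S (n + m) (λ z → W α z ∧ ((at (X c) z ⊕ true) ∧ ((at (Y e₁) z ⊕ not j) ∧ (at (Y e₂) z ⊕ not l))))
      as-sum j l = combine α (λ u v → I u v false j l) _ (λ z → tautology 7
        (λ { (j ∷ l ∷ a ∷ b ∷ c ∷ y ∷ y′ ∷ []) → Σ² (λ u v → indicator u v false j l a b c y y′) })
        (λ { (j ∷ l ∷ a ∷ b ∷ c ∷ y ∷ y′ ∷ []) → (c ⊕ true) ∧ ((y ⊕ not j) ∧ (y′ ⊕ not l)) })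
        refl (j ∷ l ∷ at (X a) z ∷ at (X b) z ∷ at (X c) z ∷ at (Y e₁) z ∷ at (Y e₂) z ∷ []))

    along-a-constant : ∀ r → along-a r ≡ along-a false
    along-a-constant r = trans (as-sum r)
      (trans (W-constants α (X a) (X c) (Y e₁) true true (not r) true true true) (sym (as-sum false)))
      where
      as-sum : ∀ r → along-a r ≡
        S (n + m) (λ z → W α z ∧ ((at (X a) z ⊕ true) ∧ ((at (X c) z ⊕ true) ∧ (at (Y e₁) z ⊕ not r))))
      as-sum r = combine α (λ v l → I false v false r l) _ (λ z → tautology 6
        (λ { (r ∷ a ∷ b ∷ c ∷ y ∷ y′ ∷ []) → Σ² (λ v l → indicator false v false r l a b c y y′) })
        (λ { (r ∷ a ∷ b ∷ c ∷ y ∷ y′ ∷ []) → (a ⊕ true) ∧ ((c ⊕ true) ∧ (y ⊕ not r)) })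
        refl (r ∷ at (X a) z ∷ at (X b) z ∷ at (X c) z ∷ at (Y e₁) z ∷ at (Y e₂) z ∷ []))

    along-b-constant : ∀ r → along-b r ≡ along-b false
    along-b-constant r = trans (as-sum r)
      (trans (W-constants α (X b) (X c) (Y e₂) true true (not r) true true true) (sym (as-sum false)))
      where
      as-sum : ∀ r → along-b r ≡
        S (n + m) (λ z → W α z ∧ ((at (X b) z ⊕ true) ∧ ((at (X c) z ⊕ true) ∧ (at (Y e₂) z ⊕ not r))))
      as-sum r = combine α (λ u j → I u false false j r) _ (λ z → tautology 6
        (λ { (r ∷ a ∷ b ∷ c ∷ y ∷ y′ ∷ []) → Σ² (λ u j → indicator u false false j r a b c y y′) })
        (λ { (r ∷ a ∷ b ∷ c ∷ y ∷ y′ ∷ []) → (b ⊕ true) ∧ ((c ⊕ true) ∧ (y′ ⊕ not r)) })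
        refl (r ∷ at (X a) z ∷ at (X b) z ∷ at (X c) z ∷ at (Y e₁) z ∷ at (Y e₂) z ∷ []))

    along-c-constant : ∀ r → along-c r ≡ along-c false
    along-c-constant r = trans (as-sum r)
      (trans (W-constants α (X a ⊞ X b) (X c) (Y e₁ ⊞ Y e₂) true true (not r) true true true) (sym (as-sum false)))
      where
      as-sum : ∀ r → along-c r ≡
        S (n + m) (λ z → W α z ∧ (((at (X a) z ⊕ at (X b) z) ⊕ true) ∧ ((at (X c) z ⊕ true) ∧ ((at (Y e₁) z ⊕ at (Y e₂) z) ⊕ not r))))
      as-sum r = combine α (λ u j → I u u false j (j ⊕ r)) _ (λ z → tautology 6
        (λ { (r ∷ a ∷ b ∷ c ∷ y ∷ y′ ∷ []) → Σ² (λ u j → indicator u u false j (j ⊕ r) a b c y y′) })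
        (λ { (r ∷ a ∷ b ∷ c ∷ y ∷ y′ ∷ []) → ((a ⊕ b) ⊕ true) ∧ ((c ⊕ true) ∧ ((y ⊕ y′) ⊕ not r)) })
        refl (r ∷ at (X a) z ∷ at (X b) z ∷ at (X c) z ∷ at (Y e₁) z ∷ at (Y e₂) z ∷ []))

    N-relations : relations (N α) ≡ true
    N-relations =
      ∧-true⁺ (∧-true⁺ (eq (all-currents-constant true true)) (∧-true⁺ (eq (all-currents-constant true false)) (eq (all-currents-constant false true))))
              (∧-true⁺ (eq (along-a-constant true)) (∧-true⁺ (eq (along-b-constant true)) (eq (along-c-constant true))))
      where
      eq : ∀ {x y} → x ≡ y → x ≡ᵇ? y ≡ true
      eq p = not-true⁺ (⊕-false⁺ p)

    N-subspace : subspace (N α) ≡ true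
    N-subspace = all-vectors-complete {4} (λ x → implies (λ p → all-vectors-complete {4} (λ y → not-true⁺ (⊕-false⁺ (N-translate α x p y)))))

    N-isotropicᵇ : isotropicᵇ (N α) ≡ true
    N-isotropicᵇ = all-vectors-complete {4} (λ x → implies (λ p → all-vectors-complete {4} (λ y → implies (λ q → not-true⁺ (N-isotropic α x y p q)))))

    -- On `W` the equations at the star read x(a) = ε₁ j, x(b) = ε₂ l and x(c) = ε₃ (j + l), where j
    -- and l are the currents through e₁ and e₂. Exactly one term of the sum over j and l has the
    -- currents of a given solution.
    Q-value : ∀ {α′} ε₁ ε₂ ε₃ → α′ e₁ ≡ ε₁ → α′ e₂ ≡ ε₂ → α′ e₃ ≡ ε₃ →
      (∀ e → star e ≡ false → α′ e ≡ α e) → Q α′ ≡ Response.value (N α) ε₁ ε₂ ε₃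
    Q-value {α′} ε₁ ε₂ ε₃ refl refl refl same = begin
      Q α′ ≡⟨ S-cong (n + m) split ⟩
      S (n + m) (λ z → W α z ∧ G z) ≡⟨ S-cong (n + m) (λ z → on-W z) ⟩
      S (n + m) (λ z → W α z ∧ Σ² (λ j l → I (ε₁ ∧ j) (ε₂ ∧ l) (ε₃ ∧ (j ⊕ l)) j l z))
        ≡⟨ sym (gather α (λ j l → I (ε₁ ∧ j) (ε₂ ∧ l) (ε₃ ∧ (j ⊕ l)) j l)) ⟩
      Σ² (λ j l → R α (ε₁ ∧ j) (ε₂ ∧ l) (ε₃ ∧ (j ⊕ l)) j l)
        ≡⟨ cong₂ _⊕_ (cong₂ _⊕_ (term false false) (term false true)) (cong₂ _⊕_ (term true false) (term true true)) ⟩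
      Response.value (N α) ε₁ ε₂ ε₃ ∎
      where
      open ≡-Reasoning
      term : ∀ j l → R α (ε₁ ∧ j) (ε₂ ∧ l) (ε₃ ∧ (j ⊕ l)) j l ≡ N α ((ε₁ ∧ j ⊕ ε₃ ∧ (j ⊕ l)) ∷ (ε₂ ∧ l ⊕ ε₃ ∧ (j ⊕ l)) ∷ j ∷ l ∷ [])
      term j l = R-normalise α (ε₁ ∧ j) (ε₂ ∧ l) (ε₃ ∧ (j ⊕ l)) j l
      φ : Vec Bool (n + m) → Fin m → Bool
      φ z e = at (edgeForm α′ e) z ⊕ true
      G : Vec Bool (n + m) → Bool
      G z = φ z e₁ ∧ (φ z e₂ ∧ φ z e₃)
      split : ∀ z → V z ∧ Π m (φ z) ≡ W α z ∧ G z
      split z = trans (cong (V z ∧_) (trans (Π-star (φ z)) (cong (_∧ G z) (Π-cong m off)))) (sym (∧-assoc (V z) _ _))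
        where
        off : ∀ e → star e ∨ φ z e ≡ star e ∨ (at (edgeForm α e) z ⊕ true)
        off e with star e in eq
        ... | true  = refl
        ... | false = cong (λ k → (at (δ e) z ⊕ k ∧ at (Y e) z) ⊕ true) (same e eq)
      on-W : ∀ z → W α z ∧ G z ≡ W α z ∧ Σ² (λ j l → I (ε₁ ∧ j) (ε₂ ∧ l) (ε₃ ∧ (j ⊕ l)) j l z)
      on-W z with W α z in W✓
      ... | false = refl
      ... | true  = trans (cong₂ _∧_ (factor ends₁) (cong₂ _∧_ (factor ends₂)
            (trans (factor ends₃) (cong (λ k → (at (X c) z ⊕ ε₃ ∧ k) ⊕ true) (current-at-w V✓)))))
          (tautology 8
            (λ { (p ∷ q ∷ r ∷ a ∷ b ∷ c ∷ y ∷ y′ ∷ []) → ((a ⊕ p ∧ y) ⊕ true) ∧ (((b ⊕ q ∧ y′) ⊕ true) ∧ ((c ⊕ r ∧ (y ⊕ y′)) ⊕ true)) })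
            (λ { (p ∷ q ∷ r ∷ a ∷ b ∷ c ∷ y ∷ y′ ∷ []) → Σ² (λ j l → indicator (p ∧ j) (q ∧ l) (r ∧ (j ⊕ l)) j l a b c y y′) })
            refl (ε₁ ∷ ε₂ ∷ ε₃ ∷ at (X a) z ∷ at (X b) z ∷ at (X c) z ∷ at (Y e₁) z ∷ at (Y e₂) z ∷ []))
        where
        V✓ : V z ≡ true
        V✓ = proj₁ (∧-true⁻ W✓)
        factor : ∀ {e u} → (s e ≡ w × t e ≡ u) ⊎ (s e ≡ u × t e ≡ w) → φ z e ≡ (at (X u) z ⊕ α′ e ∧ at (Y e) z) ⊕ true
        factor {e} j = cong (λ k → (k ⊕ α′ e ∧ at (Y e) z) ⊕ true) (δ-star V✓ j)

  ρc : ρᵛ c ≡ b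
  ρc = trans (cong ρᵛ (sym ρb)) (ρᵛ-involutive b)

  ρe₃ : ρᵉ e₃ ≡ e₂
  ρe₃ = trans (cong ρᵉ (sym ρe₂)) (ρᵉ-involutive e₂)

  reflectEdges : Vec Bool m → Vec Bool m
  reflectEdges α = tabulate (λ e → lookup α (ρᵉ e))

  reflectEdges-involutive : ∀ α → reflectEdges (reflectEdges α) ≡ α
  reflectEdges-involutive α = lookup-ext (λ e →
    trans (lookup∘tabulate _ e) (trans (lookup∘tabulate _ (ρᵉ e)) (cong (lookup α) (ρᵉ-involutive e))))

  reflect : Vec Bool (n + m) → Vec Bool (n + m)
  reflect z = tabulate (λ u → at (X (ρᵛ u)) z) ++ tabulate (λ e → at (Y (ρᵉ e)) z)

  X-reflect : ∀ u z → at (X u) (reflect z) ≡ at (X (ρᵛ u)) z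
  X-reflect u z = trans (lookup-++ˡ (tabulate _) _ u) (lookup∘tabulate _ u)

  Y-reflect : ∀ e z → at (Y e) (reflect z) ≡ at (Y (ρᵉ e)) z
  Y-reflect e z = trans (lookup-++ʳ (tabulate {n = n} _) _ e) (lookup∘tabulate _ e)

  reflect-involutive : ∀ z → reflect (reflect z) ≡ z
  reflect-involutive z = lookup-ext-++ n _ z
    (λ u → trans (X-reflect u (reflect z)) (trans (X-reflect (ρᵛ u) z) (cong (λ u → at (X u) z) (ρᵛ-involutive u))))
    (λ e → trans (Y-reflect e (reflect z)) (trans (Y-reflect (ρᵉ e) z) (cong (λ e → at (Y e) z) (ρᵉ-involutive e))))

  δ-reflect : ∀ e z → at (δ e) (reflect z) ≡ at (δ (ρᵉ e)) z
  δ-reflect e z with ends-ρ e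
  ... | inj₁ (p , q) = trans (cong₂ _⊕_ (X-reflect (s e) z) (X-reflect (t e) z))
                             (cong₂ (λ u v → at (X u) z ⊕ at (X v) z) (sym p) (sym q))
  ... | inj₂ (p , q) = trans (cong₂ _⊕_ (X-reflect (s e) z) (X-reflect (t e) z))
                             (trans (cong₂ (λ u v → at (X u) z ⊕ at (X v) z) (sym q) (sym p)) (xor-comm (at (X (t (ρᵉ e))) z) _))

  ==-ρ : ∀ u v → (u == v) ≡ (ρᵛ u == ρᵛ v)
  ==-ρ u v = bool-ext (λ k → subst (λ v → (ρᵛ u == ρᵛ v) ≡ true) (==-sound k) (==-refl (ρᵛ u)))
    (λ k → subst (λ v → (u == v) ≡ true) (trans (sym (ρᵛ-involutive u)) (trans (cong ρᵛ (==-sound k)) (ρᵛ-involutive v))) (==-refl u))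

  inc-ρ : ∀ e u → inc e u ≡ inc (ρᵉ e) (ρᵛ u)
  inc-ρ e u with ends-ρ e
  ... | inj₁ (p , q) = cong₂ _⊕_ (trans (==-ρ u (s e)) (cong (ρᵛ u ==_) (sym p))) (trans (==-ρ u (t e)) (cong (ρᵛ u ==_) (sym q)))
  ... | inj₂ (p , q) = trans (cong₂ _⊕_ (trans (==-ρ u (s e)) (cong (ρᵛ u ==_) (sym q))) (trans (==-ρ u (t e)) (cong (ρᵛ u ==_) (sym p)))) (xor-comm (ρᵛ u == t (ρᵉ e)) _)

  ∂-reflect : ∀ u z → at (∂ u) (reflect z) ≡ at (∂ (ρᵛ u)) z
  ∂-reflect u z = trans (Σ-cong m (λ e → cong₂ _∧_ (inc-ρ e u) (Y-reflect e z)))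
                        (Σ-involution ρᵉ ρᵉ-involutive (λ e → inc e (ρᵛ u) ∧ at (Y e) z))

  star-ρ : ∀ e → star e ≡ false → star (ρᵉ e) ≡ false
  star-ρ e p with star (ρᵉ e) in eq
  ... | false = refl
  ... | true  = trans (sym (on (star⁻ (ρᵉ e) eq))) p
    where
    back : ∀ {f g} → ρᵉ f ≡ g → ρᵉ e ≡ f → star g ≡ true → star e ≡ true
    back q r g∈ = subst (λ e → star e ≡ true) (sym (trans (sym (ρᵉ-involutive e)) (trans (cong ρᵉ r) q))) g∈
    on : ρᵉ e ≡ e₁ ⊎ ρᵉ e ≡ e₂ ⊎ ρᵉ e ≡ e₃ → star e ≡ true
    on (inj₁ r)        = back ρe₁ r star-e₁
    on (inj₂ (inj₁ r)) = back ρe₂ r star-e₃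
    on (inj₂ (inj₂ r)) = back ρe₃ r star-e₂

  W⁺ : ∀ {α z} → V z ≡ true → (∀ e → star e ≡ false → at (δ e) z ≡ α e ∧ at (Y e) z) → W α z ≡ true
  W⁺ {α} {z} v p = ∧-true⁺ v (Π⁺ _ edge)
    where
    edge : ∀ e → star e ∨ (at (edgeForm α e) z ⊕ true) ≡ true
    edge e with star e in eq
    ... | true  = refl
    ... | false = ⊕-true⁺ (⊕-false⁺ (p e eq))

  W-reflect : ∀ {α z} → W α z ≡ true → W (α ∘ ρᵉ) (reflect z) ≡ true
  W-reflect {α} {z} p = W⁺
    (V⁺ (trans (X-reflect w z) (trans (cong (λ u → at (X u) z) ρw) (V-X v))) (λ u → trans (∂-reflect u z) (V-∂ v (ρᵛ u))))
    (λ e e∉ → trans (δ-reflect e z) (trans (W-edge p (ρᵉ e) (star-ρ e e∉)) (cong (α (ρᵉ e) ∧_) (sym (Y-reflect e z)))))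
    where
    v : V z ≡ true
    v = proj₁ (∧-true⁻ p)

  W-cong : ∀ {α β} → (∀ e → α e ≡ β e) → ∀ z → W α z ≡ W β z
  W-cong eq z = cong (V z ∧_) (Π-cong m (λ e → cong (λ k → star e ∨ ((at (δ e) z ⊕ k ∧ at (Y e) z) ⊕ true)) (eq e)))

  W-reflect-≡ : ∀ α z → W (α ∘ ρᵉ) (reflect z) ≡ W α z
  W-reflect-≡ α z = bool-ext
    (λ p → trans (W-cong (λ e → cong α (sym (ρᵉ-involutive e))) z)
             (subst (λ z → W (α ∘ ρᵉ ∘ ρᵉ) z ≡ true) (reflect-involutive z) (W-reflect p)))
    W-reflect

  R-cong : ∀ {α β} → (∀ e → α e ≡ β e) → ∀ u v r j l → R α u v r j l ≡ R β u v r j l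
  R-cong eq u v r j l = S-cong (n + m) (λ z → cong (_∧ I u v r j l z) (W-cong eq z))

  N-cong : ∀ {α β} → (∀ e → α e ≡ β e) → ∀ x → N α x ≡ N β x
  N-cong eq (u ∷ v ∷ j ∷ l ∷ []) = R-cong eq u v false j l

  -- Reindexing by `reflect` exchanges the potentials at b and c. The condition on e₂ becomes one on
  -- e₃, whose current is the sum of the other two by Kirchhoff's law at w; so the current through
  -- e₂ has to be j + l.
  R-reflect : ∀ α u v r j l → R (α ∘ ρᵉ) u v r j l ≡ R α u r v j (j ⊕ l)
  R-reflect α u v r j l = trans (sym (S-involution reflect reflect-involutive _)) (S-cong (n + m) pointwise)
    where
    pointwise : ∀ z → W (α ∘ ρᵉ) (reflect z) ∧ I u v r j l (reflect z) ≡ W α z ∧ I u r v j (j ⊕ l) z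
    pointwise z with W α z in W✓ | W-reflect-≡ α z
    ... | false | q = cong (_∧ I u v r j l (reflect z)) q
    ... | true  | q = trans (cong₂ _∧_ q indicators) (tautology 10
        (λ { (u ∷ v ∷ r ∷ j ∷ l ∷ a ∷ b ∷ c ∷ y ∷ y′ ∷ []) → indicator u v r j l a c b y (y ⊕ y′) })
        (λ { (u ∷ v ∷ r ∷ j ∷ l ∷ a ∷ b ∷ c ∷ y ∷ y′ ∷ []) → indicator u r v j (j ⊕ l) a b c y y′ }) refl
        (u ∷ v ∷ r ∷ j ∷ l ∷ at (X a) z ∷ at (X b) z ∷ at (X c) z ∷ at (Y e₁) z ∷ at (Y e₂) z ∷ []))
      where
      x : ∀ {u v} → ρᵛ u ≡ v → at (X u) (reflect z) ≡ at (X v) z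
      x {u} refl = X-reflect u z
      y : ∀ {e f} → ρᵉ e ≡ f → at (Y e) (reflect z) ≡ at (Y f) z
      y {e} refl = Y-reflect e z
      indicators : I u v r j l (reflect z) ≡
        indicator u v r j l (at (X a) z) (at (X c) z) (at (X b) z) (at (Y e₁) z) (at (Y e₁) z ⊕ at (Y e₂) z)
      indicators = cong₂ _∧_ (cong (_⊕ not u) (x ρa)) (cong₂ _∧_ (cong (_⊕ not v) (x ρb)) (cong₂ _∧_ (cong (_⊕ not r) (x ρc))
        (cong₂ _∧_ (cong (_⊕ not j) (y ρe₁)) (cong (_⊕ not l) (trans (y ρe₂) (current-at-w (proj₁ (∧-true⁻ W✓))))))))

  N-reflect : ∀ α x → N (α ∘ ρᵉ) x ≡ swapped (N α) x
  N-reflect α (u ∷ v ∷ j ∷ l ∷ []) = trans (R-reflect α u v false j l) (R-normalise α u false v j (j ⊕ l))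

  N-lagrangian : ∀ α → _
  N-lagrangian α = lagrangian-response (N α) (N-relations α) (N-isotropicᵇ α) (N-subspace α)

  -- Selects one weighting from each class of eight that agree off the star. `N` is constant on such
  -- a class, as `W` does not see the weights of the star.
  free : Vec Bool m → Bool
  free α = (lookup α e₁ ⊕ true) ∧ ((lookup α e₂ ⊕ true) ∧ (lookup α e₃ ⊕ true))

  assign : Vec Bool m → Bool → Bool → Bool → Vec Bool m
  assign α ε₁ ε₂ ε₃ = ((α [ e₁ ]≔ ε₁) [ e₂ ]≔ ε₂) [ e₃ ]≔ ε₃

  Q-assign : ∀ α ε₁ ε₂ ε₃ → Q (lookup (assign α ε₁ ε₂ ε₃)) ≡ Response.value (N (lookup α)) ε₁ ε₂ ε₃
  Q-assign α ε₁ ε₂ ε₃ = Q-value (lookup α) ε₁ ε₂ ε₃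
    (trans (lookup∘update′ (e₃≢e₁ ∘ sym) α₂ ε₃) (trans (lookup∘update′ (e₂≢e₁ ∘ sym) α₁ ε₂) (lookup∘update e₁ α ε₁)))
    (trans (lookup∘update′ (e₃≢e₂ ∘ sym) α₂ ε₃) (lookup∘update e₂ α₁ ε₂))
    (lookup∘update e₃ α₂ ε₃)
    (λ e e∉ → trans (lookup∘update′ (avoid e e₃ star-e₃ e∉) α₂ ε₃)
             (trans (lookup∘update′ (avoid e e₂ star-e₂ e∉) α₁ ε₂) (lookup∘update′ (avoid e e₁ star-e₁ e∉) α ε₁)))
    where
    α₁ α₂ : Vec Bool m
    α₁ = α [ e₁ ]≔ ε₁
    α₂ = α₁ [ e₂ ]≔ ε₂
    avoid : ∀ e f → star f ≡ true → star e ≡ false → e ≢ f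
    avoid e f f∈ e∉ refl = true≢false (trans (sym f∈) e∉)

  isZero : Vec Bool m → ℕ
  isZero α = if Q (lookup α) then 0 else 1

  sum-over-star : Sℕ m isZero ≡ Sℕ m (λ α → if free α then zeroes (N (lookup α)) else 0)
  sum-over-star = trans (Sℕ-overCoordinate e₃ isZero) (trans (Sℕ-overCoordinate e₂ F₃) (trans (Sℕ-overCoordinate e₁ F₂) (Sℕ-cong m pointwise)))
    where
    F₃ F₂ : Vec Bool m → ℕ
    F₃ = overCoordinate e₃ isZero
    F₂ = overCoordinate e₂ F₃
    pair : Vec Bool m → Bool → Bool → ℕ
    pair α ε₁ ε₂ = isZero (assign α ε₁ ε₂ false) + isZero (assign α ε₁ ε₂ true)
    F₃-assign : ∀ α ε₁ ε₂ → F₃ ((α [ e₁ ]≔ ε₁) [ e₂ ]≔ ε₂) ≡ (if lookup α e₃ then 0 else pair α ε₁ ε₂)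
    F₃-assign α ε₁ ε₂ = cong (λ k → if k then 0 else pair α ε₁ ε₂)
      (trans (lookup∘update′ e₃≢e₂ (α [ e₁ ]≔ ε₁) ε₂) (lookup∘update′ e₃≢e₁ α ε₁))
    F₂-assign : ∀ α ε₁ → F₂ (α [ e₁ ]≔ ε₁) ≡
      (if lookup α e₂ then 0 else (if lookup α e₃ then 0 else pair α ε₁ false) + (if lookup α e₃ then 0 else pair α ε₁ true))
    F₂-assign α ε₁ = cong₂ (λ k l → if k then 0 else l) (lookup∘update′ e₂≢e₁ α ε₁) (cong₂ _+_ (F₃-assign α ε₁ false) (F₃-assign α ε₁ true))
    pair-value : ∀ α ε₁ ε₂ → pair α ε₁ ε₂ ≡ (if Response.value (N (lookup α)) ε₁ ε₂ false then 0 else 1) + (if Response.value (N (lookup α)) ε₁ ε₂ true then 0 else 1)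
    pair-value α ε₁ ε₂ = cong₂ (λ p q → (if p then 0 else 1) + (if q then 0 else 1)) (Q-assign α ε₁ ε₂ false) (Q-assign α ε₁ ε₂ true)
    pointwise : ∀ α → overCoordinate e₁ F₂ α ≡ (if free α then zeroes (N (lookup α)) else 0)
    pointwise α = trans (cong (λ k → if lookup α e₁ then 0 else k) (cong₂ _+_ (F₂-assign α false) (F₂-assign α true)))
                        (cases (lookup α e₁) (lookup α e₂) (lookup α e₃))
      where
      cases : ∀ p q r →
        (if p then 0 else (if q then 0 else (if r then 0 else pair α false false) + (if r then 0 else pair α false true))
                        + (if q then 0 else (if r then 0 else pair α true false) + (if r then 0 else pair α true true)))
        ≡ (if (p ⊕ true) ∧ ((q ⊕ true) ∧ (r ⊕ true)) then zeroes (N (lookup α)) else 0)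
      cases true  q     r     = refl
      cases false true  r     = refl
      cases false false true  = refl
      cases false false false = cong₂ _+_ (cong₂ _+_ (pair-value α false false) (pair-value α false true))
                                          (cong₂ _+_ (pair-value α true false) (pair-value α true true))

  -- The conditions on y alone, to be taken out of the sum over x and α. The current through e₃
  -- vanishes too, by Kirchhoff's law at w.
  currents : Vec Bool m → Bool
  currents y = Π n (λ u → Σ m (λ e → inc e u ∧ lookup y e) ⊕ true) ∧ ((lookup y e₁ ⊕ true) ∧ (lookup y e₂ ⊕ true))

  -- Weight and current change roles in Ohm's law: `lookup y e` is now the coefficient and `Y e`
  -- reads the unknown weight. At e₁ and e₂, where `W` requires nothing, the equation says that the
  -- weight is zero, as `free` demands.
  edgeEquation : Vec Bool m → Fin m → Affine (n + m)
  edgeEquation y e = (if (e == e₁) ∨ (e == e₂) then Y e else δ e ⊞ lookup y e ⊡ Y e) , true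

  symmetryEquation : Fin m → Affine (n + m)
  symmetryEquation e = Y e ⊞ Y (ρᵉ e) , true

  otherEdges : List (Fin m)
  otherEdges = filter (λ e → ¬? (e ≟ᶠ e₃)) (allFin m)

  lowerEdges : List (Fin m)
  lowerEdges = filter (λ e → toℕ e <? toℕ (ρᵉ e)) (allFin m)

  -- Equations for x ++ α with y fixed, so that Y stands for the weights α.  That
  -- α vanishes at e₃ follows from the equation at e₂ by symmetry.
  potentialEquations weightEquations symmetryEquations equations : Vec Bool m → List (Affine (n + m))
  potentialEquations y = (X w , true) ∷ (X a , true) ∷ (X b , true) ∷ []
  weightEquations y = map (edgeEquation y) otherEdges
  symmetryEquations y = map symmetryEquation lowerEdges
  equations y = potentialEquations y ++ˡ (weightEquations y ++ˡ symmetryEquations y)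

  -- There are 3 equations for potentials, m - 1 for edges and one for each pair, together m +
  -- (pairs + 2). This is the origin of the bound `few-pairs`.
  few-equations : ∀ y → length (equations y) < n + m
  few-equations y = begin-strict
    3 + length (weightEquations y ++ˡ symmetryEquations y)
      ≡⟨ cong (3 +_) (trans (length-++ (weightEquations y)) (cong₂ _+_ (length-map (edgeEquation y) otherEdges) (length-map symmetryEquation lowerEdges))) ⟩
    3 + (length otherEdges + length lowerEdges) ≡⟨ solve 2 (λ p q → con 3 :+ (p :+ q) := (con 1 :+ p) :+ (q :+ con 2)) refl (length otherEdges) _ ⟩
    suc (length otherEdges) + (length lowerEdges + 2) ≤⟨ +-monoˡ-≤ _ fewer ⟩
    m + (length lowerEdges + 2) <⟨ +-monoʳ-< m few-pairs ⟩
    m + n ≡⟨ +-comm m n ⟩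
    n + m ∎
    where
    open ≤-Reasoning
    open +-*-Solver
    fewer : length otherEdges < m
    fewer = ≤-trans (filter-notAll (λ e → ¬? (e ≟ᶠ e₃)) (allFin m) (lose (∈-allFin e₃) (λ k → k refl))) (≤-reflexive (length-tabulate {n = m} (λ e → e)))

  fixedIndicator : Vec Bool m → Vec Bool n → Vec Bool m → Bool
  fixedIndicator α x y = ((reflectEdges α ==ᵛ α) ∧ free α) ∧
    (W (lookup α) (x ++ y) ∧ ((at (X a) (x ++ y) ⊕ true) ∧ ((at (X b) (x ++ y) ⊕ true) ∧ ((at (Y e₁) (x ++ y) ⊕ true) ∧ (at (Y e₂) (x ++ y) ⊕ true)))))

  fixedIndicator-linear : ∀ α x y → fixedIndicator α x y ≡ currents y ∧ prod (equations y) (x ++ α)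
  fixedIndicator-linear α x y = bool-ext forth back
    where
    X≡ : ∀ y u → at (X u) (x ++ y) ≡ lookup x u
    X≡ y u = lookup-++ˡ x y u
    Y≡ : ∀ y e → at (Y e) (x ++ y) ≡ lookup y e
    Y≡ y e = lookup-++ʳ x y e
    δ≡ : ∀ e → at (δ e) (x ++ α) ≡ at (δ e) (x ++ y)
    δ≡ e = cong₂ _⊕_ (trans (X≡ α (s e)) (sym (X≡ y (s e)))) (trans (X≡ α (t e)) (sym (X≡ y (t e))))
    ∂≡ : ∀ u → at (∂ u) (x ++ y) ≡ Σ m (λ e → inc e u ∧ lookup y e)
    ∂≡ u = Σ-cong m (λ e → cong (inc e u ∧_) (Y≡ y e))
    X-swap : ∀ u y z → at (X u) (x ++ y) ⊕ true ≡ true → at (X u) (x ++ z) ⊕ true ≡ true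
    X-swap u y z p = ⊕-true⁺ (trans (X≡ z u) (trans (sym (X≡ y u)) (⊕-true⁻ p)))

    forth : fixedIndicator α x y ≡ true → currents y ∧ prod (equations y) (x ++ α) ≡ true
    forth p = ∧-true⁺
      (∧-true⁺ (Π⁺ _ (λ u → ⊕-true⁺ (trans (sym (∂≡ u)) (V-∂ v u))))
               (∧-true⁺ (⊕-true⁺ (trans (sym (Y≡ y e₁)) (⊕-true⁻ y₁))) (⊕-true⁺ (trans (sym (Y≡ y e₂)) (⊕-true⁻ y₂)))))
      (trans (prod-++ (potentialEquations y) (weightEquations y ++ˡ symmetryEquations y) (x ++ α)) (∧-true⁺
        (∧-true⁺ (X-swap w y α (⊕-true⁺ (V-X v))) (∧-true⁺ (X-swap a y α a✓) (∧-true⁺ (X-swap b y α b✓) refl)))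
        (trans (prod-++ (weightEquations y) (symmetryEquations y) (x ++ α)) (∧-true⁺
          (prod-map⁺ (edgeEquation y) otherEdges {x ++ α} edge✓) (prod-map⁺ symmetryEquation lowerEdges {x ++ α} (λ {e} _ → symmetry✓ e))))))
      where
      p₁ = ∧-true⁻ {(reflectEdges α ==ᵛ α) ∧ free α} p
      q = ∧-true⁻ {reflectEdges α ==ᵛ α} (proj₁ p₁)
      q₁ = ∧-true⁻ {lookup α e₁ ⊕ true} (proj₂ q)
      q₂ = ∧-true⁻ {lookup α e₂ ⊕ true} (proj₂ q₁)
      r = ∧-true⁻ {W (lookup α) (x ++ y)} (proj₂ p₁)
      v : V (x ++ y) ≡ true
      v = proj₁ (∧-true⁻ (proj₁ r))
      r₁ = ∧-true⁻ {at (X a) (x ++ y) ⊕ true} (proj₂ r)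
      r₂ = ∧-true⁻ {at (X b) (x ++ y) ⊕ true} (proj₂ r₁)
      r₃ = ∧-true⁻ {at (Y e₁) (x ++ y) ⊕ true} (proj₂ r₂)
      a✓ = proj₁ r₁
      b✓ = proj₁ r₂
      y₁ = proj₁ r₃
      y₂ = proj₂ r₃
      invariant : ∀ e → lookup α (ρᵉ e) ≡ lookup α e
      invariant e = trans (sym (lookup∘tabulate _ e)) (cong (λ β → lookup β e) (==ᵛ-sound {x = reflectEdges α} (proj₁ q)))
      symmetry✓ : ∀ e → (at (Y e) (x ++ α) ⊕ at (Y (ρᵉ e)) (x ++ α)) ⊕ true ≡ true
      symmetry✓ e = ⊕-true⁺ (⊕-false⁺ (trans (Y≡ α e) (trans (sym (invariant e)) (sym (Y≡ α (ρᵉ e))))))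
      edge✓ : ∀ {e} → e ∈ otherEdges → at (proj₁ (edgeEquation y e)) (x ++ α) ⊕ true ≡ true
      edge✓ {e} e∈ with e == e₁ in k₁ | e == e₂ in k₂ | e == e₃ in k₃
      ... | true  | _     | _    = ⊕-true⁺ (trans (Y≡ α e) (trans (cong (lookup α) (==-sound k₁)) (⊕-true⁻ (proj₁ q₁))))
      ... | false | true  | _    = ⊕-true⁺ (trans (Y≡ α e) (trans (cong (lookup α) (==-sound k₂)) (⊕-true⁻ (proj₁ q₂))))
      ... | false | false | true = contradiction (==-sound k₃) (proj₂ (∈-filter⁻ (λ e → ¬? (e ≟ᶠ e₃)) {xs = allFin m} e∈))
      ... | false | false | false = ⊕-true⁺ (⊕-false⁺ (trans (δ≡ e) (trans (W-edge (proj₁ r) e (cong₂ _∨_ k₁ (cong₂ _∨_ k₂ k₃)))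
              (trans (cong (lookup α e ∧_) (Y≡ y e)) (trans (∧-comm (lookup α e) _) (cong (lookup y e ∧_) (sym (Y≡ α e))))))))

    back : currents y ∧ prod (equations y) (x ++ α) ≡ true → fixedIndicator α x y ≡ true
    back p = ∧-true⁺
      (∧-true⁺ (trans (cong (_==ᵛ α) (lookup-ext {x = reflectEdges α} {α} (λ e → trans (lookup∘tabulate _ e) (invariant e)))) (==ᵛ-refl α))
               (∧-true⁺ (⊕-true⁺ α₁) (∧-true⁺ (⊕-true⁺ α₂) (⊕-true⁺ (trans (cong (lookup α) (sym ρe₂)) (trans (invariant e₂) α₂))))))
      (∧-true⁺ (W⁺ {lookup α} {x ++ y} (V⁺ {x ++ y} (⊕-true⁻ (X-swap w α y (proj₁ potential))) (λ u → trans (∂≡ u) (⊕-true⁻ (Π⁻ _ (proj₁ c✓) u)))) edge)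
        (∧-true⁺ (X-swap a α y (proj₁ potential′)) (∧-true⁺ (X-swap b α y (proj₁ (∧-true⁻ {at (X b) (x ++ α) ⊕ true} (proj₂ potential′))))
          (∧-true⁺ (⊕-true⁺ (trans (Y≡ y e₁) (⊕-true⁻ (proj₁ (∧-true⁻ {lookup y e₁ ⊕ true} (proj₂ c✓)))))) (⊕-true⁺ (trans (Y≡ y e₂) (⊕-true⁻ (proj₂ (∧-true⁻ {lookup y e₁ ⊕ true} (proj₂ c✓))))))))))
      where
      p₁ = ∧-true⁻ {currents y} p
      c✓ = ∧-true⁻ {Π n (λ u → Σ m (λ e → inc e u ∧ lookup y e) ⊕ true)} (proj₁ p₁)
      p₂ = ∧-true⁻ {prod (potentialEquations y) (x ++ α)} (trans (sym (prod-++ (potentialEquations y) (weightEquations y ++ˡ symmetryEquations y) (x ++ α))) (proj₂ p₁))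
      p₃ = ∧-true⁻ {prod (weightEquations y) (x ++ α)} (trans (sym (prod-++ (weightEquations y) (symmetryEquations y) (x ++ α))) (proj₂ p₂))
      potential = ∧-true⁻ {at (X w) (x ++ α) ⊕ true} (proj₁ p₂)
      potential′ = ∧-true⁻ {at (X a) (x ++ α) ⊕ true} (proj₂ potential)
      equation : ∀ e → e ≢ e₃ → at (proj₁ (edgeEquation y e)) (x ++ α) ≡ false
      equation e e≢ = ⊕-true⁻ (prod-map⁻ (edgeEquation y) otherEdges {x ++ α} (proj₁ p₃) (∈-filter⁺ (λ e → ¬? (e ≟ᶠ e₃)) (∈-allFin e) e≢))
      below : ∀ e → toℕ e < toℕ (ρᵉ e) → lookup α e ≡ lookup α (ρᵉ e)
      below e e< = trans (sym (Y≡ α e)) (trans (⊕-false⁻ (⊕-true⁻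
        (prod-map⁻ symmetryEquation lowerEdges {x ++ α} (proj₂ p₃) (∈-filter⁺ (λ e → toℕ e <? toℕ (ρᵉ e)) (∈-allFin e) e<)))) (Y≡ α (ρᵉ e)))
      invariant : ∀ e → lookup α (ρᵉ e) ≡ lookup α e
      invariant e with <-cmp (toℕ e) (toℕ (ρᵉ e))
      ... | tri< e< _ _ = sym (below e e<)
      ... | tri≈ _ e≡ _ = cong (lookup α) (sym (toℕ-injective e≡))
      ... | tri> _ _ e> = trans (below (ρᵉ e) (subst (λ f → toℕ (ρᵉ e) < toℕ f) (sym (ρᵉ-involutive e)) e>)) (cong (lookup α) (ρᵉ-involutive e))
      at-first : ∀ b e → b ≡ true → at (if b then Y e else δ e ⊞ lookup y e ⊡ Y e) (x ++ α) ≡ lookup α e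
      at-first true e refl = Y≡ α e
      α₁ : lookup α e₁ ≡ false
      α₁ = trans (sym (at-first _ e₁ (cong (_∨ (e₁ == e₂)) (==-refl e₁)))) (equation e₁ (e₃≢e₁ ∘ sym))
      α₂ : lookup α e₂ ≡ false
      α₂ = trans (sym (at-first _ e₂ (trans (cong ((e₂ == e₁) ∨_) (==-refl e₂)) (∨-zeroʳ _)))) (equation e₂ (e₃≢e₂ ∘ sym))
      edge : ∀ e → star e ≡ false → at (δ e) (x ++ y) ≡ lookup α e ∧ at (Y e) (x ++ y)
      edge e e∉ with e == e₁ in k₁ | e == e₂ in k₂ | e == e₃ in k₃ | equation e
      ... | false | false | false | eq =
        trans (sym (δ≡ e)) (trans (⊕-false⁻ (eq (λ { refl → true≢false (trans (sym (==-refl e)) k₃) })))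
          (trans (cong (lookup y e ∧_) (Y≡ α e)) (trans (∧-comm (lookup y e) _) (cong (lookup α e ∧_) (sym (Y≡ y e))))))

  fixed-vanish : S m (λ α → (reflectEdges α ==ᵛ α) ∧ (free α ∧ fixedParity (N (lookup α)))) ≡ false
  fixed-vanish = begin
    S m (λ α → (reflectEdges α ==ᵛ α) ∧ (free α ∧ fixedParity (N (lookup α)))) ≡⟨ S-cong m expand ⟩
    S m (λ α → S n (λ x → S m (λ y → fixedIndicator α x y))) ≡⟨ S-cong m (λ α → S-swap n m _) ⟩
    S m (λ α → S m (λ y → S n (λ x → fixedIndicator α x y))) ≡⟨ S-swap m m _ ⟩
    S m (λ y → S m (λ α → S n (λ x → fixedIndicator α x y))) ≡⟨ S-cong m (λ y → S-swap m n _) ⟩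
    S m (λ y → S n (λ x → S m (λ α → fixedIndicator α x y))) ≡⟨ S-false m vanish ⟩
    false ∎
    where
    open ≡-Reasoning
    G : Vec Bool (n + m) → Bool
    G z = (at (X a) z ⊕ true) ∧ ((at (X b) z ⊕ true) ∧ ((at (Y e₁) z ⊕ true) ∧ (at (Y e₂) z ⊕ true)))
    parity : ∀ α → fixedParity (N α) ≡ S (n + m) (λ z → W α z ∧ G z)
    parity α = trans (cong (R α false false false false false ⊕_) (sym (R-normalise α false false true false false)))
      (trans (sym (S-⊕ (n + m) _ _)) (S-cong (n + m) (λ z → tautology 6
        (λ { (w ∷ a ∷ b ∷ c ∷ y ∷ y′ ∷ []) → w ∧ indicator false false false false false a b c y y′ ⊕ w ∧ indicator false false true false false a b c y y′ })
        (λ { (w ∷ a ∷ b ∷ c ∷ y ∷ y′ ∷ []) → w ∧ ((a ⊕ true) ∧ ((b ⊕ true) ∧ ((y ⊕ true) ∧ (y′ ⊕ true)))) })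
        refl (W α z ∷ at (X a) z ∷ at (X b) z ∷ at (X c) z ∷ at (Y e₁) z ∷ at (Y e₂) z ∷ []))))
    expand : ∀ α → (reflectEdges α ==ᵛ α) ∧ (free α ∧ fixedParity (N (lookup α))) ≡ S n (λ x → S m (λ y → fixedIndicator α x y))
    expand α = begin
      (reflectEdges α ==ᵛ α) ∧ (free α ∧ fixedParity (N (lookup α))) ≡⟨ sym (∧-assoc (reflectEdges α ==ᵛ α) _ _) ⟩
      A ∧ fixedParity (N (lookup α)) ≡⟨ cong (A ∧_) (parity (lookup α)) ⟩
      A ∧ S (n + m) (λ z → W (lookup α) z ∧ G z) ≡⟨ sym (S-∧ (n + m) A _) ⟩
      S (n + m) (λ z → A ∧ (W (lookup α) z ∧ G z)) ≡⟨ S-++ n m _ ⟩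
      S n (λ x → S m (λ y → fixedIndicator α x y)) ∎
      where
      A : Bool
      A = (reflectEdges α ==ᵛ α) ∧ free α
    vanish : ∀ y → S n (λ x → S m (λ α → fixedIndicator α x y)) ≡ false
    vanish y = begin
      S n (λ x → S m (λ α → fixedIndicator α x y)) ≡⟨ S-cong n (λ x → S-cong m (λ α → fixedIndicator-linear α x y)) ⟩
      S n (λ x → S m (λ α → currents y ∧ prod (equations y) (x ++ α))) ≡⟨ S-cong n (λ x → S-∧ m (currents y) _) ⟩
      S n (λ x → currents y ∧ S m (λ α → prod (equations y) (x ++ α))) ≡⟨ S-∧ n (currents y) _ ⟩
      currents y ∧ S n (λ x → S m (λ α → prod (equations y) (x ++ α)))
        ≡⟨ cong (currents y ∧_) (trans (sym (S-++ n m (prod (equations y)))) (few-factors (n + m) (equations y) (few-equations y))) ⟩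
      currents y ∧ false ≡⟨ ∧-zeroʳ (currents y) ⟩
      false ∎

  -- Reflecting α applies `swapped` to `N`, which preserves `balanced` for a Lagrangian plane. If α
  -- is fixed, then `N` is symmetric and `fixedParity` may take the place of `balanced`.
  balanced-vanish : S m (λ α → free α ∧ balanced (N (lookup α))) ≡ false
  balanced-vanish = begin
    S m B ≡⟨ S-fixed reflectEdges reflectEdges-involutive B invariant ⟩
    S m (λ α → (reflectEdges α ==ᵛ α) ∧ B α) ≡⟨ S-cong m on-fixed ⟩
    S m (λ α → (reflectEdges α ==ᵛ α) ∧ (free α ∧ fixedParity (N (lookup α)))) ≡⟨ fixed-vanish ⟩
    false ∎
    where
    open ≡-Reasoning
    B : Vec Bool m → Bool
    B α = free α ∧ balanced (N (lookup α))
    lookup-reflect : ∀ α e → lookup (reflectEdges α) e ≡ lookup α (ρᵉ e)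
    lookup-reflect α e = lookup∘tabulate _ e
    N-reflectEdges : ∀ α x → N (lookup (reflectEdges α)) x ≡ swapped (N (lookup α)) x
    N-reflectEdges α x = trans (N-cong (lookup-reflect α) x) (N-reflect (lookup α) x)
    invariant : ∀ α → B (reflectEdges α) ≡ B α
    invariant α = cong₂ _∧_
      (trans (cong₂ (λ p q → (p ⊕ true) ∧ q) (moved ρe₁) (cong₂ (λ p q → (p ⊕ true) ∧ (q ⊕ true)) (moved ρe₂) (moved ρe₃)))
             (cong ((lookup α e₁ ⊕ true) ∧_) (∧-comm (lookup α e₃ ⊕ true) _)))
      (trans (cong (_≡ᵇ 4) (zeroes-cong (N-reflectEdges α))) (proj₁ (proj₂ (N-lagrangian (lookup α)))))
      where
      moved : ∀ {e f} → ρᵉ e ≡ f → lookup (reflectEdges α) e ≡ lookup α f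
      moved {e} refl = lookup-reflect α e
    on-fixed : ∀ α → (reflectEdges α ==ᵛ α) ∧ B α ≡ (reflectEdges α ==ᵛ α) ∧ (free α ∧ fixedParity (N (lookup α)))
    on-fixed α with reflectEdges α ==ᵛ α in eq
    ... | false = refl
    ... | true  = cong (free α ∧_) (proj₂ (proj₂ (N-lagrangian (lookup α)))
      (all-vectors-complete {4} (λ x → not-true⁺ (⊕-false⁺ (trans (sym (N-reflectEdges α x)) (cong (λ β → N (lookup β) x) (==ᵛ-sound {x = reflectEdges α} eq)))))))

  eight-divides : ∃ λ q → Sℕ m isZero ≡ 8 * q
  eight-divides = let q , H≡ = even⇒half (Sℕ m H) even in q , (begin
    Sℕ m isZero ≡⟨ sum-over-star ⟩
    Sℕ m (λ α → if free α then zeroes (N (lookup α)) else 0) ≡⟨ Sℕ-cong m pointwise ⟩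
    Sℕ m (λ α → 4 * H α) ≡⟨ Sℕ-* m 4 H ⟩
    4 * Sℕ m H ≡⟨ cong (4 *_) H≡ ⟩
    4 * (q + q) ≡⟨ solve 1 (λ q → con 4 :* (q :+ q) := con 8 :* q) refl q ⟩
    8 * q ∎)
    where
    open ≡-Reasoning
    open +-*-Solver
    H : Vec Bool m → ℕ
    H α = if free α then quarter (zeroes (N (lookup α))) else 0
    pointwise : ∀ α → (if free α then zeroes (N (lookup α)) else 0) ≡ 4 * H α
    pointwise α with free α
    ... | false = refl
    ... | true  = quarter-correct _ (proj₁ (N-lagrangian (lookup α)))
    even : odd (Sℕ m H) ≡ false
    even = trans (odd-Sℕ m H) (trans (S-cong m odd-H) balanced-vanish)
      where
      odd-H : ∀ α → odd (H α) ≡ free α ∧ balanced (N (lookup α))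
      odd-H α with free α
      ... | false = refl
      ... | true  = odd-quarter (zeroes (N (lookup α)))

-- Spanning trees

does-true⁻ : ∀ {A : Set} (A? : Dec A) → does A? ≡ true → A
does-true⁻ (yes a) _ = a

lookup-injective : ∀ {A : Set} {xs : List A} → Unique xs → ∀ {i j} → lookupˡ xs i ≡ lookupˡ xs j → i ≡ j
lookup-injective {xs = _ ∷ _} _          {zero}  {zero}  _  = refl
lookup-injective {xs = _ ∷ _} (x∉ ∷ _)   {zero}  {suc j} eq = contradiction eq (lookupAll x∉ (∈-lookup j))
lookup-injective {xs = _ ∷ _} (x∉ ∷ _)   {suc i} {zero}  eq = contradiction (sym eq) (lookupAll x∉ (∈-lookup i))
lookup-injective {xs = _ ∷ _} (_ ∷ xs!)  {suc i} {suc j} eq = cong suc (lookup-injective xs! eq)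

module _ {G : Graph} where
  open Graph G
  open DecMembership _≟_ using () renaming (_∈?_ to _∈ⱽ?_)

  walk-map : ∀ {P Q : Edge → Set} → (∀ {e} → P e → Q e) → ∀ {u v} → Walk G P u v → Walk G Q u v
  walk-map f stop           = stop
  walk-map f (step e p j w) = step e (f p) j (walk-map f w)

  walkEdges-map : ∀ {P Q : Edge → Set} (f : ∀ {e} → P e → Q e) {u v} (w : Walk G P u v) → walkEdges (walk-map f w) ≡ walkEdges w
  walkEdges-map f stop           = refl
  walkEdges-map f (step e p j w) = cong (e ∷_) (walkEdges-map f w)

  walkSources-map : ∀ {P Q : Edge → Set} (f : ∀ {e} → P e → Q e) {u v} (w : Walk G P u v) → walkSources (walk-map f w) ≡ walkSources w
  walkSources-map f stop               = refl
  walkSources-map f (step {u} e p j w) = cong (u ∷_) (walkSources-map f w)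

  module _ {P : Edge → Set} where

    _∷ʳ_ : ∀ {u v x e} → Walk G P u v → P e × Joins G e v x → Walk G P u x
    stop         ∷ʳ (p , j) = step _ p j stop
    step e q i w ∷ʳ pj      = step e q i (w ∷ʳ pj)

    walkEdges-P : ∀ {u v} (w : Walk G P u v) {e} → e ∈ walkEdges w → P e
    walkEdges-P (step e p j w) (here refl) = p
    walkEdges-P (step e p j w) (there e∈)  = walkEdges-P w e∈

    Joins-swap : ∀ {e u v} → Joins G e u v → Joins G e v u
    Joins-swap (inj₁ p) = inj₂ p
    Joins-swap (inj₂ p) = inj₁ p

    walk-trans : ∀ {u v x} → Walk G P u v → Walk G P v x → Walk G P u x
    walk-trans stop           w′ = w′
    walk-trans (step e p j w) w′ = step e p j (walk-trans w w′)

    walk-sym : ∀ {u v} → Walk G P u v → Walk G P v u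
    walk-sym stop           = stop
    walk-sym (step e p j w) = walk-sym w ∷ʳ (p , Joins-swap j)

    -- `walkSources` omits the last vertex, so v is added: this is a path, without any repeated
    -- vertex.
    Simple : ∀ {u v} → Walk G P u v → Set
    Simple {v = v} w = Unique (v ∷ walkSources w)

    from-source : ∀ {u v x} (w : Walk G P u v) → Simple w → x ∈ walkSources w → ∃ λ (w′ : Walk G P x v) → Simple w′
    from-source w@(step _ _ _ _) simple (here refl) = w , simple
    from-source (step e p j w) ((_ ∷ v∉) ∷ (_ ∷ w!)) (there x∈) = from-source w (v∉ ∷ w!) x∈

    -- Loop erasure from the end: if u already lies on the simplified remainder, the path starts
    -- from that occurrence.
    simplify : ∀ {u v} → Walk G P u v → ∃ λ (w : Walk G P u v) → Simple w
    simplify stop = stop , ([] ∷ [])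
    simplify {u} {v} (step e p j w) with u ≟ v
    ... | yes refl = stop , ([] ∷ [])
    ... | no u≢v with simplify w
    ...   | w′ , v∉ ∷ w′! with u ∈ⱽ? walkSources w′
    ...     | yes u∈ = from-source w′ (v∉ ∷ w′!) u∈
    ...     | no u∉  = step e p j w′ , (((u≢v ∘ sym) ∷ v∉) ∷ (tabulateAll (λ x∈ → λ { refl → u∉ x∈ }) ∷ w′!))

    edge-visits : ∀ {u v} (w : Walk G P u v) {e x y} → e ∈ walkEdges w → Joins G e x y → x ∈ v ∷ walkSources w
    edge-visits w@(step e p j w₀) (here refl) i = one-of j i
      where
      target∈ : ∀ {u v} (w : Walk G P u v) → u ∈ v ∷ walkSources w
      target∈ stop           = here refl
      target∈ (step _ _ _ _) = there (here refl)
      keep : ∀ {x v u} {us : List Vertex} → x ∈ v ∷ us → x ∈ v ∷ u ∷ us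
      keep (here p)  = here p
      keep (there p) = there (there p)
      one-of : ∀ {x y} → Joins G e _ _ → Joins G e x y → x ∈ _ ∷ _
      one-of (inj₁ a) (inj₁ b) with refl ← trans (sym a) b = there (here refl)
      one-of (inj₁ a) (inj₂ b) with refl ← trans (sym a) b = keep (target∈ w₀)
      one-of (inj₂ a) (inj₁ b) with refl ← trans (sym a) b = keep (target∈ w₀)
      one-of (inj₂ a) (inj₂ b) with refl ← trans (sym a) b = there (here refl)
    edge-visits (step e p j w) (there e∈) i with edge-visits w e∈ i
    ... | here q   = here q
    ... | there x∈ = there (there x∈)

    -- A second use of the first edge would visit u again.
    simple-edges : ∀ {u v} (w : Walk G P u v) → Simple w → Unique (walkEdges w)
    simple-edges stop _ = []
    simple-edges (step e p j w) ((v≢u ∷ v∉) ∷ (u∉ ∷ w!)) =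
      tabulateAll (λ { f∈ refl → u-fresh (edge-visits w f∈ j) }) ∷ simple-edges w (v∉ ∷ w!)
      where
      u-fresh : ¬ (_ ∈ _ ∷ walkSources w)
      u-fresh (here q)   = v≢u (sym q)
      u-fresh (there u∈) = lookupAll u∉ u∈ refl

module TreeParity (G : Graph) (w : Fin (length (Graph.vertices G))) where
  open Graph G

  n m : ℕ
  n = ∣V∣
  m = ∣E∣

  vertexAt : Fin n → Vertex
  vertexAt = lookupˡ vertices

  source target : Edge → Fin n
  source e = index (proj₁ (incident (∈-lookup {xs = edges} e)))
  target e = index (proj₂ (incident (∈-lookup {xs = edges} e)))

  vertexAt-source : ∀ e → proj₁ (ends e) ≡ vertexAt (source e)
  vertexAt-source e = lookup-index (proj₁ (incident (∈-lookup {xs = edges} e)))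

  vertexAt-target : ∀ e → proj₂ (ends e) ≡ vertexAt (target e)
  vertexAt-target e = lookup-index (proj₂ (incident (∈-lookup {xs = edges} e)))

  open Network source target w

  Joins-positions : ∀ {e u v} i → vertexAt i ≡ u → Joins G e u v →
    ∃ λ j → vertexAt j ≡ v × ((source e ≡ i × target e ≡ j) ⊎ (source e ≡ j × target e ≡ i))
  Joins-positions {e} i i≡ (inj₁ p) = target e , trans (sym (vertexAt-target e)) (cong proj₂ p) ,
    inj₁ (lookup-injective unique (trans (sym (vertexAt-source e)) (trans (cong proj₁ p) (sym i≡))) , refl)
  Joins-positions {e} i i≡ (inj₂ p) = source e , trans (sym (vertexAt-source e)) (cong proj₁ p) ,
    inj₂ (refl , lookup-injective unique (trans (sym (vertexAt-target e)) (trans (cong proj₂ p) (sym i≡))))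

  Joins-vertex : ∀ {e u v} → Joins G e u v → u ∈ vertices
  Joins-vertex {e} (inj₁ p) = subst (_∈ vertices) (cong proj₁ p) (proj₁ (incident (∈-lookup {xs = edges} e)))
  Joins-vertex {e} (inj₂ p) = subst (_∈ vertices) (cong proj₂ p) (proj₂ (incident (∈-lookup {xs = edges} e)))

  position : ∀ {u} → u ∈ vertices → ∃ λ i → vertexAt i ≡ u
  position u∈ = index u∈ , sym (lookup-index u∈)

  constant-along : ∀ {P : Edge → Set} (ξ : Fin n → Bool) → (∀ e → P e → ξ (source e) ≡ ξ (target e)) →
    ∀ {u v} → Walk G P u v → ∀ i j → vertexAt i ≡ u → vertexAt j ≡ v → ξ i ≡ ξ j
  constant-along ξ flat stop i j i≡ j≡ = cong ξ (lookup-injective unique (trans i≡ (sym j≡)))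
  constant-along ξ flat (step e p ends w) i j i≡ j≡ with Joins-positions i i≡ ends
  ... | k , k≡ , inj₁ (refl , refl) = trans (flat e p) (constant-along ξ flat w k j k≡ j≡)
  ... | k , k≡ , inj₂ (refl , refl) = trans (sym (flat e p)) (constant-along ξ flat w k j k≡ j≡)

  module _ {P : Edge → Set} (P? : ∀ e → Dec (P e)) (i : Fin n) where

    reachable : Fin n → Bool
    reachable j = does (walk? {G} P? (vertexAt i) (vertexAt j))

    reachable-refl : reachable i ≡ true
    reachable-refl = dec-true (walk? {G} P? (vertexAt i) (vertexAt i)) stop

    reachable-flat : ∀ e → P e → reachable (source e) ≡ reachable (target e)
    reachable-flat e p = bool-ext
      (λ r → dec-true (walk? {G} P? _ _) (does-true⁻ (walk? {G} P? _ _) r ∷ʳ (p , inj₁ ends≡)))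
      (λ r → dec-true (walk? {G} P? _ _) (does-true⁻ (walk? {G} P? _ _) r ∷ʳ (p , inj₂ ends≡)))
      where
      ends≡ : ends e ≡ (vertexAt (source e) , vertexAt (target e))
      ends≡ = cong₂ _,_ (vertexAt-source e) (vertexAt-target e)

  -- The multiplicity modulo 2, which makes the edges of any walk a chain, repetitions included.
  occurs : Edge → List Edge → Bool
  occurs e []       = false
  occurs e (f ∷ es) = (e == f) ⊕ occurs e es

  occurs-none : ∀ e es → (∀ {f} → f ∈ es → e ≢ f) → occurs e es ≡ false
  occurs-none e []       _  = refl
  occurs-none e (f ∷ es) e≢ = cong₂ _⊕_ (==-false (e≢ (here refl))) (occurs-none e es (e≢ ∘ there))

  occurs-P : ∀ {P : Edge → Set} e es → (∀ {f} → f ∈ es → P f) → occurs e es ≡ true → P e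
  occurs-P {P} e (f ∷ es) p q with e == f in eq
  ... | true  = subst P (sym (==-sound {i = e} eq)) (p (here refl))
  ... | false = occurs-P {P} e es (p ∘ there) q

  boundary : ∀ {P : Edge → Set} {u v} (wk : Walk G P u v) i j → vertexAt i ≡ u → vertexAt j ≡ v → ∀ k →
    Σ m (λ e → inc e k ∧ occurs e (walkEdges wk)) ≡ (k == i) ⊕ (k == j)
  boundary stop i j i≡ j≡ k with refl ← lookup-injective unique (trans i≡ (sym j≡)) =
    trans (Σ-false m (λ e → ∧-zeroʳ (inc e k))) (sym (xor-same (k == i)))
  boundary (step e p ends wk) i j i≡ j≡ k with Joins-positions i i≡ ends
  ... | l , l≡ , at-ends = begin
    Σ m (λ f → inc f k ∧ ((f == e) ⊕ occurs f (walkEdges wk)))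
      ≡⟨ Σ-cong m (λ f → trans (∧-distribˡ-xor (inc f k) (f == e) _) (cong (_⊕ inc f k ∧ occurs f (walkEdges wk)) (∧-comm (inc f k) (f == e)))) ⟩
    Σ m (λ f → (f == e) ∧ inc f k ⊕ inc f k ∧ occurs f (walkEdges wk))
      ≡⟨ Σ-⊕ m _ _ ⟩
    Σ m (λ f → (f == e) ∧ inc f k) ⊕ Σ m (λ f → inc f k ∧ occurs f (walkEdges wk))
      ≡⟨ cong₂ _⊕_ (trans (Σ-δ e (λ f → inc f k)) (split at-ends)) (boundary wk l j l≡ j≡ k) ⟩
    ((k == i) ⊕ (k == l)) ⊕ ((k == l) ⊕ (k == j))
      ≡⟨ trans (xor-assoc (k == i) (k == l) _) (cong ((k == i) ⊕_) (⊕-cancel (k == l) (k == j))) ⟩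
    (k == i) ⊕ (k == j) ∎
    where
    open ≡-Reasoning
    split : (source e ≡ i × target e ≡ l) ⊎ (source e ≡ l × target e ≡ i) → inc e k ≡ (k == i) ⊕ (k == l)
    split (inj₁ (refl , refl)) = refl
    split (inj₂ (refl , refl)) = xor-comm (k == source e) _

  module _ (T : Subset m) where

    ∈ˢ⇒lookup : ∀ {e} → e ∈ˢ T → lookup T e ≡ true
    ∈ˢ⇒lookup = []=⇒lookup

    lookup⇒∈ˢ : ∀ {e} → lookup T e ≡ true → e ∈ˢ T
    lookup⇒∈ˢ {e} = lookup⇒[]= e T

    solves : Vec Bool (n + m) → Bool
    solves z = V z ∧ Π m (λ e → at (treeForm (lookup T) e) z ⊕ true)

    solves⁺ : ∀ {z} → V z ≡ true → (∀ e → e ∈ˢ T → at (δ e) z ≡ false) → (∀ e → lookup T e ≡ false → at (Y e) z ≡ false) → solves z ≡ true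
    solves⁺ {z} v d y = ∧-true⁺ v (Π⁺ _ edge)
      where
      edge : ∀ e → at (treeForm (lookup T) e) z ⊕ true ≡ true
      edge e with lookup T e in eq
      ... | true  = ⊕-true⁺ (d e (lookup⇒∈ˢ eq))
      ... | false = ⊕-true⁺ (y e eq)

    solves-form : ∀ {z} → solves z ≡ true → ∀ e b → lookup T e ≡ b → at (if b then δ e else Y e) z ≡ false
    solves-form {z} s e _ refl = ⊕-true⁻ (Π⁻ _ (proj₂ (∧-true⁻ {V z} s)) e)

    spanning⇒trivial : IsSpanningTree G T → ∀ {z} → solves z ≡ true → z ≡ 0ᵛ
    spanning⇒trivial (connected , acyclic) {z} s = lookup-ext-++ n z 0ᵛ
        (λ u → trans (x≡0 u) (sym (lookup-replicate (u ↑ˡ m) false))) (λ e → trans (y≡0 e) (sym (lookup-replicate (n ↑ʳ e) false)))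
      where
      v : V z ≡ true
      v = proj₁ (∧-true⁻ s)
      x≡0 : ∀ u → at (X u) z ≡ false
      x≡0 u = trans (constant-along (λ i → at (X i) z) (λ e e∈ → ⊕-false⁻ (solves-form s e true (∈ˢ⇒lookup e∈)))
                      (connected (∈-lookup {xs = vertices} u) (∈-lookup w)) u w refl refl) (V-X v)
      -- Otherwise the rest of T does not connect the ends of e, and the boundary
      -- of y vanishes on the side of one end, although e alone crosses the cut.
      y≡0 : ∀ e → at (Y e) z ≡ false
      y≡0 e with lookup T e in T≡ | at (Y e) z in Y≡
      ... | _     | false = refl
      ... | false | true  = trans (sym Y≡) (solves-form s e false T≡)
      ... | true  | true  = contradiction cut (λ q → true≢false (trans (sym q) no-cut))
        where
        Other : Edge → Set
        Other f = f ∈ˢ T × f ≢ e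
        Other? : ∀ f → Dec (Other f)
        Other? f = (f ∈ˢ? T) ×-dec ¬? (f ≟ᶠ e)
        ξ : Fin n → Bool
        ξ = reachable Other? (source e)
        ends≡ : ends e ≡ (vertexAt (source e) , vertexAt (target e))
        ends≡ = cong₂ _,_ (vertexAt-source e) (vertexAt-target e)
        separated : ξ (target e) ≡ false
        separated = dec-false (walk? {G} Other? _ _) closes
          where
          closes : ¬ Walk G Other (vertexAt (source e)) (vertexAt (target e))
          closes wk with simplify wk
          -- A path from the source to the target of e that avoids e is closed to a cycle by
          -- crossing e backwards first.
          ... | path , simple = acyclic (step e (lookup⇒∈ˢ T≡) (inj₂ ends≡) (walk-map proj₁ path))
            ( s≤s z≤n
            , subst (λ es → Unique (e ∷ es)) (sym (walkEdges-map proj₁ path))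
                (tabulateAll (λ f∈ → λ { refl → proj₂ (walkEdges-P path f∈) refl }) ∷ simple-edges path simple)
            , subst (λ us → Unique (vertexAt (target e) ∷ us)) (sym (walkSources-map proj₁ path)) simple)
        cut : Σ m (λ f → at (Y f) z ∧ (ξ (source f) ⊕ ξ (target f))) ≡ true
        cut = trans (Σ-extract e _) (trans (cong₂ _⊕_ (cong₂ _∧_ Y≡ (cong₂ _⊕_ (reachable-refl Other? (source e)) separated)) (Σ-false m rest)) refl)
          where
          rest : ∀ f → not (f == e) ∧ (at (Y f) z ∧ (ξ (source f) ⊕ ξ (target f))) ≡ false
          rest f with f ≟ᶠ e
          ... | yes _  = refl
          ... | no f≢e with at (Y f) z in Yf≡ | lookup T f in Tf≡
          ...   | false | _     = refl
          ...   | true  | true  = ⊕-false⁺ (reachable-flat Other? (source e) f (lookup⇒∈ˢ Tf≡ , f≢e))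
          ...   | true  | false = contradiction (trans (sym Yf≡) (solves-form s f false Tf≡)) true≢false
        no-cut : Σ m (λ f → at (Y f) z ∧ (ξ (source f) ⊕ ξ (target f))) ≡ false
        no-cut = trans (sym (pairing ξ z)) (Σ-false n (λ u → trans (cong (ξ u ∧_) (V-∂ v u)) (∧-zeroʳ (ξ u))))

    -- The potential that is 1 off the component of w in T, without currents, is a solution. Being
    -- zero, it shows that every vertex is reachable from w.
    trivial⇒connected : (∀ {z} → solves z ≡ true → z ≡ 0ᵛ) → Connected G (_∈ˢ T)
    trivial⇒connected trivial {u} {v} u∈ v∈ = walk-trans (walk-sym (from-base u∈)) (from-base v∈)
      where
      reach : Fin n → Bool
      reach = reachable (_∈ˢ? T) w
      z : Vec Bool (n + m)
      z = tabulate (λ i → not (reach i)) ++ 0ᵛ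
      X≡ : ∀ i → at (X i) z ≡ not (reach i)
      X≡ i = trans (lookup-++ˡ (tabulate _) 0ᵛ i) (lookup∘tabulate _ i)
      Y≡ : ∀ e → at (Y e) z ≡ false
      Y≡ e = trans (lookup-++ʳ (tabulate {n = n} _) 0ᵛ e) (lookup-replicate e false)
      solution : solves z ≡ true
      solution = solves⁺
        (V⁺ (trans (X≡ w) (cong not (reachable-refl (_∈ˢ? T) w))) (λ u → Σ-false m (λ e → trans (cong (inc e u ∧_) (Y≡ e)) (∧-zeroʳ (inc e u)))))
        (λ e e∈ → ⊕-false⁺ (trans (X≡ (source e)) (trans (cong not (reachable-flat (_∈ˢ? T) w e e∈)) (sym (X≡ (target e))))))
        (λ e _ → Y≡ e)
      from-base : ∀ {u} → u ∈ vertices → Walk G (_∈ˢ T) (vertexAt w) u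
      from-base u∈ with position u∈
      ... | i , refl = does-true⁻ (walk? {G} (_∈ˢ? T) _ _) (not-false (trans (sym (X≡ i)) (trans (cong (at (X i)) (trivial solution)) (lookup-replicate (i ↑ˡ m) false))))
        where
        not-false : ∀ {b} → not b ≡ false → b ≡ true
        not-false {true} _ = refl

    -- The chain of a cycle in T has no boundary, so together with the zero potential it is a
    -- solution. It is nonzero, as the first edge of the cycle is not repeated.
    trivial⇒acyclic : (∀ {z} → solves z ≡ true → z ≡ 0ᵛ) → Acyclic G (_∈ˢ T)
    trivial⇒acyclic trivial stop (() , _)
    trivial⇒acyclic trivial {u} wk@(step e p j wk′) (_ , (e∉ ∷ _) , _) =
      true≢false (trans (sym on-e) (trans (sym (Y≡ e)) (trans (cong (at (Y e)) (trivial solution)) (lookup-replicate (n ↑ʳ e) false))))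
      where
      es : List Edge
      es = walkEdges wk
      z : Vec Bool (n + m)
      z = 0ᵛ {n} ++ tabulate (λ f → occurs f es)
      X≡ : ∀ i → at (X i) z ≡ false
      X≡ i = trans (lookup-++ˡ 0ᵛ (tabulate (λ f → occurs f es)) i) (lookup-replicate i false)
      Y≡ : ∀ f → at (Y f) z ≡ occurs f es
      Y≡ f = trans (lookup-++ʳ (0ᵛ {n}) (tabulate (λ f → occurs f es)) f) (lookup∘tabulate _ f)
      closed : ∀ k → at (∂ k) z ≡ false
      closed k with position (Joins-vertex j)
      ... | i , i≡ = trans (Σ-cong m (λ f → cong (inc f k ∧_) (Y≡ f))) (trans (boundary wk i i i≡ i≡ k) (xor-same (k == i)))
      off-T : ∀ f → lookup T f ≡ false → occurs f es ≡ false
      off-T f f∉ with occurs f es in eq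
      ... | false = refl
      ... | true  = contradiction (trans (sym (∈ˢ⇒lookup (occurs-P f es (walkEdges-P wk) eq))) f∉) true≢false
      solution : solves z ≡ true
      solution = solves⁺ (V⁺ (X≡ w) closed) (λ f _ → cong₂ _⊕_ (X≡ (source f)) (X≡ (target f))) (λ f f∉ → trans (Y≡ f) (off-T f f∉))
      on-e : occurs e es ≡ true
      on-e = cong₂ _⊕_ (==-refl e) (occurs-none e (walkEdges wk′) (λ f∈ → lookupAll e∉ f∈))

    solves-0 : solves 0ᵛ ≡ true
    solves-0 = ∧-true⁺ (Π⁺ _ (λ u → ⊕-true⁺ (at-0 (vertexForm u)))) (Π⁺ _ (λ e → ⊕-true⁺ (at-0 (treeForm (lookup T) e))))

    solves-translate : ∀ {t} → solves t ≡ true → ∀ z → solves (t ⊕ᵛ z) ≡ solves z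
    solves-translate {t} p z = cong₂ _∧_ (V-translate (proj₁ (∧-true⁻ p)) z) (Π-cong m (λ e → cong (λ k → k ⊕ true)
      (trans (additive (treeForm (lookup T) e) t z) (cong (λ k → k ⊕ at (treeForm (lookup T) e) z) (solves-form p e (lookup T e) refl)))))

    -- By `S-homogeneous` an odd number of solutions means that only zero is one; conversely a
    -- unique solution is an odd number.
    treeParity-spanning : treeParity (lookup T) ≡ does (isSpanningTree? G T)
    treeParity-spanning = bool-ext
      (λ p → let trivial = λ {z} → S-homogeneous solves solves-0 solves-translate p {z} in
             dec-true (isSpanningTree? G T) (trivial⇒connected trivial , trivial⇒acyclic trivial))
      (λ p → unique-solution (spanning⇒trivial (does-true⁻ (isSpanningTree? G T) p)))
      where
      unique-solution : (∀ {z} → solves z ≡ true → z ≡ 0ᵛ) → S (n + m) solves ≡ true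
      unique-solution trivial = trans (S-cong (n + m) (λ z → bool-ext (to z) (from z))) (S-δ (n + m) 0ᵛ (λ _ → true))
        where
        to : ∀ z → solves z ≡ true → (z ==ᵛ 0ᵛ) ∧ true ≡ true
        to z s with refl ← trivial {z} s = ∧-true⁺ (==ᵛ-refl z) refl
        from : ∀ z → (z ==ᵛ 0ᵛ) ∧ true ≡ true → solves z ≡ true
        from z s = subst (λ z → solves z ≡ true) (sym (==ᵛ-sound (proj₁ (∧-true⁻ s)))) solves-0

-- Parity of the Kirchhoff polynomial and the number of its zeros

odd-* : ∀ m n → odd (m * n) ≡ odd m ∧ odd n
odd-* zero    n = refl
odd-* (suc m) n = trans (odd-+ n (m * n)) (trans (cong (odd n ⊕_) (odd-* m n)) (distribute (odd m) (odd n)))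
  where
  distribute : ∀ a b → b ⊕ a ∧ b ≡ not a ∧ b
  distribute false b = xor-identityʳ b
  distribute true  b = xor-same b

2∣⇒even : ∀ {k} → 2 ∣ k → odd k ≡ false
2∣⇒even (divides q refl) = trans (odd-* q 2) (∧-zeroʳ (odd q))

even⇒2∣ : ∀ {k} → odd k ≡ false → 2 ∣ k
even⇒2∣ {k} p with even⇒half k p
... | q , refl = divides q (trans (cong (q +_) (sym (+-identityʳ q))) (*-comm 2 q))

odd-∣? : ∀ k → does (2 ∣? k) ≡ not (odd k)
odd-∣? k with odd k in eq
... | true  = dec-false (2 ∣? k) (λ d → true≢false (trans (sym eq) (2∣⇒even d)))
... | false = dec-true (2 ∣? k) (even⇒2∣ eq)

xorOver : ∀ {A : Set} → (A → Bool) → List A → Bool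
xorOver h []       = false
xorOver h (x ∷ xs) = h x ⊕ xorOver h xs

xorOver-++ : ∀ {A : Set} (h : A → Bool) xs ys → xorOver h (xs ++ˡ ys) ≡ xorOver h xs ⊕ xorOver h ys
xorOver-++ h []       ys = refl
xorOver-++ h (x ∷ xs) ys = trans (cong (h x ⊕_) (xorOver-++ h xs ys)) (sym (xor-assoc (h x) _ _))

xorOver-map : ∀ {A B : Set} (h : B → Bool) (f : A → B) xs → xorOver h (map f xs) ≡ xorOver (h ∘ f) xs
xorOver-map h f []       = refl
xorOver-map h f (x ∷ xs) = cong (h (f x) ⊕_) (xorOver-map h f xs)

xorOver-allVecs : ∀ n h → xorOver h (allVecs (outside ∷ inside ∷ []) n) ≡ S n h
xorOver-allVecs zero    h = xor-identityʳ (h [])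
xorOver-allVecs (suc n) h = trans (xorOver-++ h (map (false ∷_) vs) _) (cong₂ _⊕_ (trans (xorOver-map h _ vs) (xorOver-allVecs n _))
  (trans (xorOver-++ h (map (true ∷_) vs) []) (trans (xor-identityʳ _) (trans (xorOver-map h _ vs) (xorOver-allVecs n _)))))
  where
  vs : List (Vec Bool n)
  vs = allVecs (outside ∷ inside ∷ []) n

odd-sum-filter : ∀ {A : Set} {P : A → Set} (P? : ∀ x → Dec (P x)) (f : A → ℕ) xs →
                 odd (sum (map f (filter P? xs))) ≡ xorOver (λ x → does (P? x) ∧ odd (f x)) xs
odd-sum-filter P? f []       = refl
odd-sum-filter P? f (x ∷ xs) with does (P? x)
... | true  = trans (odd-+ (f x) _) (cong (odd (f x) ⊕_) (odd-sum-filter P? f xs))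
... | false = odd-sum-filter P? f xs

-- Stated for a tabulated list because the tail of `allFin` is again tabulated, but not of the form
-- `allFin`.
odd-product-filter : ∀ {A : Set} {P : A → Set} (P? : ∀ x → Dec (P x)) (f : A → ℕ) k (g : Fin k → A) →
                     odd (product (map f (filter P? (tabulateˡ g)))) ≡ Π k (λ i → not (does (P? (g i))) ∨ odd (f (g i)))
odd-product-filter P? f zero    g = refl
odd-product-filter P? f (suc k) g with does (P? (g zero))
... | true  = trans (odd-* (f (g zero)) _) (cong (odd (f (g zero)) ∧_) (odd-product-filter P? f k (g ∘ suc)))
... | false = odd-product-filter P? f k (g ∘ suc)

Σℕ : ∀ {A : Set} → (A → ℕ) → List A → ℕ
Σℕ h xs = sum (map h xs)

Σℕ-++ : ∀ {A : Set} (h : A → ℕ) xs ys → Σℕ h (xs ++ˡ ys) ≡ Σℕ h xs + Σℕ h ys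
Σℕ-++ h []       ys = refl
Σℕ-++ h (x ∷ xs) ys = trans (cong (h x +_) (Σℕ-++ h xs ys)) (sym (+-assoc (h x) _ _))

Σℕ-map : ∀ {A B : Set} (h : B → ℕ) (f : A → B) xs → Σℕ h (map f xs) ≡ Σℕ (h ∘ f) xs
Σℕ-map h f []       = refl
Σℕ-map h f (x ∷ xs) = cong (h (f x) +_) (Σℕ-map h f xs)

bit : Bool → Fin 2
bit false = zero
bit true  = suc zero

Σℕ-allVecs : ∀ n h → Σℕ h (allVecs (allFin 2) n) ≡ Sℕ n (h ∘ Vec.map bit)
Σℕ-allVecs zero    h = +-identityʳ (h [])
Σℕ-allVecs (suc n) h = trans (Σℕ-++ h (map (zero ∷_) vs) _) (cong₂ _+_ (trans (Σℕ-map h _ vs) (Σℕ-allVecs n _))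
  (trans (Σℕ-++ h (map (suc zero ∷_) vs) []) (trans (+-identityʳ _) (trans (Σℕ-map h _ vs) (Σℕ-allVecs n _)))))
  where
  vs : List (Vec (Fin 2) n)
  vs = allVecs (allFin 2) n

length-filter : ∀ {A : Set} {P : A → Set} (P? : ∀ x → Dec (P x)) xs →
                length (filter P? xs) ≡ Σℕ (λ x → if does (P? x) then 1 else 0) xs
length-filter P? []       = refl
length-filter P? (x ∷ xs) with does (P? x)
... | true  = cong suc (length-filter P? xs)
... | false = length-filter P? xs

module KirchhoffParity (G : Graph) (w : Fin (length (Graph.vertices G))) where
  open Graph G
  open TreeParity G w
  open Network source target w

  -- The matrix-tree theorem modulo 2. The monomial of T is odd when every edge outside T has odd
  -- weight, that is, when `lookup T e ∨ odd (α e)` holds for all e.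
  odd-Ψ : ∀ α → odd (Ψ G α) ≡ Q (odd ∘ α)
  odd-Ψ α = begin
    odd (Ψ G α) ≡⟨ odd-sum-filter (isSpanningTree? G) _ (allVecs (outside ∷ inside ∷ []) m) ⟩
    xorOver _ (allVecs (outside ∷ inside ∷ []) m) ≡⟨ xorOver-allVecs m _ ⟩
    S m (λ T → does (isSpanningTree? G T) ∧ odd (product (map α (filter (λ e → ¬? (e ∈ˢ? T)) (allFin m)))))
      ≡⟨ S-cong m (λ T → trans (∧-comm (does (isSpanningTree? G T)) _) (cong₂ _∧_ (weight T) (sym (treeParity-spanning T)))) ⟩
    S m (λ T → Π m (λ e → lookup T e ∨ odd (α e)) ∧ treeParity (lookup T)) ≡⟨ sum-over-trees (odd ∘ α) ⟩
    Q (odd ∘ α) ∎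
    where
    open ≡-Reasoning
    does-∈ : ∀ T e → does (e ∈ˢ? T) ≡ lookup T e
    does-∈ T e = bool-ext (λ p → ∈ˢ⇒lookup T (does-true⁻ (e ∈ˢ? T) p)) (λ p → dec-true (e ∈ˢ? T) (lookup⇒∈ˢ T p))
    not-not : ∀ b → not (not b) ≡ b
    not-not true  = refl
    not-not false = refl
    weight : ∀ T → odd (product (map α (filter (λ e → ¬? (e ∈ˢ? T)) (allFin m)))) ≡ Π m (λ e → lookup T e ∨ odd (α e))
    weight T = trans (odd-product-filter (λ e → ¬? (e ∈ˢ? T)) α m (λ e → e))
      (Π-cong m (λ e → cong (_∨ odd (α e)) (trans (not-not (does (e ∈ˢ? T))) (does-∈ T e))))

  zeros-2 : zeros G 2 ≡ Sℕ m (λ α → if Q (lookup α) then 0 else 1)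
  zeros-2 = trans (length-filter (λ α → 2 ∣? Ψ G (toℕ ∘ lookup α)) (allVecs (allFin 2) m))
    (trans (Σℕ-allVecs m _) (Sℕ-cong m pointwise))
    where
    odd-bit : ∀ b → odd (toℕ (bit b)) ≡ b
    odd-bit false = refl
    odd-bit true  = refl
    flip : ∀ b → (if not b then 1 else 0) ≡ (if b then 0 else 1)
    flip true  = refl
    flip false = refl
    Q-cong : ∀ {α β} → (∀ e → α e ≡ β e) → Q α ≡ Q β
    Q-cong eq = S-cong (n + m) (λ z → cong (V z ∧_) (Π-cong m (λ e → cong (λ k → (at (δ e) z ⊕ k ∧ at (Y e) z) ⊕ true) (eq e))))
    pointwise : ∀ α → (if does (2 ∣? Ψ G (toℕ ∘ lookup (Vec.map bit α))) then 1 else 0) ≡ (if Q (lookup α) then 0 else 1)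
    pointwise α = trans (cong (if_then 1 else 0) (trans (odd-∣? (Ψ G β)) (cong not (trans (odd-Ψ β)
        (Q-cong (λ e → trans (cong (odd ∘ toℕ) (lookup-map e bit α)) (odd-bit (lookup α e))))))))
      (flip (Q (lookup α)))
      where
      β : Edge → ℕ
      β = toℕ ∘ lookup (Vec.map bit α)

-- The torus

module _ {n : ℕ} where

  residue : ℕ → Fin (suc n)
  residue a = a mod suc n

  toℕ-residue : ∀ a → toℕ (residue a) ≡ a % suc n
  toℕ-residue a = toℕ-fromℕ< (m%n<n a (suc n))

  residue-toℕ : ∀ i → residue (toℕ i) ≡ i
  residue-toℕ i = toℕ-injective (trans (toℕ-residue (toℕ i)) (m<n⇒m%n≡m (toℕ<n i)))

  residue-cong : ∀ a b → a % suc n ≡ b % suc n → residue a ≡ residue b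
  residue-cong a b eq = toℕ-injective (trans (toℕ-residue a) (trans eq (sym (toℕ-residue b))))

  residue-+ : ∀ a b → residue (toℕ (residue a) + b) ≡ residue (a + b)
  residue-+ a b = residue-cong (toℕ (residue a) + b) (a + b) (begin
    (toℕ (residue a) + b) % M        ≡⟨ cong (λ k → (k + b) % M) (toℕ-residue a) ⟩
    (a % M + b) % M                  ≡⟨ %-distribˡ-+ (a % M) b M ⟩
    (a % M % M + b % M) % M          ≡⟨ cong (λ k → (k + b % M) % M) (m%n%n≡m%n a M) ⟩
    (a % M + b % M) % M              ≡⟨ sym (%-distribˡ-+ a b M) ⟩
    (a + b) % M                      ∎)
    where
    open ≡-Reasoning
    M = suc n

  residue-period : ∀ a → residue (a + suc n) ≡ residue a
  residue-period a = residue-cong (a + suc n) a ([m+n]%n≡m%n a (suc n))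

  sucMod-residue : ∀ a → sucMod (residue a) ≡ residue (suc a)
  sucMod-residue a = begin
    residue (suc (toℕ (residue a)))  ≡⟨ cong residue (+-comm 1 _) ⟩
    residue (toℕ (residue a) + 1)    ≡⟨ residue-+ a 1 ⟩
    residue (a + 1)                  ≡⟨ cong residue (+-comm a 1) ⟩
    residue (suc a)                  ∎
    where open ≡-Reasoning

  sucMod-injective : ∀ {i j : Fin (suc n)} → sucMod i ≡ sucMod j → i ≡ j
  sucMod-injective {i} {j} eq = trans (sym (back i)) (trans (cong (λ k → residue (toℕ k + n)) eq) (back j))
    where
    back : ∀ i → residue (toℕ (sucMod i) + n) ≡ i
    back i = trans (residue-+ (suc (toℕ i)) n) (trans (cong residue (sym (+-suc (toℕ i) n))) (trans (residue-period (toℕ i)) (residue-toℕ i)))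

  residue-cancel : ∀ a b c → residue (a + c) ≡ residue (b + c) → residue a ≡ residue b
  residue-cancel a b zero    eq = trans (cong residue (sym (+-identityʳ a))) (trans eq (cong residue (+-identityʳ b)))
  residue-cancel a b (suc c) eq = residue-cancel a b c (sucMod-injective
    (trans (sucMod-residue (a + c)) (trans (cong residue (sym (+-suc a c))) (trans eq (trans (cong residue (+-suc b c)) (sym (sucMod-residue (b + c))))))))

  toℕ-cancel : ∀ i j c → residue (toℕ i + c) ≡ residue (toℕ j + c) → i ≡ j
  toℕ-cancel i j c eq = trans (sym (residue-toℕ i)) (trans (residue-cancel (toℕ i) (toℕ j) c eq) (residue-toℕ j))

  shift-≢ : ∀ i d → 0 < d → d < suc n → residue (toℕ i + d) ≢ i
  shift-≢ i (suc d) _ d< eq with trans (sym (m<n⇒m%n≡m d<)) (trans (sym (toℕ-residue (suc d))) (cong toℕ zero≡))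
    where
    zero≡ : residue (suc d) ≡ residue 0
    zero≡ = residue-cancel (suc d) 0 (toℕ i) (trans (cong residue (+-comm (suc d) (toℕ i))) (trans eq (sym (residue-toℕ i))))
  ... | ()

  -- The reflection h ↦ 2q - h of the cycle about q. The modulus is added before h is subtracted, so
  -- that the truncated subtraction is exact.
  mirror : Fin (suc n) → Fin (suc n) → Fin (suc n)
  mirror q h = residue (toℕ q + toℕ q + (suc n ∸ toℕ h))

  mirror-sum : ∀ q h → residue (toℕ (mirror q h) + toℕ h) ≡ residue (toℕ q + toℕ q)
  mirror-sum q h = begin
    residue (toℕ (mirror q h) + toℕ h)                      ≡⟨ residue-+ (toℕ q + toℕ q + (suc n ∸ toℕ h)) (toℕ h) ⟩
    residue (toℕ q + toℕ q + (suc n ∸ toℕ h) + toℕ h)       ≡⟨ cong residue (+-assoc (toℕ q + toℕ q) _ (toℕ h)) ⟩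
    residue (toℕ q + toℕ q + (suc n ∸ toℕ h + toℕ h))       ≡⟨ cong (λ k → residue (toℕ q + toℕ q + k)) (m∸n+n≡m (<⇒≤ (toℕ<n h))) ⟩
    residue (toℕ q + toℕ q + suc n)                         ≡⟨ residue-period (toℕ q + toℕ q) ⟩
    residue (toℕ q + toℕ q)                                 ∎
    where open ≡-Reasoning

  mirror-unique : ∀ q i h → residue (toℕ i + toℕ h) ≡ residue (toℕ q + toℕ q) → mirror q h ≡ i
  mirror-unique q i h eq = toℕ-cancel (mirror q h) i (toℕ h) (trans (mirror-sum q h) (sym eq))

  mirror-involutive : ∀ q h → mirror q (mirror q h) ≡ h
  mirror-involutive q h = mirror-unique q h (mirror q h) (trans (cong residue (+-comm (toℕ h) _)) (mirror-sum q h))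

  mirror-centre : ∀ q → mirror q q ≡ q
  mirror-centre q = mirror-unique q q q refl

  sucMod-mirror : ∀ q h → sucMod (mirror q (sucMod h)) ≡ mirror q h
  sucMod-mirror q h = sym (mirror-unique q _ h (begin
    residue (toℕ (sucMod i) + toℕ h)    ≡⟨ residue-+ (suc (toℕ i)) (toℕ h) ⟩
    residue (suc (toℕ i) + toℕ h)       ≡⟨ cong residue (+-comm (suc (toℕ i)) (toℕ h)) ⟩
    residue (toℕ h + suc (toℕ i))       ≡⟨ cong residue (+-suc (toℕ h) (toℕ i)) ⟩
    residue (suc (toℕ h) + toℕ i)       ≡⟨ sym (residue-+ (suc (toℕ h)) (toℕ i)) ⟩
    residue (toℕ (sucMod h) + toℕ i)    ≡⟨ cong residue (+-comm (toℕ (sucMod h)) (toℕ i)) ⟩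
    residue (toℕ i + toℕ (sucMod h))    ≡⟨ mirror-sum q (sucMod h) ⟩
    residue (toℕ q + toℕ q)             ∎))
    where
    open ≡-Reasoning
    i : Fin (suc n)
    i = mirror q (sucMod h)

  residue-sum : ∀ a b → residue (toℕ (residue a) + toℕ (residue b)) ≡ residue (a + b)
  residue-sum a b = trans (residue-+ a _) (trans (cong residue (+-comm a _)) (trans (residue-+ b a) (cong residue (+-comm b a))))

  -- Going b steps forward from q is the same as going a steps back, as a + b is the length. With a
  -- = b this gives the fixed point opposite to q, with b = a + 1 the two neighbouring points that
  -- are exchanged.
  mirror-far : ∀ q a b → a + b ≡ suc n → mirror q (residue (toℕ q + b)) ≡ residue (toℕ q + a)
  mirror-far q a b eq = mirror-unique q (residue (toℕ q + a)) (residue (toℕ q + b)) (begin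
    residue (toℕ (residue (toℕ q + a)) + toℕ (residue (toℕ q + b))) ≡⟨ residue-sum (toℕ q + a) (toℕ q + b) ⟩
    residue ((toℕ q + a) + (toℕ q + b)) ≡⟨ cong residue (solve 3 (λ q a b → (q :+ a) :+ (q :+ b) := (q :+ q) :+ (a :+ b)) refl (toℕ q) a b) ⟩
    residue (toℕ q + toℕ q + (a + b))   ≡⟨ cong (λ k → residue (toℕ q + toℕ q + k)) eq ⟩
    residue (toℕ q + toℕ q + suc n)     ≡⟨ residue-period (toℕ q + toℕ q) ⟩
    residue (toℕ q + toℕ q)             ∎)
    where
    open ≡-Reasoning
    open +-*-Solver

  sucMod-≢ : 1 < suc n → ∀ (i : Fin (suc n)) → sucMod i ≢ i
  sucMod-≢ 1< i eq = shift-≢ i 1 (s≤s z≤n) 1< (trans (cong residue (+-comm (toℕ i) 1)) eq)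

  sucMod²-≢ : 2 < suc n → ∀ (i : Fin (suc n)) → sucMod (sucMod i) ≢ i
  sucMod²-≢ 2< i eq = shift-≢ i 2 (s≤s z≤n) 2<
    (trans (cong residue (+-comm (toℕ i) 2)) (trans (sym (sucMod-residue (suc (toℕ i)))) eq))

-- Counting and labelling with lists without repetition

unique-⊆-length : ∀ {A : Set} {xs ys : List A} → Unique xs → (∀ {x} → x ∈ xs → x ∈ ys) → length xs ≤ length ys
unique-⊆-length {xs = xs} {ys} xs! sub = injective⇒≤ {f = λ i → index (sub (∈-lookup i))} (λ {i} {j} eq →
  lookup-injective xs! (trans (lookup-index (sub (∈-lookup {xs = xs} i)))
    (trans (cong (lookupˡ ys) eq) (sym (lookup-index (sub (∈-lookup {xs = xs} j)))))))

length-cartesianProduct : ∀ {A B : Set} (xs : List A) (ys : List B) → length (cartesianProduct xs ys) ≡ length xs * length ys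
length-cartesianProduct []       ys = refl
length-cartesianProduct (x ∷ xs) ys = trans (length-++ (map (x ,_) ys)) (cong₂ _+_ (length-map (x ,_) ys) (length-cartesianProduct xs ys))

cartesianProduct-mapʳ : ∀ {A B C : Set} (g : B → C) (xs : List A) ys →
  cartesianProduct xs (map g ys) ≡ map (λ (a , b) → a , g b) (cartesianProduct xs ys)
cartesianProduct-mapʳ g []       ys = refl
cartesianProduct-mapʳ g (x ∷ xs) ys = trans (cong₂ _++ˡ_ (trans (sym (map-∘ ys)) (map-∘ ys)) (cartesianProduct-mapʳ g xs ys)) (sym (map-++ _ (map (x ,_) ys) _))

cartesianProduct-mapˡ : ∀ {A B C : Set} (g : A → C) (xs : List A) (ys : List B) →
  cartesianProduct (map g xs) ys ≡ map (λ (a , b) → g a , b) (cartesianProduct xs ys)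
cartesianProduct-mapˡ g []       ys = refl
cartesianProduct-mapˡ g (x ∷ xs) ys = trans (cong₂ _++ˡ_ (map-∘ ys) (cartesianProduct-mapˡ g xs ys)) (sym (map-++ _ (map (x ,_) ys) _))

filter-map : ∀ {A B : Set} {P : B → Set} (P? : ∀ b → Dec (P b)) (f : A → B) xs → filter P? (map f xs) ≡ map f (filter (P? ∘ f) xs)
filter-map P? f []       = refl
filter-map P? f (x ∷ xs) with P? (f x)
... | yes _ = cong (f x ∷_) (filter-map P? f xs)
... | no _  = filter-map P? f xs

preimage : ∀ {A B : Set} (f : A → B) (L : List A) → Fin (length (map f L)) → A
preimage f (x ∷ L) zero    = x
preimage f (x ∷ L) (suc i) = preimage f L i

lookup-preimage : ∀ {A B : Set} (f : A → B) L i → lookupˡ (map f L) i ≡ f (preimage f L i)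
lookup-preimage f (x ∷ L) zero    = refl
lookup-preimage f (x ∷ L) (suc i) = lookup-preimage f L i

preimage-∈ : ∀ {A B : Set} (f : A → B) L i → preimage f L i ∈ L
preimage-∈ f (x ∷ L) zero    = here refl
preimage-∈ f (x ∷ L) (suc i) = there (preimage-∈ f L i)

preimage-injective : ∀ {A B : Set} (f : A → B) {L} → Unique L → ∀ {i j} → preimage f L i ≡ preimage f L j → i ≡ j
preimage-injective f {x ∷ L} _         {zero}  {zero}  _  = refl
preimage-injective f {x ∷ L} (x∉ ∷ _)  {zero}  {suc j} eq = contradiction eq (lookupAll x∉ (preimage-∈ f L j))
preimage-injective f {x ∷ L} (x∉ ∷ _)  {suc i} {zero}  eq = contradiction (sym eq) (lookupAll x∉ (preimage-∈ f L i))
preimage-injective f {x ∷ L} (_ ∷ L!)  {suc i} {suc j} eq = cong suc (preimage-injective f L! eq)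

preimage-surjective : ∀ {A B : Set} (f : A → B) L {x} → x ∈ L → ∃ λ i → preimage f L i ≡ x
preimage-surjective f (x ∷ L) (here refl) = zero , refl
preimage-surjective f (x ∷ L) (there x∈)  = let i , eq = preimage-surjective f L x∈ in suc i , eq

-- Edges are positions in a filtered list, which are awkward to compute with. A labelling identifies
-- them with the elements of L; injectivity is asked of the labels, not of f.
record Labelling {A B : Set} (f : A → B) (L : List A) (xs : List B) : Set where
  field
    label           : Fin (length xs) → A
    lookup-label    : ∀ i → lookupˡ xs i ≡ f (label i)
    label-∈         : ∀ i → label i ∈ L
    label-injective : ∀ {i j} → label i ≡ label j → i ≡ j
    label-onto      : ∀ {x} → x ∈ L → ∃ λ i → label i ≡ x

labelling : ∀ {A B : Set} (f : A → B) {L xs} → xs ≡ map f L → Unique L → Labelling f L xs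
labelling f {L} refl L! = record
  { label           = preimage f L
  ; lookup-label    = lookup-preimage f L
  ; label-∈         = preimage-∈ f L
  ; label-injective = preimage-injective f L!
  ; label-onto      = preimage-surjective f L
  }

half-of : ∀ n → ∃ λ d → (n ≡ d + d) ⊎ (n ≡ d + suc d)
half-of zero    = 0 , inj₁ refl
half-of (suc n) with half-of n
... | d , inj₁ refl = d , inj₂ (sym (+-suc d d))
... | d , inj₂ refl = suc d , inj₁ refl

eight-divides⇒ : ∀ z → (∃ λ d → z ≡ 8 * d) → z / 4 % 2 ≡ 0
eight-divides⇒ z (d , eq) = begin
  z / 4 % 2              ≡⟨ cong (λ z → z / 4 % 2) (trans eq (solve 1 (λ d → con 8 :* d := d :* con 2 :* con 4) refl d)) ⟩
  d * 2 * 4 / 4 % 2      ≡⟨ cong (_% 2) (m*n/n≡m (d * 2) 4) ⟩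
  d * 2 % 2              ≡⟨ m*n%n≡0 d 2 ⟩
  0                      ∎
  where
  open ≡-Reasoning
  open +-*-Solver

c₂-reflection : ∀ G w → Reflection (TreeParity.source G w) (TreeParity.target G w) w → c₂ 2 G ≡ 0
c₂-reflection G w reflection = eight-divides⇒ (zeros G 2)
  (let d , eq = Reflected.eight-divides reflection in d , trans (KirchhoffParity.zeros-2 G w) eq)

incident-to : ∀ {n m} (s t : Fin m → Fin n) {w a b c e₁ e₂ e₃} →
  s e₁ ≡ w → t e₁ ≡ a → s e₂ ≡ w → t e₂ ≡ b → s e₃ ≡ c → t e₃ ≡ w → a ≢ w → b ≢ w → c ≢ w →
  (∀ e → s e ≡ w → e ≡ e₁ ⊎ e ≡ e₂) → (∀ e → t e ≡ w → e ≡ e₃) →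
  ∀ e → (w == s e) ⊕ (w == t e) ≡ (e == e₁) ∨ ((e == e₂) ∨ (e == e₃))
incident-to s t {w} {e₁ = e₁} {e₂} {e₃} s₁ t₁ s₂ t₂ s₃ t₃ a≢ b≢ c≢ s⁻ t⁻ e with e ≟ᶠ e₁ | e ≟ᶠ e₂ | e ≟ᶠ e₃
... | yes refl | _        | _        = cong₂ _⊕_ (trans (cong (w ==_) s₁) (==-refl w)) (==-false (λ w≡ → a≢ (trans (sym t₁) (sym w≡))))
... | no _     | yes refl | _        = cong₂ _⊕_ (trans (cong (w ==_) s₂) (==-refl w)) (==-false (λ w≡ → b≢ (trans (sym t₂) (sym w≡))))
... | no _     | no _     | yes refl = cong₂ _⊕_ (==-false (λ w≡ → c≢ (trans (sym s₃) (sym w≡)))) (trans (cong (w ==_) t₃) (==-refl w))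
... | no e≢₁   | no e≢₂   | no e≢₃   = cong₂ _⊕_ (==-false (λ w≡s → [ e≢₁ , e≢₂ ]′ (s⁻ e (sym w≡s)))) (==-false (λ w≡t → e≢₃ (t⁻ e (sym w≡t))))

-- The decompleted torus and its reflection

module Torus {k N : ℕ} (p : Fin k) (q : Fin N) (p₋ : Fin k) (mirror : Fin N → Fin N)
  (sucMod-p₋ : sucMod p₋ ≡ p)
  (p₁≢p : sucMod p ≢ p) (p₂≢p : sucMod (sucMod p) ≢ p) (p₂≢p₁ : sucMod (sucMod p) ≢ sucMod p) (q₁≢q : sucMod q ≢ q)
  (sucMod-injective-k : ∀ {i j : Fin k} → sucMod i ≡ sucMod j → i ≡ j)
  (sucMod-injective-N : ∀ {i j : Fin N} → sucMod i ≡ sucMod j → i ≡ j)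
  (mirror-involutive : ∀ h → mirror (mirror h) ≡ h)
  (mirror-centre : mirror q ≡ q)
  (sucMod-mirror : ∀ h → sucMod (mirror (sucMod h)) ≡ mirror h)
  where

  v : Fin k × Fin N
  v = p , q

  p₁ p₂ : Fin k
  p₁ = sucMod p
  p₂ = sucMod p₁

  q₁ q₋ : Fin N
  q₁ = sucMod q
  q₋ = mirror q₁

  sucMod-q₋ : sucMod q₋ ≡ q
  sucMod-q₋ = trans (sucMod-mirror q) mirror-centre

  q₋≢q : q₋ ≢ q
  q₋≢q eq = q₁≢q (trans (cong sucMod (sym eq)) sucMod-q₋)

  p₋≢p : p₋ ≢ p
  p₋≢p eq = p₁≢p (trans (cong sucMod (sym eq)) sucMod-p₋)

  Γ G : Graph
  Γ = γ k □ γ N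
  G = Γ ∖ v

  open Graph G using (Vertex; _≟_; vertices; edges; unique; ends; ∣E∣)

  -- The edge leaving a vertex in the second (false) or first (true) direction.
  Label : Set
  Label = Bool × Vertex

  endsOf : Label → Vertex × Vertex
  endsOf (false , (g , h)) = (g , h) , (g , sucMod h)
  endsOf (true  , (g , h)) = (g , h) , (sucMod g , h)

  tagged : Bool → Vertex → Label
  tagged b x = b , x

  torusVertices : List Vertex
  torusVertices = cartesianProduct (allFin k) (allFin N)

  torusLabels : List Label
  torusLabels = map (tagged false) torusVertices ++ˡ map (tagged true) torusVertices

  torus-edges : Graph.edges Γ ≡ map endsOf torusLabels
  torus-edges = trans (cong₂ _++ˡ_
      (trans (cong (map _) (cartesianProduct-mapʳ (λ i → i , sucMod i) (allFin k) (allFin N))) (trans (sym (map-∘ torusVertices)) (map-∘ torusVertices)))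
      (trans (cong (map _) (cartesianProduct-mapˡ (λ i → i , sucMod i) (allFin k) (allFin N))) (trans (sym (map-∘ torusVertices)) (map-∘ torusVertices))))
    (sym (map-++ endsOf (map (tagged false) torusVertices) _))

  Avoids : Vertex × Vertex → Set
  Avoids (x , y) = x ≢ v × y ≢ v

  avoids? : ∀ e → Dec (Avoids e)
  avoids? (x , y) = ¬? (x ≟ v) ×-dec ¬? (y ≟ v)

  labels : List Label
  labels = filter (avoids? ∘ endsOf) torusLabels

  edges≡ : edges ≡ map endsOf labels
  edges≡ = trans (cong (filter avoids?) torus-edges) (filter-map avoids? endsOf torusLabels)

  torusVertices! : Unique torusVertices
  torusVertices! = Unique.cartesianProduct⁺ (Unique.allFin⁺ k) (Unique.allFin⁺ N)

  torusLabels! : Unique torusLabels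
  torusLabels! = Unique.++⁺ (Unique.map⁺ (cong proj₂) torusVertices!) (Unique.map⁺ (cong proj₂) torusVertices!) disjoint
    where
    disjoint : Disjoint (map (tagged false) torusVertices) (map (tagged true) torusVertices)
    disjoint (a , b) with ∈-map⁻ (tagged false) a | ∈-map⁻ (tagged true) b
    ... | _ , _ , refl | _ , _ , ()

  ∈-torusVertices : ∀ x → x ∈ torusVertices
  ∈-torusVertices (g , h) = ∈-cartesianProduct⁺ (∈-allFin g) (∈-allFin h)

  ∈-torusLabels : ∀ l → l ∈ torusLabels
  ∈-torusLabels (false , x) = ∈-++⁺ˡ (∈-map⁺ (tagged false) (∈-torusVertices x))
  ∈-torusLabels (true  , x) = ∈-++⁺ʳ (map (tagged false) torusVertices) (∈-map⁺ (tagged true) (∈-torusVertices x))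

  abstract

    edgeLabelling : Labelling endsOf labels edges
    edgeLabelling = labelling endsOf edges≡ (Unique.filter⁺ (avoids? ∘ endsOf) torusLabels!)

    ∈-labels : ∀ l → Avoids (endsOf l) → l ∈ labels
    ∈-labels l good = ∈-filter⁺ (avoids? ∘ endsOf) (∈-torusLabels l) good

  open Labelling edgeLabelling

  edge : ∀ l → Avoids (endsOf l) → ∃ λ e → label e ≡ l
  edge l good = label-onto (∈-labels l good)

  label-avoids : ∀ e → Avoids (endsOf (label e))
  label-avoids e = proj₂ (∈-filter⁻ (avoids? ∘ endsOf) {xs = torusLabels} (label-∈ e))

  abstract

    vertex : ∀ x → x ≢ v → ∃ λ i → lookupˡ vertices i ≡ x
    vertex x x≢v = index x∈ , sym (lookup-index x∈)
      where
      x∈ : x ∈ vertices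
      x∈ = ∈-filter⁺ (λ y → ¬? (y ≟ v)) (∈-torusVertices x) x≢v

  vertex-≢ : ∀ i → lookupˡ vertices i ≢ v
  vertex-≢ i = proj₂ (∈-filter⁻ (λ y → ¬? (y ≟ v)) {xs = torusVertices} (∈-lookup i))

  σ : Vertex → Vertex
  σ (g , h) = g , mirror h

  σ-involutive : ∀ x → σ (σ x) ≡ x
  σ-involutive (g , h) = cong (g ,_) (mirror-involutive h)

  σ-≢ : ∀ {x} → x ≢ v → σ x ≢ v
  σ-≢ {x} x≢v eq = x≢v (trans (sym (σ-involutive x)) (trans (cong σ eq) (cong (p ,_) mirror-centre)))

  -- A reflected edge in the second direction is traversed backwards, so its initial vertex is the
  -- image of the old terminal one.
  σᴸ : Label → Label
  σᴸ (false , (g , h)) = false , (g , mirror (sucMod h))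
  σᴸ (true  , (g , h)) = true , (g , mirror h)

  σᴸ-involutive : ∀ l → σᴸ (σᴸ l) ≡ l
  σᴸ-involutive (false , (g , h)) = cong (λ h → false , (g , h)) (trans (cong mirror (sucMod-mirror h)) (mirror-involutive h))
  σᴸ-involutive (true  , (g , h)) = cong (λ h → true , (g , h)) (mirror-involutive h)

  endsOf-σᴸ : ∀ l → endsOf (σᴸ l) ≡ (σ (proj₁ (endsOf l)) , σ (proj₂ (endsOf l))) ⊎ endsOf (σᴸ l) ≡ (σ (proj₂ (endsOf l)) , σ (proj₁ (endsOf l)))
  endsOf-σᴸ (false , (g , h)) = inj₂ (cong (λ i → (g , mirror (sucMod h)) , (g , i)) (sucMod-mirror h))
  endsOf-σᴸ (true  , (g , h)) = inj₁ refl

  σᴸ-avoids : ∀ l → Avoids (endsOf l) → Avoids (endsOf (σᴸ l))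
  σᴸ-avoids l (x≢ , y≢) with endsOf-σᴸ l
  ... | inj₁ eq = subst Avoids (sym eq) (σ-≢ x≢ , σ-≢ y≢)
  ... | inj₂ eq = subst Avoids (sym eq) (σ-≢ y≢ , σ-≢ x≢)

  -- w is the neighbour of v along the axis of the reflection. Its fourth neighbour is v itself,
  -- which is deleted; a continues the axis, and b and c lie on either side.
  vʷ vᵃ vᵇ vᶜ : Vertex
  vʷ = p₁ , q
  vᵃ = p₂ , q
  vᵇ = p₁ , q₁
  vᶜ = p₁ , q₋

  vʷ≢v : vʷ ≢ v
  vʷ≢v = p₁≢p ∘ cong proj₁

  vᵃ≢v : vᵃ ≢ v
  vᵃ≢v = p₂≢p ∘ cong proj₁

  vᵇ≢v : vᵇ ≢ v
  vᵇ≢v = p₁≢p ∘ cong proj₁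

  vᶜ≢v : vᶜ ≢ v
  vᶜ≢v = p₁≢p ∘ cong proj₁

  l₁ l₂ l₃ : Label
  l₁ = true , (p₁ , q)
  l₂ = false , (p₁ , q)
  l₃ = false , (p₁ , q₋)

  w a b c : Fin (length vertices)
  w = proj₁ (vertex vʷ vʷ≢v)
  a = proj₁ (vertex vᵃ vᵃ≢v)
  b = proj₁ (vertex vᵇ vᵇ≢v)
  c = proj₁ (vertex vᶜ vᶜ≢v)

  w≡ : lookupˡ vertices w ≡ vʷ
  w≡ = proj₂ (vertex vʷ vʷ≢v)

  a≡ : lookupˡ vertices a ≡ vᵃ
  a≡ = proj₂ (vertex vᵃ vᵃ≢v)

  b≡ : lookupˡ vertices b ≡ vᵇ
  b≡ = proj₂ (vertex vᵇ vᵇ≢v)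

  c≡ : lookupˡ vertices c ≡ vᶜ
  c≡ = proj₂ (vertex vᶜ vᶜ≢v)

  edge₁ : ∃ λ e → label e ≡ l₁
  edge₁ = edge l₁ (vʷ≢v , vᵃ≢v)

  edge₂ : ∃ λ e → label e ≡ l₂
  edge₂ = edge l₂ (vʷ≢v , vᵇ≢v)

  edge₃ : ∃ λ e → label e ≡ l₃
  edge₃ = edge l₃ (vᶜ≢v , p₁≢p ∘ cong proj₁)

  e₁ e₂ e₃ : Fin (length edges)
  e₁ = proj₁ edge₁
  e₂ = proj₁ edge₂
  e₃ = proj₁ edge₃

  distinct : ∀ {e f l l′} → label e ≡ l → label f ≡ l′ → l ≢ l′ → e ≢ f
  distinct e≡ f≡ l≢ refl = l≢ (trans (sym e≡) f≡)

  e₂≢e₁ : e₂ ≢ e₁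
  e₂≢e₁ = distinct (proj₂ edge₂) (proj₂ edge₁) (λ ())

  e₃≢e₁ : e₃ ≢ e₁
  e₃≢e₁ = distinct (proj₂ edge₃) (proj₂ edge₁) (λ ())

  e₃≢e₂ : e₃ ≢ e₂
  e₃≢e₂ = distinct (proj₂ edge₃) (proj₂ edge₂) (q₋≢q ∘ cong (proj₂ ∘ proj₂))

  open TreeParity G w using (source; target; vertexAt-source; vertexAt-target)

  at-position : ∀ {i j x y} → lookupˡ vertices i ≡ x → lookupˡ vertices j ≡ y → x ≡ y → i ≡ j
  at-position i≡ j≡ x≡y = lookup-injective unique (trans i≡ (trans x≡y (sym j≡)))

  source-label : ∀ e → lookupˡ vertices (source e) ≡ proj₁ (endsOf (label e))
  source-label e = trans (sym (vertexAt-source e)) (cong proj₁ (lookup-label e))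

  target-label : ∀ e → lookupˡ vertices (target e) ≡ proj₂ (endsOf (label e))
  target-label e = trans (sym (vertexAt-target e)) (cong proj₂ (lookup-label e))

  source≡ : ∀ {e l i x} → label e ≡ l → lookupˡ vertices i ≡ x → proj₁ (endsOf l) ≡ x → source e ≡ i
  source≡ {e} refl i≡ x≡ = at-position (source-label e) i≡ x≡

  target≡ : ∀ {e l i x} → label e ≡ l → lookupˡ vertices i ≡ x → proj₂ (endsOf l) ≡ x → target e ≡ i
  target≡ {e} refl i≡ x≡ = at-position (target-label e) i≡ x≡

  source-e₁ : source e₁ ≡ w
  source-e₁ = source≡ {e₁} {l₁} {w} (proj₂ edge₁) w≡ refl

  target-e₁ : target e₁ ≡ a
  target-e₁ = target≡ {e₁} {l₁} {a} (proj₂ edge₁) a≡ refl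

  source-e₂ : source e₂ ≡ w
  source-e₂ = source≡ {e₂} {l₂} {w} (proj₂ edge₂) w≡ refl

  target-e₂ : target e₂ ≡ b
  target-e₂ = target≡ {e₂} {l₂} {b} (proj₂ edge₂) b≡ refl

  source-e₃ : source e₃ ≡ c
  source-e₃ = source≡ {e₃} {l₃} {c} (proj₂ edge₃) c≡ refl

  target-e₃ : target e₃ ≡ w
  target-e₃ = target≡ {e₃} {l₃} {w} (proj₂ edge₃) w≡ (cong (p₁ ,_) sucMod-q₋)

  a≢w : a ≢ w
  a≢w eq = p₂≢p₁ (cong proj₁ (trans (sym a≡) (trans (cong (lookupˡ vertices) eq) w≡)))

  b≢w : b ≢ w
  b≢w eq = q₁≢q (cong proj₂ (trans (sym b≡) (trans (cong (lookupˡ vertices) eq) w≡)))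

  c≢w : c ≢ w
  c≢w eq = q₋≢q (cong proj₂ (trans (sym c≡) (trans (cong (lookupˡ vertices) eq) w≡)))

  source-w : ∀ e → source e ≡ w → e ≡ e₁ ⊎ e ≡ e₂
  source-w e eq = by-label (label e) refl (trans (sym (source-label e)) (trans (cong (lookupˡ vertices) eq) w≡))
    where
    by-label : ∀ l → label e ≡ l → proj₁ (endsOf l) ≡ vʷ → e ≡ e₁ ⊎ e ≡ e₂
    by-label (true  , _) l≡ refl = inj₁ (label-injective (trans l≡ (sym (proj₂ edge₁))))
    by-label (false , _) l≡ refl = inj₂ (label-injective (trans l≡ (sym (proj₂ edge₂))))

  target-w : ∀ e → target e ≡ w → e ≡ e₃
  target-w e eq = by-label (label e) refl (label-avoids e) (trans (sym (target-label e)) (trans (cong (lookupˡ vertices) eq) w≡))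
    where
    by-label : ∀ l → label e ≡ l → Avoids (endsOf l) → proj₂ (endsOf l) ≡ vʷ → e ≡ e₃
    by-label (false , (g , h)) l≡ _ x≡ = label-injective (trans l≡ (trans
      (cong₂ (λ g h → false , (g , h)) (cong proj₁ x≡) (sucMod-injective-N (trans (cong proj₂ x≡) (sym sucMod-q₋)))) (sym (proj₂ edge₃))))
    -- The edge of the torus that enters w in the first direction starts at v and is absent from G.
    by-label (true  , (g , h)) l≡ (g≢ , _) x≡ = contradiction (cong₂ _,_ (sucMod-injective-k (cong proj₁ x≡)) (cong proj₂ x≡)) g≢

  at-w : ∀ e → (w == source e) ⊕ (w == target e) ≡ (e == e₁) ∨ ((e == e₂) ∨ (e == e₃))
  at-w = incident-to source target {w} {a} {b} {c} {e₁} {e₂} {e₃} source-e₁ target-e₁ source-e₂ target-e₂ source-e₃ target-e₃ a≢w b≢w c≢w source-w target-w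

  vertexAt : Fin (length vertices) → Vertex
  vertexAt = lookupˡ vertices

  abstract

    ρᵛ : Fin (length vertices) → Fin (length vertices)
    ρᵛ i = proj₁ (vertex (σ (vertexAt i)) (σ-≢ (vertex-≢ i)))

    vertexAt-ρᵛ : ∀ i → vertexAt (ρᵛ i) ≡ σ (vertexAt i)
    vertexAt-ρᵛ i = proj₂ (vertex (σ (vertexAt i)) (σ-≢ (vertex-≢ i)))

    ρᵉ : Fin (length edges) → Fin (length edges)
    ρᵉ e = proj₁ (edge (σᴸ (label e)) (σᴸ-avoids (label e) (label-avoids e)))

    label-ρᵉ : ∀ e → label (ρᵉ e) ≡ σᴸ (label e)
    label-ρᵉ e = proj₂ (edge (σᴸ (label e)) (σᴸ-avoids (label e) (label-avoids e)))

  ρᵛ-involutive : ∀ i → ρᵛ (ρᵛ i) ≡ i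
  ρᵛ-involutive i = lookup-injective unique (trans (vertexAt-ρᵛ (ρᵛ i)) (trans (cong σ (vertexAt-ρᵛ i)) (σ-involutive (vertexAt i))))

  ρᵉ-involutive : ∀ e → ρᵉ (ρᵉ e) ≡ e
  ρᵉ-involutive e = label-injective (trans (label-ρᵉ (ρᵉ e)) (trans (cong σᴸ (label-ρᵉ e)) (σᴸ-involutive (label e))))

  ρᵛ≡ : ∀ {i j x y} → vertexAt i ≡ x → vertexAt j ≡ y → σ x ≡ y → ρᵛ i ≡ j
  ρᵛ≡ {i} i≡ j≡ σx≡y = lookup-injective unique (trans (vertexAt-ρᵛ i) (trans (cong σ i≡) (trans σx≡y (sym j≡))))

  ρᵉ≡ : ∀ {e f l l′} → label e ≡ l → label f ≡ l′ → σᴸ l ≡ l′ → ρᵉ e ≡ f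
  ρᵉ≡ {e} e≡ f≡ σl≡l′ = label-injective (trans (label-ρᵉ e) (trans (cong σᴸ e≡) (trans σl≡l′ (sym f≡))))

  ends-ρ : ∀ e → (source (ρᵉ e) ≡ ρᵛ (source e) × target (ρᵉ e) ≡ ρᵛ (target e)) ⊎
                 (source (ρᵉ e) ≡ ρᵛ (target e) × target (ρᵉ e) ≡ ρᵛ (source e))
  ends-ρ e = [ (λ eq → inj₁ (source≡ (label-ρᵉ e) (image (source e) (source-label e)) (cong proj₁ eq) ,
                             target≡ (label-ρᵉ e) (image (target e) (target-label e)) (cong proj₂ eq)))
             , (λ eq → inj₂ (source≡ (label-ρᵉ e) (image (target e) (target-label e)) (cong proj₁ eq) ,
                             target≡ (label-ρᵉ e) (image (source e) (source-label e)) (cong proj₂ eq)))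
             ]′ (endsOf-σᴸ (label e))
    where
    image : ∀ i {x} → vertexAt i ≡ x → vertexAt (ρᵛ i) ≡ σ x
    image i i≡ = trans (vertexAt-ρᵛ i) (cong σ i≡)

  ρw : ρᵛ w ≡ w
  ρw = ρᵛ≡ w≡ w≡ (cong (p₁ ,_) mirror-centre)

  ρa : ρᵛ a ≡ a
  ρa = ρᵛ≡ a≡ a≡ (cong (p₂ ,_) mirror-centre)

  ρb : ρᵛ b ≡ c
  ρb = ρᵛ≡ b≡ c≡ refl

  ρe₁ : ρᵉ e₁ ≡ e₁
  ρe₁ = ρᵉ≡ (proj₂ edge₁) (proj₂ edge₁) (cong (λ h → true , (p₁ , h)) mirror-centre)

  ρe₂ : ρᵉ e₂ ≡ e₃
  ρe₂ = ρᵉ≡ (proj₂ edge₂) (proj₂ edge₃) refl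

  many-vertices : k * N ≤ suc (length vertices)
  many-vertices = begin
    k * N                                        ≡⟨ cong₂ _*_ (sym (length-tabulate {n = k} (λ i → i))) (sym (length-tabulate {n = N} (λ i → i))) ⟩
    length (allFin k) * length (allFin N)        ≡⟨ sym (length-cartesianProduct (allFin k) (allFin N)) ⟩
    length torusVertices                         ≤⟨ unique-⊆-length torusVertices! covered ⟩
    suc (length vertices)                        ∎
    where
    open ≤-Reasoning
    covered : ∀ {x} → x ∈ torusVertices → x ∈ v ∷ vertices
    covered {x} x∈ with x ≟ v
    ... | yes x≡v = here x≡v
    ... | no x≢v  = there (∈-filter⁺ (λ y → ¬? (y ≟ v)) x∈ x≢v)

  -- The torus has 2kN labels, among which the four in `at-v` have v as an end and are distinct from
  -- each other and from the labels of the edges of G.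
  few-edges : length edges + 4 ≤ k * N + k * N
  few-edges = begin
    length edges + 4
      ≡⟨ sym (trans (length-++ (map label (allFin (length edges)))) (cong (_+ 4) (trans (length-map label (allFin (length edges))) (length-tabulate {n = length edges} (λ i → i))))) ⟩
    length (map label (allFin (length edges)) ++ˡ at-v)
      ≤⟨ unique-⊆-length (Unique.++⁺ (Unique.map⁺ label-injective (Unique.allFin⁺ _)) at-v! disjoint) (λ {l} _ → ∈-torusLabels l) ⟩
    length torusLabels
      ≡⟨ trans (length-++ (map (tagged false) torusVertices)) (cong₂ _+_ (length-map (tagged false) torusVertices) (length-map (tagged true) torusVertices)) ⟩
    length torusVertices + length torusVertices
      ≡⟨ cong (λ k → k + k) (trans (length-cartesianProduct (allFin k) (allFin N)) (cong₂ _*_ (length-tabulate {n = k} (λ i → i)) (length-tabulate {n = N} (λ i → i)))) ⟩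
    k * N + k * N ∎
    where
    open ≤-Reasoning
    at-v : List Label
    at-v = (false , v) ∷ (false , (p , q₋)) ∷ (true , v) ∷ (true , (p₋ , q)) ∷ []
    at-v! : Unique at-v
    at-v! = ((q₋≢q ∘ sym ∘ cong (proj₂ ∘ proj₂)) ∷ (λ ()) ∷ (λ ()) ∷ []) ∷ ((λ ()) ∷ (λ ()) ∷ []) ∷ ((p₋≢p ∘ sym ∘ cong (proj₁ ∘ proj₂)) ∷ []) ∷ [] ∷ []
    blocked : ∀ {l} → l ∈ at-v → ¬ Avoids (endsOf l)
    blocked (here refl)                         (x≢ , _) = x≢ refl
    blocked (there (here refl))                 (_ , y≢) = y≢ (cong (p ,_) sucMod-q₋)
    blocked (there (there (here refl)))         (x≢ , _) = x≢ refl
    blocked (there (there (there (here refl)))) (_ , y≢) = y≢ (cong (_, q) sucMod-p₋)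
    disjoint : Disjoint (map label (allFin (length edges))) at-v
    disjoint (l∈ , l∈v) with ∈-map⁻ label l∈
    ... | e , _ , refl = blocked l∈v (label-avoids e)

  lowerEdges : List (Fin (length edges))
  lowerEdges = filter (λ e → toℕ e <? toℕ (ρᵉ e)) (allFin (length edges))

  module FixedEdges (tag : Bool) (r : Fin N) (σᴸ-fixed : ∀ g → σᴸ (tag , (g , r)) ≡ (tag , (g , r)))
    (avoids : ∀ g → Avoids (endsOf (tag , (g , r)))) where

    fixedEdge : Fin k → Fin (length edges)
    fixedEdge g = proj₁ (edge (tag , (g , r)) (avoids g))

    label-fixedEdge : ∀ g → label (fixedEdge g) ≡ (tag , (g , r))
    label-fixedEdge g = proj₂ (edge (tag , (g , r)) (avoids g))

    fixedEdge-injective : ∀ {g h} → fixedEdge g ≡ fixedEdge h → g ≡ h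
    fixedEdge-injective {g} {h} eq = cong (proj₁ ∘ proj₂) (trans (sym (label-fixedEdge g)) (trans (cong label eq) (label-fixedEdge h)))

    ρ-fixedEdge : ∀ g → ρᵉ (fixedEdge g) ≡ fixedEdge g
    ρ-fixedEdge g = ρᵉ≡ (label-fixedEdge g) (label-fixedEdge g) (σᴸ-fixed g)

    -- Three edges of the fixed row are enough, and p, p₁, p₂ are at hand as distinct indices.
    fixedEdges : List (Fin (length edges))
    fixedEdges = map fixedEdge (p ∷ p₁ ∷ p₂ ∷ [])

    fixedEdges! : Unique fixedEdges
    fixedEdges! = Unique.map⁺ fixedEdge-injective (((p₁≢p ∘ sym) ∷ (p₂≢p ∘ sym) ∷ []) ∷ ((p₂≢p₁ ∘ sym) ∷ []) ∷ [] ∷ [])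

    lower : ∀ {e} → e ∈ lowerEdges → toℕ e < toℕ (ρᵉ e)
    lower e∈ = proj₂ (∈-filter⁻ (λ e → toℕ e <? toℕ (ρᵉ e)) {xs = allFin (length edges)} e∈)

    upper : ∀ {e} → e ∈ map ρᵉ lowerEdges → toℕ (ρᵉ e) < toℕ e
    upper {e} e∈ = let f , f∈ , e≡ = ∈-map⁻ ρᵉ e∈ in
      subst (λ g → toℕ (ρᵉ g) < toℕ g) (sym e≡) (subst (λ g → toℕ g < toℕ (ρᵉ f)) (sym (ρᵉ-involutive f)) (lower f∈))

    fixed : ∀ {e} → e ∈ fixedEdges → toℕ (ρᵉ e) ≡ toℕ e
    fixed {e} e∈ = let g , _ , e≡ = ∈-map⁻ fixedEdge e∈ in
      cong toℕ (trans (cong ρᵉ e≡) (trans (ρ-fixedEdge g) (sym e≡)))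

    -- The lower edges, their images and the fixed edges are disjoint: the position of ρ e lies
    -- respectively after, before and at that of e.
    orbits : length lowerEdges + length lowerEdges + 3 ≤ length edges
    orbits = begin
      length lowerEdges + length lowerEdges + 3
        ≡⟨ sym (trans (length-++ (lowerEdges ++ˡ map ρᵉ lowerEdges)) (cong (_+ 3) (trans (length-++ lowerEdges) (cong (length lowerEdges +_) (length-map ρᵉ lowerEdges))))) ⟩
      length ((lowerEdges ++ˡ map ρᵉ lowerEdges) ++ˡ fixedEdges)
        ≤⟨ unique-⊆-length (Unique.++⁺ (Unique.++⁺ lowerEdges! (Unique.map⁺ ρᵉ-injective lowerEdges!) lower-upper) fixedEdges! moved-fixed) (λ {e} _ → ∈-allFin e) ⟩
      length (allFin (length edges))
        ≡⟨ length-tabulate {n = length edges} (λ i → i) ⟩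
      length edges ∎
      where
      open ≤-Reasoning
      lowerEdges! : Unique lowerEdges
      lowerEdges! = Unique.filter⁺ (λ e → toℕ e <? toℕ (ρᵉ e)) (Unique.allFin⁺ (length edges))
      ρᵉ-injective : ∀ {e f} → ρᵉ e ≡ ρᵉ f → e ≡ f
      ρᵉ-injective {e} {f} eq = trans (sym (ρᵉ-involutive e)) (trans (cong ρᵉ eq) (ρᵉ-involutive f))
      lower-upper : Disjoint lowerEdges (map ρᵉ lowerEdges)
      lower-upper (e∈ , e∈′) = <-asym (lower e∈) (upper e∈′)
      moved-fixed : Disjoint (lowerEdges ++ˡ map ρᵉ lowerEdges) fixedEdges
      moved-fixed (e∈ , e∈′) =
        [ (λ e∈ˡ → <-irrefl (sym (fixed e∈′)) (lower e∈ˡ)) , (λ e∈ᵘ → <-irrefl (fixed e∈′) (upper e∈ᵘ)) ]′ (∈-++⁻ lowerEdges e∈)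

    -- With h pairs, 2h + 3 + 4 ≤ 2kN ≤ 2(n + 1), hence 2(h + 2) < 2n. Two fixed edges would give
    -- only h + 2 ≤ n.
    few-pairs : length lowerEdges + 2 < length vertices
    few-pairs = *-cancelˡ-< 2 _ _ (+-cancelʳ-≤ 2 _ _ (begin
      suc (2 * (length lowerEdges + 2)) + 2                  ≡⟨ solve 1 (λ h → con 1 :+ con 2 :* (h :+ con 2) :+ con 2 := h :+ h :+ con 3 :+ con 4) refl (length lowerEdges) ⟩
      length lowerEdges + length lowerEdges + 3 + 4          ≤⟨ +-monoˡ-≤ 4 orbits ⟩
      length edges + 4                                       ≤⟨ few-edges ⟩
      k * N + k * N                                          ≤⟨ +-mono-≤ many-vertices many-vertices ⟩
      suc (length vertices) + suc (length vertices)          ≡⟨ solve 1 (λ n → (con 1 :+ n) :+ (con 1 :+ n) := con 2 :* n :+ con 2) refl (length vertices) ⟩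
      2 * length vertices + 2                                ∎))
      where
      open ≤-Reasoning
      open +-*-Solver

    reflection : Reflection source target w
    reflection = record
      { a = a ; b = b ; c = c
      ; e₁ = e₁ ; e₂ = e₂ ; e₃ = e₃
      ; e₂≢e₁ = e₂≢e₁ ; e₃≢e₁ = e₃≢e₁ ; e₃≢e₂ = e₃≢e₂
      ; ends₁ = inj₁ (source-e₁ , target-e₁) ; ends₂ = inj₁ (source-e₂ , target-e₂) ; ends₃ = inj₂ (source-e₃ , target-e₃)
      ; at-w = at-w
      ; ρᵛ = ρᵛ ; ρᵉ = ρᵉ
      ; ρᵛ-involutive = ρᵛ-involutive ; ρᵉ-involutive = ρᵉ-involutive
      ; ends-ρ = ends-ρ
      ; ρw = ρw ; ρa = ρa ; ρb = ρb ; ρe₁ = ρe₁ ; ρe₂ = ρe₂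
      ; few-pairs = few-pairs
      }

    c₂-vanishes : c₂ 2 G ≡ 0
    c₂-vanishes = c₂-reflection G w reflection

-- Fixed edges opposite to the deleted vertex

module _ {k N : ℕ} (k≥3 : suc k ≥ 3) (N≥3 : suc N ≥ 3) (p : Fin (suc k)) (q : Fin (suc N)) where

  open Torus p q (mirror p (sucMod p)) (mirror q) (trans (sucMod-mirror p p) (mirror-centre p))
    (sucMod-≢ (≤-trans (s≤s (s≤s z≤n)) k≥3) p) (sucMod²-≢ k≥3 p) (sucMod-≢ (≤-trans (s≤s (s≤s z≤n)) k≥3) (sucMod p))
    (sucMod-≢ (≤-trans (s≤s (s≤s z≤n)) N≥3) q) sucMod-injective sucMod-injective
    (mirror-involutive q) (mirror-centre q) (sucMod-mirror q)

  -- The edges fixed by the reflection lie opposite to q: in the first direction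
  -- for even N, in the second for odd N.
  opposite : ℕ → Fin (suc N)
  opposite d = residue (toℕ q + d)

  c₂-even : ∀ d → suc N ≡ d + d → c₂ 2 G ≡ 0
  c₂-even zero      ()
  c₂-even d@(suc _) N≡ = FixedEdges.c₂-vanishes true (opposite d)
    (λ g → cong (λ h → true , (g , h)) (mirror-far q d d (sym N≡))) (λ g → r≢q ∘ cong proj₂ , r≢q ∘ cong proj₂)
    where
    r≢q : opposite d ≢ q
    r≢q = shift-≢ q d (s≤s z≤n) (subst (d <_) (sym N≡) (m<m+n d (s≤s z≤n)))

  c₂-odd : ∀ d → suc N ≡ d + suc d → c₂ 2 G ≡ 0
  c₂-odd zero N≡ = contradiction (subst (3 ≤_) N≡ N≥3) (λ { (s≤s ()) })
  c₂-odd d@(suc _) N≡ = FixedEdges.c₂-vanishes false (opposite d)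
    (λ g → cong (λ h → false , (g , h)) (trans (cong (mirror q) sucMod-r) (mirror-far q d (suc d) (sym N≡)))) (λ g → r≢q ∘ cong proj₂ , r⁺≢q ∘ cong proj₂)
    where
    sucMod-r : sucMod (opposite d) ≡ opposite (suc d)
    sucMod-r = trans (sucMod-residue (toℕ q + d)) (cong residue (sym (+-suc (toℕ q) d)))
    r≢q : opposite d ≢ q
    r≢q = shift-≢ q d (s≤s z≤n) (subst (d <_) (sym N≡) (m<m+n d (s≤s z≤n)))
    r⁺≢q : sucMod (opposite d) ≢ q
    r⁺≢q eq = shift-≢ q (suc d) (s≤s z≤n) (subst (suc d <_) (trans (+-comm (suc d) d) (sym N≡)) (m<m+n (suc d) (s≤s z≤n))) (trans (sym sucMod-r) eq)

proposition3p2 : (N k : ℕ) → N ≥ 3 → k ≥ 3 →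
    (v : Graph.Vertex (γ k □ γ N)) →
    Graph.∣V∣ ((γ k □ γ N) ∖ v) ≥ 3 * N ∸ 1 →
    c₂ 2 ((γ k □ γ N) ∖ v) ≡ 0
proposition3p2 (suc N) (suc k) N≥3 k≥3 (p , q) _ =
  let d , parity = half-of (suc N) in [ c₂-even k≥3 N≥3 p q d , c₂-odd k≥3 N≥3 p q d ]′ parity
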